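{- The vc-density of the theory of a one-based group has linear growth, provided that the group has finite dp-rank. Namely, if $G$ is a one-based group of finite dp-rank, then for every positive integer $m$ $$\mathrm{vc}^{\mathrm{Th}(G)}(m)=m\cdot\mathrm{vc}^{\mathrm{Th}(G)}(1).$$
   Context: Work in a complete theory with infinite models, inside a sufficiently saturated model. A group $G$ (possibly with additional structure) is one-based if for every $m$ any definable subset of $G^m$ is a finite boolean combination of cosets of $\mathrm{acl}^{\mathrm{eq}}(\emptyset)$-definable subgroups of $G^m$. The theory of a one-based group is stable. dp-rank. An inp-pattern of depth $\kappa$ for a partial type $\pi(x)$ is a sequence of formulas $(\varphi^\alpha(x,y^\alpha))_{\alpha<\kappa}$ together with natural numbers $(k^\alpha)_{\alpha<\kappa}$ such that there is an array of tuples $(b_i^\alpha)_{\alpha<\kappa,i<\omega}$ for which each row $\{\varphi^\alpha(x,b_i^\alpha)\}_{i<\omega}$ is $k^\alpha$-inconsistent, while for every $\eta:\kappa\to\omega$ the path $\pi(x)\cup\{\varphi^\alpha(x,b^\alpha_{\eta(\alpha)})\}_{\alpha<\kappa}$ is consistent. In a stable theory the dp-rank of $\pi$ is the supremum of the cardinals $\kappa$ for which there is an inp-pattern of depth $\kappa$ for $\pi$. The dp-rank of $G$ is the dp-rank of $\{x=x\}$ with $x$ a single variable. vc-density. For a class $\mathcal S$ of subsets of a set $X$, the shatter function is $\pi_{\mathcal S}(n)=\max\{|\{C\cap A:C\in\mathcal S\}|: A\subseteq X,|A|=n\}$, and $\mathrm{vc}(\mathcal S)$ is the infimum of the reals $r\ge0$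 with $\pi_{\mathcal S}(n)=O(n^r)$ ($\infty$ if there is none). For a formula $\varphi(x;y)$ with object variables $x$ and parameter variables $y$, $\mathcal S_\varphi=\{\varphi(\mathbb M;b):b\in\mathbb M^{|y|}\}$ for $\mathbb M$ a sufficiently saturated model of $T$. The vc-density of $T$ is the function $\mathrm{vc}^T(n)=\sup\{\mathrm{vc}(\mathcal S_\varphi):\varphi(x;y)\text{ a formula of }T\text{ with }|y|=n\}$. -}

module Defs where

open import Level using (Level; _⊔_) renaming (suc to lsuc)
open import Algebra.Structures using (IsGroup)
open import Data.Empty.Polymorphic using (⊥)
open import Data.Unit.Polymorphic using (⊤)
open import Data.Fin using (Fin; zero; suc)
open import Data.Fin.Subset using (Subset) renaming (_∈_ to _∈ₛ_)
open import Data.Integer using (+_; ∣_∣)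
open import Data.List using (List; []; _∷_; length)
open import Data.List.Membership.Propositional using (_∈_)
open import Data.List.Relation.Unary.All as All using (All; []; _∷_)
open import Data.List.Relation.Unary.Any using (Any)
open import Data.List.Relation.Unary.Unique.Propositional using (Unique)
open import Data.Nat as ℕ using (ℕ; zero; suc; NonZero)
open import Data.Product using (Σ; Σ-syntax; ∃; ∃-syntax; _×_; _,_; proj₁; proj₂)
open import Data.Rational as ℚ using (ℚ; 0ℚ; _/_; ↥_; ↧ₙ_)
import Data.Rational.Properties as ℚₚ
open import Data.Sum using (_⊎_; inj₁; inj₂; [_,_])
open import Data.Vec as Vec using (Vec; []; _∷_)
open import Function.Bundles using (_⇔_; _↣_; module Injection)
open import Relation.Binary.PropositionalEquality using (_≡_; subst)
open import Relation.Binary.Structures using (IsEquivalence)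
open import Relation.Nullary using (¬_)
open import Relation.Unary using (Pred; _≐_; ∁; _∪_; _∩_)

private variable
  ℓ c p i b s : Level

record Language (ℓ : Level) : Set (lsuc ℓ) where
  field
    Functions : ℕ → Set ℓ
    Relations : ℕ → Set ℓ

open Language public

record Structure (L : Language ℓ) (c : Level) : Set (ℓ ⊔ lsuc c) where
  field
    Carrier : Set c
    fun     : ∀ {n} → Functions L n → Vec Carrier n → Carrier
    rel     : ∀ {n} → Relations L n → Vec Carrier n → Set c

open Structure public

-- Variables are de Bruijn indices: `all′` binds variable `zero`.  The
-- connectives form a complete set for classical logic.
data Term (L : Language ℓ) (n : ℕ) : Set ℓ where
  var : Fin n → Term L n
  app : ∀ {k} → Functions L k → Vec (Term L n) k → Term L n

data Formula (L : Language ℓ) (n : ℕ) : Set ℓ where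
  false : Formula L n
  _≗_   : Term L n → Term L n → Formula L n
  relₐ  : ∀ {k} → Relations L k → Vec (Term L n) k → Formula L n
  _⇒_   : Formula L n → Formula L n → Formula L n
  all′  : Formula L (suc n) → Formula L n

module _ {L : Language ℓ} (𝕄 : Structure L c) where

  eval  : ∀ {n} → Term L n → Vec (Carrier 𝕄) n → Carrier 𝕄
  evals : ∀ {n k} → Vec (Term L n) k → Vec (Carrier 𝕄) n → Vec (Carrier 𝕄) k
  eval (var x)    ρ = Vec.lookup ρ x
  eval (app f ts) ρ = fun 𝕄 f (evals ts ρ)
  evals []       ρ = []
  evals (t ∷ ts) ρ = eval t ρ ∷ evals ts ρ

  infix 4 _⊨_[_]
  _⊨_[_] : ∀ {n} → Formula L n → Vec (Carrier 𝕄) n → Set c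
  _⊨_[_] false       ρ = ⊥
  _⊨_[_] (t ≗ u)     ρ = eval t ρ ≡ eval u ρ
  _⊨_[_] (relₐ R ts) ρ = rel 𝕄 R (evals ts ρ)
  _⊨_[_] (φ ⇒ ψ)     ρ = _⊨_[_] φ ρ → _⊨_[_] ψ ρ
  _⊨_[_] (all′ φ)    ρ = ∀ a → _⊨_[_] φ (a ∷ ρ)

-- The set φ(𝕄; b) for a partitioned formula φ(x; y): the object
-- variables x come first, the parameter variables y after them.
instanceOf : {L : Language ℓ} (𝕄 : Structure L c) {n k : ℕ} →
             Formula L (n ℕ.+ k) → Vec (Carrier 𝕄) k → Pred (Vec (Carrier 𝕄) n) c
instanceOf 𝕄 φ b a = 𝕄 ⊨ φ [ a Vec.++ b ]

record PartialType {L : Language ℓ} (𝕄 : Structure L c) (n : ℕ) : Set (lsuc ℓ ⊔ c) where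
  field
    Index   : Set ℓ
    arity   : Index → ℕ
    formula : (j : Index) → Formula L (n ℕ.+ arity j)
    param   : (j : Index) → Vec (Carrier 𝕄) (arity j)

open PartialType public

module _ {L : Language ℓ} {𝕄 : Structure L c} {n : ℕ} where

  member : (π : PartialType 𝕄 n) → Index π → Pred (Vec (Carrier 𝕄) n) c
  member π j = instanceOf 𝕄 (formula π j) (param π j)

  Realised : PartialType 𝕄 n → Set (ℓ ⊔ c)
  Realised π = ∃[ a ] (∀ j → member π j a)

  -- Consistency with the elementary diagram of 𝕄, that is, finite
  -- satisfiability in 𝕄.
  Consistent : PartialType 𝕄 n → Set (ℓ ⊔ c)
  Consistent π = ∀ (js : List (Index π)) → ∃[ a ] All (λ j → member π j a) js

  infixr 6 _∪ₜ_
  _∪ₜ_ : PartialType 𝕄 n → PartialType 𝕄 n → PartialType 𝕄 n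
  π ∪ₜ σ = record
    { Index   = Index π ⊎ Index σ
    ; arity   = [ arity π , arity σ ]
    ; formula = λ { (inj₁ j) → formula π j ; (inj₂ j) → formula σ j }
    ; param   = λ { (inj₁ j) → param π j ; (inj₂ j) → param σ j }
    }

-- "Sufficiently saturated": cardinals are small when they are represented
-- in the universe Set ℓ of the language.  There are then as many formulas
-- over a small parameter set as there are elements of a small type, so a
-- partial type over a small parameter set is a family indexed by a small
-- type.  The carrier lives in a universe Set c that may be larger (and, for
-- an infinite carrier, has to be).
Saturated : {L : Language ℓ} → Structure L c → Set (lsuc ℓ ⊔ c)
Saturated 𝕄 = ∀ n (π : PartialType 𝕄 n) → Consistent π → Realised π

-- `inconsistent` is k-inconsistency of the row as an indexed family: any k
-- formulas with distinct indices are jointly inconsistent.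
record InpPattern {L : Language ℓ} {𝕄 : Structure L c} {n : ℕ}
                  (π : PartialType 𝕄 n) (κ : Set ℓ) : Set (ℓ ⊔ c) where
  field
    len   : κ → ℕ
    φ     : (α : κ) → Formula L (n ℕ.+ len α)
    k     : κ → ℕ
    array : (α : κ) → ℕ → Vec (Carrier 𝕄) (len α)

  path : (κ → ℕ) → PartialType 𝕄 n
  path η = record { Index = κ ; arity = len ; formula = φ ; param = λ α → array α (η α) }

  field
    inconsistent : ∀ α (e : Fin (k α) ↣ ℕ) →
                   ¬ (∃[ a ] ∀ j → instanceOf 𝕄 (φ α) (array α (Injection.to e j)) a)
    consistent   : ∀ η → Consistent (π ∪ₜ path η)

-- The supremum of the depths κ is finite iff some natural number bounds
-- every depth.
FiniteDpRank : {L : Language ℓ} {𝕄 : Structure L c} {n : ℕ} →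
               PartialType 𝕄 n → Set (lsuc ℓ ⊔ c)
FiniteDpRank {ℓ = ℓ} π = ∃[ d ] ∀ (κ : Set ℓ) → InpPattern π κ → κ ↣ Fin d

-- {x = x}, with x a single variable.
x=x : {L : Language ℓ} (𝕄 : Structure L c) → PartialType 𝕄 1
x=x 𝕄 = record
  { Index   = ⊤
  ; arity   = λ _ → 0
  ; formula = λ _ → var zero ≗ var zero
  ; param   = λ _ → []
  }

-- 𝕄^eq as a many-sorted structure.  Besides the home sort there is a sort
-- for each ∅-definable equivalence relation E on a power of 𝕄.  An element
-- of that sort is given by a representative tuple, and equality of the
-- sort is E.
module Eq {L : Language ℓ} (𝕄 : Structure L c) where

  record DefinableEquivalence : Set (ℓ ⊔ c) where
    field
      dim           : ℕ
      E             : Formula L (dim ℕ.+ dim)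
      isEquivalence : IsEquivalence (λ (a b : Vec (Carrier 𝕄) dim) → 𝕄 ⊨ E [ a Vec.++ b ])

  open DefinableEquivalence public

  data Sort : Set (ℓ ⊔ c) where
    home : Sort
    quot : DefinableEquivalence → Sort

  ⟦_⟧ : Sort → Set c
  ⟦ home ⟧   = Carrier 𝕄
  ⟦ quot ε ⟧ = Vec (Carrier 𝕄) (dim ε)

  ≈[_] : (s : Sort) → ⟦ s ⟧ → ⟦ s ⟧ → Set c
  ≈[ home ]   a b = a ≡ b
  ≈[ quot ε ] a b = 𝕄 ⊨ E ε [ a Vec.++ b ]

  Context : Set (ℓ ⊔ c)
  Context = List Sort

  Env : Context → Set (ℓ ⊔ c)
  Env = All ⟦_⟧

  data Termᵉ (Γ : Context) : Sort → Set (ℓ ⊔ c) where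
    var  : ∀ {s} → s ∈ Γ → Termᵉ Γ s
    app  : ∀ {k} → Functions L k → Vec (Termᵉ Γ home) k → Termᵉ Γ home
    proj : ∀ ε → Vec (Termᵉ Γ home) (dim ε) → Termᵉ Γ (quot ε)

  data Formulaᵉ (Γ : Context) : Set (ℓ ⊔ c) where
    false : Formulaᵉ Γ
    eq    : ∀ s → Termᵉ Γ s → Termᵉ Γ s → Formulaᵉ Γ
    relₐ  : ∀ {k} → Relations L k → Vec (Termᵉ Γ home) k → Formulaᵉ Γ
    _⇒_   : Formulaᵉ Γ → Formulaᵉ Γ → Formulaᵉ Γ
    all′  : ∀ s → Formulaᵉ (s ∷ Γ) → Formulaᵉ Γ

  evalᵉ  : ∀ {Γ s} → Termᵉ Γ s → Env Γ → ⟦ s ⟧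
  evalsᵉ : ∀ {Γ k} → Vec (Termᵉ Γ home) k → Env Γ → Vec (Carrier 𝕄) k
  evalᵉ (var x)     ρ = All.lookup ρ x
  evalᵉ (app f ts)  ρ = fun 𝕄 f (evalsᵉ ts ρ)
  evalᵉ (proj ε ts) ρ = evalsᵉ ts ρ
  evalsᵉ []       ρ = []
  evalsᵉ (t ∷ ts) ρ = evalᵉ t ρ ∷ evalsᵉ ts ρ

  ⊨ᵉ_[_] : ∀ {Γ} → Formulaᵉ Γ → Env Γ → Set c
  ⊨ᵉ false     [ ρ ] = ⊥
  ⊨ᵉ eq s t u  [ ρ ] = ≈[ s ] (evalᵉ t ρ) (evalᵉ u ρ)
  ⊨ᵉ relₐ R ts [ ρ ] = rel 𝕄 R (evalsᵉ ts ρ)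
  ⊨ᵉ φ ⇒ ψ     [ ρ ] = ⊨ᵉ φ [ ρ ] → ⊨ᵉ ψ [ ρ ]
  ⊨ᵉ all′ s φ  [ ρ ] = ∀ (a : ⟦ s ⟧) → ⊨ᵉ φ [ a ∷ ρ ]

  -- e lies in a finite ∅-definable set.
  Algebraic : ∀ s → ⟦ s ⟧ → Set (ℓ ⊔ c)
  Algebraic s e = Σ[ θ ∈ Formulaᵉ (s ∷ []) ]
      ⊨ᵉ θ [ e ∷ [] ]
    × ∃[ es ] (∀ e′ → ⊨ᵉ θ [ e′ ∷ [] ] → Any (≈[ s ] e′) es)

  aclᵉ : Sort → Set (ℓ ⊔ c)
  aclᵉ s = ∃ (Algebraic s)

  homes : ℕ → Context → Context
  homes zero    Γ = Γ
  homes (suc m) Γ = home ∷ homes m Γ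

  _++ᵉ_ : ∀ {m Γ} → Vec (Carrier 𝕄) m → Env Γ → Env (homes m Γ)
  []      ++ᵉ ρ = ρ
  (a ∷ v) ++ᵉ ρ = a ∷ (v ++ᵉ ρ)

  AclEqDefinable : ∀ {m} → Pred (Vec (Carrier 𝕄) m) c → Set (ℓ ⊔ c)
  AclEqDefinable {m} D =
    ∃[ Γ ] Σ[ ψ ∈ Formulaᵉ (homes m Γ) ] Σ[ es ∈ All aclᵉ Γ ]
      D ≐ (λ a → ⊨ᵉ ψ [ a ++ᵉ All.map proj₁ es ])

-- A group, possibly with additional structure: a structure in a language
-- with a distinguished binary function symbol, interpreted by a group law.
record ExpandedGroup (ℓ c : Level) : Set (lsuc (ℓ ⊔ c)) where
  field
    language  : Language ℓ
    mul       : Functions language 2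
    structure : Structure language c

  _∙_ : Carrier structure → Carrier structure → Carrier structure
  x ∙ y = fun structure mul (x ∷ y ∷ [])

  field
    unit    : Carrier structure
    _⁻¹     : Carrier structure → Carrier structure
    isGroup : IsGroup _≡_ _∙_ unit _⁻¹

open ExpandedGroup public using (structure)

data BooleanCombination {a} {X : Set a} (𝒮 : Pred (Pred X p) s) : Pred X p → Set (a ⊔ lsuc p ⊔ s) where
  gen  : ∀ {C} → 𝒮 C → BooleanCombination 𝒮 C
  comp : ∀ {P} → BooleanCombination 𝒮 P → BooleanCombination 𝒮 (∁ P)
  cup  : ∀ {P Q} → BooleanCombination 𝒮 P → BooleanCombination 𝒮 Q → BooleanCombination 𝒮 (P ∪ Q)
  cap  : ∀ {P Q} → BooleanCombination 𝒮 P → BooleanCombination 𝒮 Q → BooleanCombination 𝒮 (P ∩ Q)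
  resp : ∀ {P Q} → P ≐ Q → BooleanCombination 𝒮 P → BooleanCombination 𝒮 Q

module _ (G : ExpandedGroup ℓ c) where
  open ExpandedGroup G using (language; _∙_; unit; _⁻¹)

  private
    M : Set c
    M = Carrier (structure G)

  record IsSubgroup {m : ℕ} (H : Pred (Vec M m) c) : Set c where
    field
      unit-closed : H (Vec.replicate m unit)
      mul-closed  : ∀ {x y} → H x → H y → H (Vec.zipWith _∙_ x y)
      inv-closed  : ∀ {x} → H x → H (Vec.map _⁻¹ x)

  leftCoset : {m : ℕ} → Vec M m → Pred (Vec M m) c → Pred (Vec M m) c
  leftCoset g H x = ∃[ h ] H h × x ≡ Vec.zipWith _∙_ g h

  CosetOfAclEqSubgroup : {m : ℕ} → Pred (Pred (Vec M m) c) (ℓ ⊔ lsuc c)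
  CosetOfAclEqSubgroup C =
    ∃[ H ] IsSubgroup H × Eq.AclEqDefinable (structure G) H × ∃[ g ] C ≐ leftCoset g H

  -- "Definable" allows parameters.
  OneBased : Set (ℓ ⊔ lsuc c)
  OneBased = ∀ m k (φ : Formula language (m ℕ.+ k)) (b : Vec M k) →
             BooleanCombination CosetOfAclEqSubgroup (instanceOf (structure G) φ b)

-- A point of [0,∞] is given by the set of rationals strictly above it; the
-- empty set is ∞.
record ℝ≥0∞ (p : Level) : Set (lsuc p) where
  field
    Above    : ℚ → Set p
    positive : ∀ {q} → Above q → 0ℚ ℚ.< q
    upward   : ∀ {q r} → Above q → q ℚ.< r → Above r
    rounded  : ∀ {q} → Above q → ∃[ r ] r ℚ.< q × Above r

open ℝ≥0∞ public

infix 4 _≈_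
_≈_ : ℝ≥0∞ p → ℝ≥0∞ i → Set (p ⊔ i)
x ≈ y = ∀ q → Above x q ⇔ Above y q

inf : (S : ℚ → Set p) → (∀ {r} → S r → 0ℚ ℚ.≤ r) → ℝ≥0∞ p
inf S nonneg = record
  { Above    = λ q → ∃[ r ] S r × r ℚ.< q
  ; positive = λ { (r , Sr , r<q) → ℚₚ.≤-<-trans (nonneg Sr) r<q }
  ; upward   = λ { (r , Sr , r<q) q<q′ → r , Sr , ℚₚ.<-trans r<q q<q′ }
  ; rounded  = λ { (r , Sr , r<q) → let (t , r<t , t<q) = ℚₚ.<-dense r<q
                                    in t , t<q , r , Sr , r<t }
  }

-- q is strictly above the supremum iff some r < q is above every member;
-- 0 ≤ r makes the supremum of the empty family 0.
sup : {I : Set i} → (I → ℝ≥0∞ p) → ℝ≥0∞ (i ⊔ p)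
sup x = record
  { Above    = λ q → ∃[ r ] 0ℚ ℚ.≤ r × r ℚ.< q × (∀ j → Above (x j) r)
  ; positive = λ { (r , 0≤r , r<q , _) → ℚₚ.≤-<-trans 0≤r r<q }
  ; upward   = λ { (r , 0≤r , r<q , h) q<q′ → r , 0≤r , ℚₚ.<-trans r<q q<q′ , h }
  ; rounded  = λ { (r , 0≤r , r<q , h) → let (t , r<t , t<q) = ℚₚ.<-dense r<q
                                         in t , t<q , r , 0≤r , r<t , h }
  }

-- Multiplication by a positive natural number.
infixr 7 _·_
_·_ : (m : ℕ) .{{_ : NonZero m}} → ℝ≥0∞ p → ℝ≥0∞ p
suc n · x = record
  { Above    = λ q → ∃[ r ] Above x r × m ℚ.* r ℚ.≤ q
  ; positive = λ { (r , xr , mr≤q) → ℚₚ.<-≤-trans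
                     (subst (ℚ._< m ℚ.* r) (ℚₚ.*-zeroʳ m) (mono (positive x xr))) mr≤q }
  ; upward   = λ { (r , xr , mr≤q) q<q′ → r , xr , ℚₚ.≤-trans mr≤q (ℚₚ.<⇒≤ q<q′) }
  ; rounded  = λ { (r , xr , mr≤q) → let (t , t<r , xt) = rounded x xr
                                     in m ℚ.* t , ℚₚ.<-≤-trans (mono t<r) mr≤q , t , xt , ℚₚ.≤-refl }
  }
  where
  m : ℚ
  m = + suc n / 1
  mono : ∀ {a b} → a ℚ.< b → m ℚ.* a ℚ.< m ℚ.* b
  mono = ℚₚ.*-monoʳ-<-pos m {{ℚₚ.normalize-pos (suc n) 1}}

HasCardinality : {A : Set i} → Pred A p → ℕ → Set (i ⊔ p)
HasCardinality {A = A} P k =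
  Σ[ xs ∈ List A ] Unique xs × (∀ x → P x ⇔ (x ∈ xs)) × length xs ≡ k

module _ {X : Set i} {B : Set b} (𝒮 : B → Pred X p) where

  -- The sets C ∩ A for C in the class, where A = {a₀,…,aₙ₋₁} has exactly n
  -- elements, as sets of indices.
  Trace : ∀ {n} → Fin n ↣ X → Pred (Subset n) (b ⊔ p)
  Trace a T = ∃[ y ] ∀ j → (j ∈ₛ T) ⇔ 𝒮 y (Injection.to a j)

  -- k is the value at n of the shatter function.
  IsShatterValue : ℕ → ℕ → Set (i ⊔ b ⊔ p)
  IsShatterValue n k =
      (Σ[ a ∈ Fin n ↣ X ] HasCardinality (Trace a) k)
    × (∀ (a : Fin n ↣ X) k′ → HasCardinality (Trace a) k′ → k′ ℕ.≤ k)

  -- The shatter function is O(n^r).  For r = u/d with d > 0 the bound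
  -- π(n) ≤ C·n^r is written π(n)^d ≤ C·n^u (with another constant C).
  GrowthBound : ℚ → Set (i ⊔ b ⊔ p)
  GrowthBound r = 0ℚ ℚ.≤ r × ∃[ C ] ∃[ N ] ∀ n k → N ℕ.≤ n → IsShatterValue n k →
                  k ℕ.^ ↧ₙ r ℕ.≤ C ℕ.* n ℕ.^ ∣ ↥ r ∣

  -- The infimum over real exponents equals that over rational ones, since
  -- a bound O(n^r) implies O(n^q) for all q ≥ r.
  vc : ℝ≥0∞ (i ⊔ b ⊔ p)
  vc = inf GrowthBound proj₁

-- vc^T(n) for T the theory of the sufficiently saturated structure 𝕄: the
-- supremum is over formulas φ(x; y) with x of any finite length, |y| = n.
vcDensity : {L : Language ℓ} → Structure L c → ℕ → ℝ≥0∞ (ℓ ⊔ c)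
vcDensity {L = L} 𝕄 n =
  sup {I = Σ[ k ∈ ℕ ] Formula L (k ℕ.+ n)} (λ { (k , φ) → vc (instanceOf 𝕄 {k} {n} φ) })

-- For a one-based group both sides are read off from the definable subgroups
-- of Gᵐ up to commensurability.  Call finitely many definable subgroups
-- irredundant if dropping any one of them enlarges the intersection by an
-- infinite index, and let b(m) be the largest size of an irredundant family
-- in Gᵐ.
--
-- Upper bound vc(m) ≤ b(m).  By one-basedness φ(x; y) is a Boolean combination
-- of cosets of finitely many subgroups of Gᵏ⁺ᵐ, so the traces on n points are
-- the cells cut out by n cosets of each of finitely many subgroups of Gᵐ.  An
-- intersection of such subgroups is commensurable to one of at most b(m) of
-- them, which leaves O(n^b(m)) cells.
--
-- Lower bound vc(m) ≥ b(m).  Let K₁, …, Kₛ be irredundant.  If elements aᵢⱼ of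
-- the intersection of the K_l with l ≠ i lie in distinct double cosets of Kᵢ,
-- then the product of the a_{i,η(i)} lies in Kᵢ aᵢⱼ Kᵢ iff j = η(i), so s·t
-- double cosets have at least tˢ traces.  Infinitely many double cosets exist
-- because generic elements normalise Kᵢ up to commensurability: acl^eq(∅)-
-- definable subgroups lie in finite ∅-definable families, so the conjugates of
-- Kᵢ fall into boundedly many commensurability classes.
--
-- Finally b(m) = m·b(1), since irredundant families in a product add up and a
-- modular-law argument splits a family in Gᵏ⁺ᵐ into one in Gᵏ and one in Gᵐ.
module Submission where

open import Defs
open import Algebra.Bundles using (Group)
import Algebra.Properties.Group as GroupProperties
open import Algebra.Structures using (IsGroup)
open import Axiom.ExcludedMiddle using (ExcludedMiddle)
open import Data.Bool using (Bool; true; false)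
open import Data.Empty using (⊥-elim; ⊥)
import Data.Empty.Polymorphic as ⊥ₚ
open import Data.Fin using (Fin; zero; suc; _↑ˡ_; _↑ʳ_; combine; remQuot; finToFun; funToFin; _≟_)
import Data.Fin.Properties as Finₚ
open import Data.Fin.Subset using (Subset; inside; outside) renaming (_∈_ to _∈ₛ_)
import Data.Fin.Subset.Properties as Subsetₚ
open import Data.Integer as ℤ using (ℤ; +_; ∣_∣; +≤+)
import Data.Integer.Properties as ℤₚ
open import Data.List as List using (List; []; _∷_; length; _++_; cartesianProductWith; cartesianProduct; filter)
open import Data.List.Membership.Propositional using (_∈_; find)
open import Data.List.Membership.Propositional.Properties using (∈-map⁺; ∈-++⁺ˡ; ∈-++⁺ʳ; ∈-cartesianProductWith⁺; ∈-cartesianProduct⁺; ∈-allFin; ∈-filter⁺; ∈-map⁻; ∈-++⁻; ∈-∃++; ∈-lookup)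
import Data.List.Properties as Listₚ
open import Data.List.Relation.Binary.Permutation.Propositional using (_↭_; ↭-sym; ↭-trans; prep; ↭-refl; swap)
open import Data.List.Relation.Binary.Permutation.Propositional.Properties using (↭-map-inv; ↭-length; shift; drop-∷; ∈-resp-↭; ++⁺ˡ; ++⁺ʳ; map⁺)
open import Data.List.Relation.Unary.All as All using (All; []; _∷_)
import Data.List.Relation.Unary.All.Properties as Allₚ
open import Data.List.Relation.Unary.Any as Any using (Any; here; there)
import Data.List.Relation.Unary.Any.Properties as Anyₚ
open import Data.List.Relation.Unary.Unique.Propositional using (Unique; []; _∷_)
import Data.List.Relation.Unary.Unique.Propositional.Properties as Uniqueₚ
open import Data.Nat using (ℕ; zero; suc; NonZero; _+_; _≤_; z≤n; s≤s; _*_; _^_; _<_)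
import Data.Nat.Coprimality as Coprimality
open import Data.Nat.ListAction using (sum)
import Data.Nat.Properties as ℕₚ
open import Data.Product using (Σ-syntax; ∃; ∃-syntax; _×_; _,_; proj₁; proj₂)
open import Data.Rational as ℚ using (ℚ; mkℚ; 0ℚ; _/_; ↥_; ↧ₙ_; *≤*)
import Data.Rational.Properties as ℚₚ
open import Data.Sum using (_⊎_; inj₁; inj₂)
import Data.Unit.Polymorphic as ⊤ₚ
open import Data.Vec as Vec using (Vec; []; _∷_)
import Data.Vec.Properties as Vecₚ
open import Function.Base using (_∘_; id; case_of_)
open import Function.Bundles using (_⇔_; mk⇔; _↣_; module Equivalence; module Injection; mk↣)
import Function.Properties.Equivalence as ⇔
open import Level using (Level; _⊔_) renaming (suc to lsuc)
open import Relation.Binary.PropositionalEquality hiding (_≗_; isEquivalence; J)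
import Relation.Binary.PropositionalEquality.Properties as ≡ₚ
open import Relation.Binary.Structures using (IsEquivalence)
open import Relation.Nullary using (¬_; Dec; yes; no; ¬?)
open import Relation.Unary using (Pred; _∪_; _∩_)

open Equivalence using (to; from)

≡⇒⇔ : ∀ {a} {A B : Set a} → A ≡ B → A ⇔ B
≡⇒⇔ refl = ⇔.refl

-- Renaming of variables in terms and formulas.

module _ {ℓ} {L : Language ℓ} where

  renTerm  : ∀ {m n} → Vec (Fin n) m → Term L m → Term L n
  renTerms : ∀ {m n k} → Vec (Fin n) m → Vec (Term L m) k → Vec (Term L n) k
  renTerm ξ (var x)    = var (Vec.lookup ξ x)
  renTerm ξ (app f ts) = app f (renTerms ξ ts)
  renTerms ξ []       = []
  renTerms ξ (t ∷ ts) = renTerm ξ t ∷ renTerms ξ ts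

  renFormula : ∀ {m n} → Vec (Fin n) m → Formula L m → Formula L n
  renFormula ξ false       = false
  renFormula ξ (t ≗ u)     = renTerm ξ t ≗ renTerm ξ u
  renFormula ξ (relₐ R ts) = relₐ R (renTerms ξ ts)
  renFormula ξ (φ ⇒ ψ)     = renFormula ξ φ ⇒ renFormula ξ ψ
  renFormula ξ (all′ φ)    = all′ (renFormula (zero ∷ Vec.map suc ξ) φ)

leftIdx : ∀ m n → Vec (Fin (m + n)) m
leftIdx m n = Vec.map (_↑ˡ n) (Vec.allFin m)

rightIdx : ∀ m n → Vec (Fin (m + n)) n
rightIdx m n = Vec.map (m ↑ʳ_) (Vec.allFin n)

module _ {a} {A : Set a} where

  map-lookup-map : ∀ {k m n} (ρ : Vec A n) (f : Fin m → Fin n) (σ : Vec A m) →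
                   (∀ i → Vec.lookup ρ (f i) ≡ Vec.lookup σ i) → (ξ : Vec (Fin m) k) →
                   Vec.map (Vec.lookup ρ) (Vec.map f ξ) ≡ Vec.map (Vec.lookup σ) ξ
  map-lookup-map ρ f σ h ξ = trans (sym (Vecₚ.map-∘ _ _ ξ)) (Vecₚ.map-cong h ξ)

  map-lookup-leftIdx : ∀ {m n} (x : Vec A m) (y : Vec A n) →
                       Vec.map (Vec.lookup (x Vec.++ y)) (leftIdx m n) ≡ x
  map-lookup-leftIdx x y =
    trans (map-lookup-map (x Vec.++ y) (_↑ˡ _) x (Vecₚ.lookup-++ˡ x y) (Vec.allFin _)) (Vecₚ.map-lookup-allFin x)

  map-lookup-rightIdx : ∀ {m n} (x : Vec A m) (y : Vec A n) →
                        Vec.map (Vec.lookup (x Vec.++ y)) (rightIdx m n) ≡ y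
  map-lookup-rightIdx x y =
    trans (map-lookup-map (x Vec.++ y) (_ ↑ʳ_) y (Vecₚ.lookup-++ʳ x y) (Vec.allFin _)) (Vecₚ.map-lookup-allFin y)

-- Closure properties of definable relations and functions.

module Definability (em : ∀ {a} → ExcludedMiddle a)
                    {ℓ c} {L : Language ℓ} (𝕄 : Structure L c) where

  private M = Carrier 𝕄

  evals≡map : ∀ {k n} (ts : Vec (Term L n) k) ρ → evals 𝕄 ts ρ ≡ Vec.map (λ t → eval 𝕄 t ρ) ts
  evals≡map []       ρ = refl
  evals≡map (t ∷ ts) ρ = cong (_ ∷_) (evals≡map ts ρ)

  eval-ren  : ∀ {m n} (ξ : Vec (Fin n) m) t ρ →
              eval 𝕄 (renTerm ξ t) ρ ≡ eval 𝕄 t (Vec.map (Vec.lookup ρ) ξ)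
  evals-ren : ∀ {m n k} (ξ : Vec (Fin n) m) (ts : Vec _ k) ρ →
              evals 𝕄 (renTerms ξ ts) ρ ≡ evals 𝕄 ts (Vec.map (Vec.lookup ρ) ξ)
  eval-ren ξ (var x)    ρ = sym (Vecₚ.lookup-map x (Vec.lookup ρ) ξ)
  eval-ren ξ (app f ts) ρ = cong (fun 𝕄 f) (evals-ren ξ ts ρ)
  evals-ren ξ []       ρ = refl
  evals-ren ξ (t ∷ ts) ρ = cong₂ _∷_ (eval-ren ξ t ρ) (evals-ren ξ ts ρ)

  ⊨-ren : ∀ {m n} (ξ : Vec (Fin n) m) φ ρ →
          𝕄 ⊨ renFormula ξ φ [ ρ ] ⇔ 𝕄 ⊨ φ [ Vec.map (Vec.lookup ρ) ξ ]
  ⊨-ren ξ false       ρ = ⇔.refl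
  ⊨-ren ξ (t ≗ u)     ρ = ≡⇒⇔ (cong₂ _≡_ (eval-ren ξ t ρ) (eval-ren ξ u ρ))
  ⊨-ren ξ (relₐ R ts) ρ = ≡⇒⇔ (cong (rel 𝕄 R) (evals-ren ξ ts ρ))
  ⊨-ren ξ (φ ⇒ ψ)     ρ = mk⇔ (λ h → to (⊨-ren ξ ψ ρ) ∘ h ∘ from (⊨-ren ξ φ ρ))
                               (λ h → from (⊨-ren ξ ψ ρ) ∘ h ∘ to (⊨-ren ξ φ ρ))
  ⊨-ren ξ (all′ φ)    ρ = mk⇔ (λ h a → subst (𝕄 ⊨ φ [_]) (lift a) (to (⊨-ren _ φ (a ∷ ρ)) (h a)))
                               (λ h a → from (⊨-ren _ φ (a ∷ ρ)) (subst (𝕄 ⊨ φ [_]) (sym (lift a)) (h a)))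
    where
    lift : ∀ a → Vec.map (Vec.lookup (a ∷ ρ)) (zero ∷ Vec.map suc ξ) ≡ a ∷ Vec.map (Vec.lookup ρ) ξ
    lift a = cong (a ∷_) (map-lookup-map (a ∷ ρ) suc ρ (λ _ → refl) ξ)

  -- Variables come in blocks: a context lists the lengths of tuples, so that quantifiers and
  -- functions act on whole tuples at once.
  Env : List ℕ → Set c
  Env = All (Vec M)

  flat : ∀ {Γ} → Env Γ → Vec M (sum Γ)
  flat []      = []
  flat (x ∷ ρ) = x Vec.++ flat ρ

  -- The predicate is kept next to a parameter-free formula for it. Definability can then be proved
  -- along the structure of `P`, and de Bruijn indices do not appear again.
  Def : ∀ {Γ} → Pred (Env Γ) c → Set (ℓ ⊔ c)
  Def {Γ} P = Σ[ φ ∈ Formula L (sum Γ) ] ∀ ρ → 𝕄 ⊨ φ [ flat ρ ] ⇔ P ρ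

  private
    variable
      Γ : List ℕ
      P Q : Pred (Env Γ) c
      j k l : ℕ

  Def-resp : (∀ ρ → P ρ ⇔ Q ρ) → Def P → Def Q
  Def-resp h (φ , p) = φ , λ ρ → ⇔.trans (p ρ) (h ρ)

  Def-⊥ : Def {Γ} (λ _ → ⊥ₚ.⊥)
  Def-⊥ = false , λ _ → ⇔.refl

  Def-→ : Def P → Def Q → Def (λ ρ → P ρ → Q ρ)
  Def-→ (φ , p) (ψ , q) = (φ ⇒ ψ) , λ ρ → mk⇔ (λ h → to (q ρ) ∘ h ∘ from (p ρ)) (λ h → from (q ρ) ∘ h ∘ to (p ρ))

  Def-¬ : Def P → Def (λ ρ → ¬ P ρ)
  Def-¬ p = Def-resp (λ ρ → mk⇔ (λ h x → ⊥ₚ.⊥-elim (h x)) (λ h x → ⊥-elim (h x))) (Def-→ p Def-⊥)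

  ¬¬-elim : ∀ {a} {A : Set a} → ¬ ¬ A → A
  ¬¬-elim {A = A} h with em {P = A}
  ... | yes x = x
  ... | no ¬x = ⊥-elim (h ¬x)

  Def-× : Def P → Def Q → Def (λ ρ → P ρ × Q ρ)
  Def-× p q = Def-resp (λ ρ → mk⇔ (λ h → ¬¬-elim λ k → h λ x y → k (x , y)) (λ { (x , y) h → h x y }))
                       (Def-¬ (Def-→ p (Def-¬ q)))

  Def-⊎ : Def P → Def Q → Def (λ ρ → P ρ ⊎ Q ρ)
  Def-⊎ p q = Def-resp (λ ρ → mk⇔ (λ h → ¬¬-elim λ k → k (inj₂ (h (k ∘ inj₁))))
                                  (λ { (inj₁ x) h → ⊥-elim (h x) ; (inj₂ y) h → y }))
                       (Def-→ (Def-¬ p) q)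

  alls : ∀ k {n} → Formula L (k + n) → Formula L n
  alls zero    φ = φ
  alls (suc k) φ = alls k (all′ φ)

  ⊨-alls : ∀ k {n} (φ : Formula L (k + n)) ρ → 𝕄 ⊨ alls k φ [ ρ ] ⇔ (∀ (v : Vec M k) → 𝕄 ⊨ φ [ v Vec.++ ρ ])
  ⊨-alls zero    φ ρ = mk⇔ (λ { h [] → h }) (λ h → h [])
  ⊨-alls (suc k) φ ρ = mk⇔ (λ { h (a ∷ v) → to (⊨-alls k (all′ φ) ρ) h v a })
                           (λ h → from (⊨-alls k (all′ φ) ρ) λ v a → h (a ∷ v))

  Def-∀ : Def {k ∷ Γ} P → Def {Γ} (λ ρ → ∀ v → P (v ∷ ρ))
  Def-∀ (φ , p) = alls _ φ , λ ρ → ⇔.trans (⊨-alls _ φ (flat ρ))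
                    (mk⇔ (λ h v → to (p (v ∷ ρ)) (h v)) (λ h v → from (p (v ∷ ρ)) (h v)))

  Def-∃ : Def {k ∷ Γ} P → Def {Γ} (λ ρ → ∃[ v ] P (v ∷ ρ))
  Def-∃ p = Def-resp (λ ρ → mk⇔ (λ h → ¬¬-elim λ k → h λ v x → k (v , x)) (λ { (v , x) h → h v x }))
                     (Def-¬ (Def-∀ (Def-¬ p)))

  -- Maps given by tuples of terms. In a group expansion the product is of this kind, but the unit
  -- and the inverse need not be, which calls for the wider notion `DF`.
  TF : ∀ {Γ k} → (Env Γ → Vec M k) → Set (ℓ ⊔ c)
  TF {Γ} {k} f = Σ[ ts ∈ Vec (Term L (sum Γ)) k ] ∀ ρ → evals 𝕄 ts (flat ρ) ≡ f ρ

  private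
    variable
      f : Env Γ → Vec M k
      g : Env Γ → Vec M l

  evals-var : ∀ {n} (ξ : Vec (Fin n) k) ρ → evals 𝕄 (Vec.map var ξ) ρ ≡ Vec.map (Vec.lookup ρ) ξ
  evals-var []      ρ = refl
  evals-var (x ∷ ξ) ρ = cong (_ ∷_) (evals-var ξ ρ)

  TF-head : TF {k ∷ Γ} All.head
  TF-head = Vec.map var (leftIdx _ _) ,
            λ { (x ∷ ρ) → trans (evals-var (leftIdx _ _) (x Vec.++ flat ρ)) (map-lookup-leftIdx x (flat ρ)) }

  TF-tail : TF {Γ} f → TF {k ∷ Γ} (f ∘ All.tail)
  TF-tail (ts , h) = renTerms (rightIdx _ _) ts , λ { (x ∷ ρ) →
    trans (evals-ren (rightIdx _ _) ts (x Vec.++ flat ρ))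
          (trans (cong (evals 𝕄 ts) (map-lookup-rightIdx x (flat ρ))) (h ρ)) }

  TF-++ : TF {Γ} f → TF g → TF (λ ρ → f ρ Vec.++ g ρ)
  TF-++ (ts , h) (us , i) = ts Vec.++ us , λ ρ → trans (evals-++ ts) (cong₂ Vec._++_ (h ρ) (i ρ))
    where
    evals-++ : ∀ {m n ρ} (ts : Vec _ m) {us : Vec (Term L n) l} →
               evals 𝕄 (ts Vec.++ us) ρ ≡ evals 𝕄 ts ρ Vec.++ evals 𝕄 us ρ
    evals-++ []       = refl
    evals-++ (t ∷ ts) = cong (_ ∷_) (evals-++ ts)

  TF-take : ∀ k {f : Env Γ → Vec M (k + l)} → TF f → TF (Vec.take k ∘ f)
  TF-take k {f} (ts , h) = Vec.take k ts , λ ρ →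
    trans (evals≡map (Vec.take k ts) (flat ρ)) (trans (sym (Vecₚ.take-map _ k ts))
      (cong (Vec.take k) (trans (sym (evals≡map ts (flat ρ))) (h ρ))))

  TF-drop : ∀ k {f : Env Γ → Vec M (k + l)} → TF f → TF (Vec.drop k ∘ f)
  TF-drop k {f} (ts , h) = Vec.drop k ts , λ ρ →
    trans (evals≡map (Vec.drop k ts) (flat ρ)) (trans (sym (Vecₚ.drop-map _ k ts))
      (cong (Vec.drop k) (trans (sym (evals≡map ts (flat ρ))) (h ρ))))

  eqs : ∀ {n} → Vec (Term L n) k → Vec (Term L n) k → Formula L n
  eqs []       []       = false ⇒ false
  eqs (t ∷ ts) (u ∷ us) = ((t ≗ u) ⇒ (eqs ts us ⇒ false)) ⇒ false

  ⊨-eqs : ∀ {n} (ts us : Vec (Term L n) k) ρ → 𝕄 ⊨ eqs ts us [ ρ ] ⇔ (evals 𝕄 ts ρ ≡ evals 𝕄 us ρ)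
  ⊨-eqs []       []       ρ = mk⇔ (λ _ → refl) (λ _ ())
  ⊨-eqs (t ∷ ts) (u ∷ us) ρ = mk⇔
    (λ h → ¬¬-elim λ k → ⊥ₚ.⊥-elim (h λ e e′ → ⊥-elim (k (cong₂ _∷_ e (to (⊨-eqs ts us ρ) e′)))))
    (λ e h → h (cong Vec.head e) (from (⊨-eqs ts us ρ) (cong Vec.tail e)))

  Def-≡ : {f g : Env Γ → Vec M k} → TF f → TF g → Def (λ ρ → f ρ ≡ g ρ)
  Def-≡ (ts , h) (us , i) = eqs ts us , λ ρ → ⇔.trans (⊨-eqs ts us (flat ρ)) (≡⇒⇔ (cong₂ _≡_ (h ρ) (i ρ)))

  -- Definable functions, given by their graphs.
  record DF {Γ : List ℕ} {k : ℕ} (f : Env Γ → Vec M k) : Set (ℓ ⊔ c) where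
    constructor mkDF
    field graph : Def {k ∷ Γ} (λ σ → All.head σ ≡ f (All.tail σ))
  open DF

  TF⇒DF : TF {Γ} f → DF f
  TF⇒DF t = mkDF (Def-≡ TF-head (TF-tail t))

  private
    skipIdx : ∀ i m n → Vec (Fin (i + (m + n))) (i + n)
    skipIdx i m n = leftIdx i (m + n) Vec.++ Vec.map (i ↑ʳ_) (rightIdx m n)

    map-lookup-skipIdx : ∀ {i m n} (x : Vec M i) (y : Vec M m) (z : Vec M n) →
                         Vec.map (Vec.lookup (x Vec.++ (y Vec.++ z))) (skipIdx i m n) ≡ x Vec.++ z
    map-lookup-skipIdx {i} {m} {n} x y z =
      trans (Vecₚ.map-++ _ (leftIdx i (m + n)) _) (cong₂ Vec._++_ (map-lookup-leftIdx x _)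
        (trans (map-lookup-map (x Vec.++ (y Vec.++ z)) (i ↑ʳ_) (y Vec.++ z) (Vecₚ.lookup-++ʳ x _) (rightIdx m n))
               (map-lookup-rightIdx y z)))

  -- Weakening just below the head. A graph keeps the value of the function in the first block, so a
  -- new variable has to enter behind it.
  Def-skip : ∀ {Γ j k} {P : Pred (Env (j ∷ Γ)) c} → Def P →
             Def {j ∷ k ∷ Γ} (λ σ → P (All.head σ ∷ All.tail (All.tail σ)))
  Def-skip {Γ} {j} {k} (φ , p) = renFormula (skipIdx j k (sum Γ)) φ , λ { (x ∷ y ∷ ρ) →
    ⇔.trans (⊨-ren (skipIdx j k (sum Γ)) φ (x Vec.++ (y Vec.++ flat ρ)))
      (⇔.trans (≡⇒⇔ (cong (𝕄 ⊨ φ [_]) (map-lookup-skipIdx x y (flat ρ)))) (p (x ∷ ρ))) }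

  DF-tail : DF {Γ} f → DF {k ∷ Γ} (f ∘ All.tail)
  DF-tail {f = f} (mkDF d) = mkDF (Def-skip {P = λ σ → All.head σ ≡ f (All.tail σ)} d)

  -- Substitution of a function that is not a term: its value is a quantified block that the graph
  -- ties to `f ρ`.
  Def-sub₁ : Def {k ∷ Γ} P → DF f → Def {Γ} (λ ρ → P (f ρ ∷ ρ))
  Def-sub₁ p d = Def-resp (λ ρ → mk⇔ (λ h → h _ refl) (λ { h _ refl → h })) (Def-∀ (Def-→ (graph d) p))

  DF₁ : (h : Vec M j → Vec M k) → (∀ {Γ} {f : Env Γ → Vec M j} → TF f → TF (λ ρ → h (f ρ))) →
        {f : Env Γ → Vec M j} → DF f → DF (λ ρ → h (f ρ))
  DF₁ h H d = mkDF (Def-sub₁ {P = λ σ → All.head (All.tail σ) ≡ h (All.head σ)}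
                (Def-≡ (TF-tail TF-head) (H TF-head)) (DF-tail d))

  DF₂ : (h : Vec M j → Vec M l → Vec M k) →
        (∀ {Γ} {f : Env Γ → Vec M j} {g : Env Γ → Vec M l} → TF f → TF g → TF (λ ρ → h (f ρ) (g ρ))) →
        {f : Env Γ → Vec M j} {g : Env Γ → Vec M l} → DF f → DF g → DF (λ ρ → h (f ρ) (g ρ))
  DF₂ h H {f} {g} d e = mkDF
    (Def-sub₁ {P = λ σ → All.head (All.tail σ) ≡ h (All.head σ) (g (All.tail (All.tail σ)))}
      (Def-sub₁ {P = λ σ → All.head (All.tail (All.tail σ)) ≡ h (All.head (All.tail σ)) (All.head σ)}
        (Def-≡ (TF-tail (TF-tail TF-head)) (H (TF-tail TF-head) TF-head)) (DF-tail (DF-tail e)))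
      (DF-tail d))

  DF-head : DF {k ∷ Γ} All.head
  DF-head = TF⇒DF TF-head

  DF-++ : {f : Env Γ → Vec M j} {g : Env Γ → Vec M k} → DF f → DF g → DF (λ ρ → f ρ Vec.++ g ρ)
  DF-++ = DF₂ Vec._++_ TF-++

  DF-take : ∀ k {f : Env Γ → Vec M (k + l)} → DF f → DF (Vec.take k ∘ f)
  DF-take k = DF₁ (Vec.take k) (TF-take k)

  DF-drop : ∀ k {f : Env Γ → Vec M (k + l)} → DF f → DF (Vec.drop k ∘ f)
  DF-drop k = DF₁ (Vec.drop k) (TF-drop k)

  Def-⊨ : (φ : Formula L k) {f : Env Γ → Vec M k} → DF f → Def (λ ρ → 𝕄 ⊨ φ [ f ρ ])
  Def-⊨ φ d = Def-sub₁ {P = λ σ → 𝕄 ⊨ φ [ All.head σ ]}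
    (renFormula (leftIdx _ _) φ , λ { (x ∷ ρ) →
      ⇔.trans (⊨-ren (leftIdx _ _) φ (x Vec.++ flat ρ)) (≡⇒⇔ (cong (𝕄 ⊨ φ [_]) (map-lookup-leftIdx x (flat ρ)))) })
    d

  abstract
    -- An environment of two blocks flattens to `x ++ (y ++ [])`, while `instanceOf` reads `x ++ y`;
    -- a renaming passes from one to the other.
    toFormula : ∀ {P : Pred (Env (j ∷ k ∷ [])) c} → Def P →
                Σ[ φ ∈ Formula L (j + k) ] ∀ x y → 𝕄 ⊨ φ [ x Vec.++ y ] ⇔ P (x ∷ y ∷ [])
    toFormula {j} {k} (φ , p) = renFormula ξ φ , λ x y →
        ⇔.trans (⊨-ren ξ φ (x Vec.++ y)) (⇔.trans (≡⇒⇔ (cong (𝕄 ⊨ φ [_]) (eq x y))) (p (x ∷ y ∷ [])))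
      where
      ξ : Vec (Fin (j + k)) (j + (k + 0))
      ξ = leftIdx j k Vec.++ (rightIdx j k Vec.++ [])
      eq : ∀ (x : Vec M j) (y : Vec M k) → Vec.map (Vec.lookup (x Vec.++ y)) ξ ≡ x Vec.++ (y Vec.++ [])
      eq x y = trans (Vecₚ.map-++ _ (leftIdx j k) _) (cong₂ Vec._++_ (map-lookup-leftIdx x y)
                 (trans (Vecₚ.map-++ _ (rightIdx j k) _) (cong (Vec._++ []) (map-lookup-rightIdx x y))))

-- Coverings by finitely many translates in a group.

module Covers (em : ∀ {a} → ExcludedMiddle a) {c} {X : Set c} {mul : X → X → X} {ε : X} {inv : X → X}
              (isGroup : IsGroup _≡_ mul ε inv) where

  private
    𝔾 : Group c c
    𝔾 = record { isGroup = isGroup }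

  open Group 𝔾 using (_∙_; _⁻¹; assoc; identityˡ; identityʳ; inverseˡ; inverseʳ)
  open GroupProperties 𝔾 using (⁻¹-anti-homo-∙; ⁻¹-involutive; ε⁻¹≈ε)
    renaming (\\-leftDividesˡ to x[x⁻¹y]≡y; \\-leftDividesʳ to x⁻¹[xy]≡y)

  private
    variable
      a u v w : Level
      U U′ : Pred X u
      V : Pred X v
      W : Pred X w
      K H A : Pred X c

  record Sub (K : Pred X c) : Set c where
    field
      ε∈  : K ε
      ∙∈  : ∀ {x y} → K x → K y → K (x ∙ y)
      ⁻¹∈ : ∀ {x} → K x → K (x ⁻¹)
  open Sub

  [xy]⁻¹z : ∀ x y z → ((x ∙ y) ⁻¹) ∙ z ≡ (y ⁻¹) ∙ ((x ⁻¹) ∙ z)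
  [xy]⁻¹z x y z = trans (cong (_∙ z) (⁻¹-anti-homo-∙ x y)) (assoc _ _ _)

  x⁻¹[yx⁻¹z]≡ : ∀ x y z → (x ⁻¹ ∙ y) ⁻¹ ∙ (x ⁻¹ ∙ z) ≡ (y ⁻¹) ∙ z
  x⁻¹[yx⁻¹z]≡ x y z = trans ([xy]⁻¹z (x ⁻¹) y _) (cong (y ⁻¹ ∙_) (x⁻¹[xy]≡y (x ⁻¹) z))

  [x⁻¹y]⁻¹z : ∀ x y z → (x ⁻¹ ∙ y) ⁻¹ ∙ z ≡ (y ⁻¹) ∙ (x ∙ z)
  [x⁻¹y]⁻¹z x y z = trans ([xy]⁻¹z (x ⁻¹) y z) (cong (λ t → y ⁻¹ ∙ (t ∙ z)) (⁻¹-involutive x))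

  coset-diff : Sub K → ∀ {x y z} → K (x ⁻¹ ∙ y) → K (x ⁻¹ ∙ z) → K (y ⁻¹ ∙ z)
  coset-diff {K = K} s {x} {y} {z} p q = subst K (x⁻¹[yx⁻¹z]≡ x y z) (∙∈ s (⁻¹∈ s p) q)

  coset-refl : Sub K → ∀ {x} → K (x ⁻¹ ∙ x)
  coset-refl {K = K} s {x} = subst K (sym (inverseˡ x)) (ε∈ s)

  coset-sym : Sub K → ∀ {x y} → K (x ⁻¹ ∙ y) → K (y ⁻¹ ∙ x)
  coset-sym s p = coset-diff s p (coset-refl s)

  coset-trans : Sub K → ∀ {x y z} → K (x ⁻¹ ∙ y) → K (y ⁻¹ ∙ z) → K (x ⁻¹ ∙ z)
  coset-trans s p q = coset-diff s (coset-sym s p) q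

  Sub-∩ : Sub K → Sub H → Sub (K ∩ H)
  Sub-∩ s t = record
    { ε∈  = ε∈ s , ε∈ t
    ; ∙∈  = λ (p , q) (p′ , q′) → ∙∈ s p p′ , ∙∈ t q q′
    ; ⁻¹∈ = λ (p , q) → ⁻¹∈ s p , ⁻¹∈ t q
    }

  -- U is covered by finitely many left translates of W; for a subgroup W
  -- of a subgroup U this says that the index is finite.
  infix 4 _≲_
  infixr 4 _,_
  record _≲_ (U : Pred X u) (W : Pred X w) : Set (c ⊔ u ⊔ w) where
    constructor _,_
    field
      translators : List X
      covers      : ∀ {x} → U x → ∃[ c ] (c ∈ translators × W (c ⁻¹ ∙ x))

  ≲-trans : U ≲ V → V ≲ W → U ≲ W
  ≲-trans {W = W} (cs , f) (ds , g) = cartesianProductWith _∙_ cs ds , λ Ux →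
    let (c , c∈ , Vx) = f Ux ; (d , d∈ , Wx) = g Vx
    in c ∙ d , ∈-cartesianProductWith⁺ _∙_ c∈ d∈ , subst W (sym ([xy]⁻¹z c d _)) Wx

  ⊆⇒≲ : (∀ {x} → U x → W x) → U ≲ W
  ⊆⇒≲ {W = W} h = ε ∷ [] , λ {x} Ux → ε , here refl ,
    subst W (sym (trans (cong (_∙ x) ε⁻¹≈ε) (identityˡ x))) (h Ux)

  ≲-monoˡ : (∀ {x} → U x → V x) → V ≲ W → U ≲ W
  ≲-monoˡ h (cs , f) = cs , f ∘ h

  ≲-monoʳ : (∀ {x} → V x → W x) → U ≲ V → U ≲ W
  ≲-monoʳ h (cs , f) = cs , λ Ux → let (c , c∈ , Vx) = f Ux in c , c∈ , h Vx

  ≲-∪ : U ≲ W → V ≲ W → (U ∪ V) ≲ W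
  ≲-∪ (cs , f) (ds , g) = cs ++ ds , λ
    { (inj₁ p) → let (c , c∈ , q) = f p in c , ∈-++⁺ˡ c∈ , q
    ; (inj₂ p) → let (c , c∈ , q) = g p in c , ∈-++⁺ʳ cs c∈ , q }

  ≲-⋃ : {I : Set a} (is : List I) {V : I → Pred X v} → (∀ i → V i ≲ W) →
        (λ x → ∃[ i ] (i ∈ is × V i x)) ≲ W
  ≲-⋃ []       h = [] , λ ()
  ≲-⋃ (i ∷ is) h = ≲-monoˡ (λ { (_ , here refl , p) → inj₁ p ; (j , there j∈ , p) → inj₂ (j , j∈ , p) })
                           (≲-∪ (h i) (≲-⋃ is h))

  ≲-translate : ∀ g → U ≲ W → (λ x → U (g ∙ x)) ≲ W
  ≲-translate {W = W} g (cs , f) = List.map (g ⁻¹ ∙_) cs , λ {x} Ugx →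
    let (c , c∈ , p) = f Ugx in g ⁻¹ ∙ c , ∈-map⁺ _ c∈ , subst W (sym ([x⁻¹y]⁻¹z g c x)) p

  ∅≲ : (∀ {x} → ¬ U x) → U ≲ W
  ∅≲ h = [] , λ Ux → ⊥-elim (h Ux)

  -- Moves the centres of a covering to points that themselves have the property at hand; an index
  -- whose set is empty contributes none. The bound on the length serves the count of cells in the
  -- upper bound.
  representatives : ∀ {I : Set a} {Y : Set v} (is : List I) (P : I → Pred Y u) →
                    ∃[ ys ] (length ys ≤ length is × (∀ {i y} → i ∈ is → P i y → ∃[ x ] (x ∈ ys × P i x)))
  representatives []       P = [] , z≤n , λ ()
  representatives (i ∷ is) P with em {P = ∃ (P i)} | representatives is P
  ... | yes (y , p) | ys , l , h = y ∷ ys , s≤s l , λ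
    { (here refl) _ → y , here refl , p ; (there i∈) q → let (x , x∈ , r) = h i∈ q in x , there x∈ , r }
  ... | no ¬p | ys , l , h = ys , ℕₚ.m≤n⇒m≤1+n l , λ
    { (here refl) q → ⊥-elim (¬p (_ , q)) ; (there i∈) q → h i∈ q }

  -- A coset of `K` and a coset of `H` that meet have a coset of `K ∩ H` as their intersection, and
  -- any point of it can serve as the centre.
  ≲-∩ : Sub K → Sub H → U ≲ K → U ≲ H → U ≲ (K ∩ H)
  ≲-∩ {K = K} {H = H} s t (cs , f) (ds , g) =
    let (ys , _ , h) = representatives (cartesianProduct cs ds) (λ (c , d) x → K (c ⁻¹ ∙ x) × H (d ⁻¹ ∙ x))
    in ys , λ Ux → let (c , c∈ , p) = f Ux ; (d , d∈ , q) = g Ux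
                       (y , y∈ , p′ , q′) = h (∈-cartesianProduct⁺ c∈ d∈) (p , q)
                   in y , y∈ , coset-diff s p′ p , coset-diff t q′ q

  not-⊆ : ¬ (∀ {x} → U x → W x) → ∃[ x ] (U x × ¬ W x)
  not-⊆ {U = U} {W = W} h with em {P = ∃[ x ] (U x × ¬ W x)}
  ... | yes p = p
  ... | no ¬p = ⊥-elim (h λ {x} Ux → case em {P = W x} of λ { (yes q) → q ; (no q) → ⊥-elim (¬p (x , Ux , q)) })

  -- B. H. Neumann: if some coset aK ⊆ A is missed by the translates of K,
  -- then aK is covered by those of W, hence so are all the other cosets of K.
  neumann : Sub A → Sub K → A ≲ (K ∪ W) → A ≲ K ⊎ A ≲ W
  neumann {A = A} {K = K} {W = W} sA sK (cs , f) with em {P = A ≲ K}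
  ... | yes p = inj₁ p
  ... | no ¬p = inj₂ (≲-monoˡ split (≲-∪ (≲-⋃ cs covered) (cs , proj₂)))
    where
    missed : ∃[ a ] (A a × ¬ (∃[ c ] (c ∈ cs × K (c ⁻¹ ∙ a))))
    missed = not-⊆ λ h → ¬p (cs , h)
    g = proj₁ missed
    coset≲ : (λ x → A x × K (g ⁻¹ ∙ x)) ≲ W
    coset≲ = cs , λ { (Ax , Kx) → case-∪ Kx (f Ax) }
      where
      case-∪ : ∀ {x} → K (g ⁻¹ ∙ x) → ∃[ c ] (c ∈ cs × (K ∪ W) (c ⁻¹ ∙ x)) → ∃[ c ] (c ∈ cs × W (c ⁻¹ ∙ x))
      case-∪ Kx (c , c∈ , inj₁ q) = ⊥-elim (proj₂ (proj₂ missed) (c , c∈ , coset-trans sK q (coset-sym sK Kx)))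
      case-∪ Kx (c , c∈ , inj₂ q) = c , c∈ , q
    covered : ∀ c → (λ x → A x × K (c ⁻¹ ∙ x)) ≲ W
    covered c with em {P = ∃[ x ] (A x × K (c ⁻¹ ∙ x))}
    ... | no ¬q = ∅≲ λ q → ¬q (_ , q)
    ... | yes (d , Ad , Kd) = ≲-monoˡ
      (λ {x} (Ax , Kx) → subst A (sym (assoc g _ x)) (∙∈ sA (proj₁ (proj₂ missed)) (∙∈ sA (⁻¹∈ sA Ad) Ax)) ,
                         subst K (sym (trans (cong (g ⁻¹ ∙_) (assoc g _ x)) (x⁻¹[xy]≡y g _))) (coset-diff sK Kd Kx))
      (≲-translate (g ∙ (d ⁻¹)) coset≲)
    split : ∀ {x} → A x → (∃[ c ] (c ∈ cs × A x × K (c ⁻¹ ∙ x))) ⊎ (A x × ∃[ c ] (c ∈ cs × W (c ⁻¹ ∙ x)))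
    split Ax with f Ax
    ... | c , c∈ , inj₁ q = inj₁ (c , c∈ , Ax , q)
    ... | c , c∈ , inj₂ q = inj₂ (Ax , c , c∈ , q)

  ⋃ : List (Pred X c) → Pred X c
  ⋃ []       x = ⊥ₚ.⊥
  ⋃ (K ∷ Ks) x = K x ⊎ ⋃ Ks x

  ∈-⋃ : ∀ {Ks x} → K ∈ Ks → K x → ⋃ Ks x
  ∈-⋃ (here refl) p = inj₁ p
  ∈-⋃ (there i)   p = inj₂ (∈-⋃ i p)

  -- In `neumann` the set `W` is arbitrary, so the union of the remaining subgroups can take its
  -- place and the subgroups are split off one by one.
  neumann-⋃ : Sub A → ∀ {Ks} → All Sub Ks → A ≲ ⋃ Ks → Any (A ≲_) Ks
  neumann-⋃ sA []       (cs , f) = ⊥ₚ.⊥-elim (proj₂ (proj₂ (f (ε∈ sA))))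
  neumann-⋃ sA (s ∷ ss) p with neumann sA s p
  ... | inj₁ q = here q
  ... | inj₂ q = there (neumann-⋃ sA ss q)

  -- Conjugates and double cosets.

  conj : X → Pred X c → Pred X c
  conj x K z = K (x ⁻¹ ∙ (z ∙ x))

  Sub-conj : ∀ x → Sub K → Sub (conj x K)
  Sub-conj {K = K} x s = record
    { ε∈  = subst K (sym (trans (cong (x ⁻¹ ∙_) (identityˡ x)) (inverseˡ x))) (ε∈ s)
    ; ∙∈  = λ {y} {z} p q → subst K (trans (assoc _ _ _) (cong (x ⁻¹ ∙_)
              (trans (assoc _ _ _) (trans (cong (y ∙_) (x[x⁻¹y]≡y x _)) (sym (assoc _ _ _)))))) (∙∈ s p q)
    ; ⁻¹∈ = λ {y} p → subst K (trans (⁻¹-anti-homo-∙ _ _) (trans (cong₂ _∙_ (⁻¹-anti-homo-∙ y x) (⁻¹-involutive x)) (assoc _ _ _))) (⁻¹∈ s p)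
    }

  -- Conjugation by g⁻¹ carries the covering along: the translate with centre `c` becomes one with
  -- centre g⁻¹cg.
  conj-shift : ∀ g x → conj g K ≲ conj x K → K ≲ conj (g ⁻¹ ∙ x) K
  conj-shift {K = K} g x (cs , f) = List.map (λ c → g ⁻¹ ∙ (c ∙ g)) cs , λ {z} Kz →
    let (c , c∈ , p) = f {(g ∙ z) ∙ (g ⁻¹)} (subst K (sym (e₁ z)) Kz)
    in g ⁻¹ ∙ (c ∙ g) , ∈-map⁺ _ c∈ , subst K (sym (e₂ c z)) p
    where
    open ≡-Reasoning
    e₁ : ∀ z → g ⁻¹ ∙ (((g ∙ z) ∙ (g ⁻¹)) ∙ g) ≡ z
    e₁ z = begin
      g ⁻¹ ∙ (((g ∙ z) ∙ (g ⁻¹)) ∙ g) ≡⟨ cong (g ⁻¹ ∙_) (assoc _ _ _) ⟩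
      g ⁻¹ ∙ ((g ∙ z) ∙ ((g ⁻¹) ∙ g)) ≡⟨ cong (λ t → g ⁻¹ ∙ ((g ∙ z) ∙ t)) (inverseˡ g) ⟩
      g ⁻¹ ∙ ((g ∙ z) ∙ ε)            ≡⟨ cong (g ⁻¹ ∙_) (identityʳ _) ⟩
      g ⁻¹ ∙ (g ∙ z)                  ≡⟨ x⁻¹[xy]≡y g z ⟩
      z                               ∎
    e₂ : ∀ c z → (g ⁻¹ ∙ x) ⁻¹ ∙ (((g ⁻¹ ∙ (c ∙ g)) ⁻¹ ∙ z) ∙ (g ⁻¹ ∙ x)) ≡ x ⁻¹ ∙ ((c ⁻¹ ∙ ((g ∙ z) ∙ (g ⁻¹))) ∙ x)
    e₂ c z = begin
      (g ⁻¹ ∙ x) ⁻¹ ∙ (((g ⁻¹ ∙ (c ∙ g)) ⁻¹ ∙ z) ∙ (g ⁻¹ ∙ x)) ≡⟨ [x⁻¹y]⁻¹z g x _ ⟩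
      x ⁻¹ ∙ (g ∙ (((g ⁻¹ ∙ (c ∙ g)) ⁻¹ ∙ z) ∙ (g ⁻¹ ∙ x)))
        ≡⟨ cong (λ t → x ⁻¹ ∙ (g ∙ (t ∙ (g ⁻¹ ∙ x)))) (trans ([x⁻¹y]⁻¹z g (c ∙ g) z) ([xy]⁻¹z c g _)) ⟩
      x ⁻¹ ∙ (g ∙ ((g ⁻¹ ∙ (c ⁻¹ ∙ (g ∙ z))) ∙ (g ⁻¹ ∙ x))) ≡⟨ cong (λ t → x ⁻¹ ∙ (g ∙ t)) (assoc _ _ _) ⟩
      x ⁻¹ ∙ (g ∙ (g ⁻¹ ∙ ((c ⁻¹ ∙ (g ∙ z)) ∙ (g ⁻¹ ∙ x)))) ≡⟨ cong (x ⁻¹ ∙_) (x[x⁻¹y]≡y g _) ⟩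
      x ⁻¹ ∙ ((c ⁻¹ ∙ (g ∙ z)) ∙ (g ⁻¹ ∙ x))                ≡⟨ cong (x ⁻¹ ∙_) (assoc _ _ _) ⟨
      x ⁻¹ ∙ (((c ⁻¹ ∙ (g ∙ z)) ∙ (g ⁻¹)) ∙ x)              ≡⟨ cong (λ t → x ⁻¹ ∙ (t ∙ x)) (assoc _ _ _) ⟩
      x ⁻¹ ∙ ((c ⁻¹ ∙ ((g ∙ z) ∙ (g ⁻¹))) ∙ x)              ∎

  DoubleCoset : Pred X c → X → Pred X c
  DoubleCoset K a y = ∃[ k ] ∃[ l ] (K k × K l × y ≡ k ∙ (a ∙ l))

  DoubleCoset-sym : Sub K → ∀ {a b} → DoubleCoset K a b → DoubleCoset K b a
  DoubleCoset-sym s {a} (k , l , Kk , Kl , refl) = k ⁻¹ , l ⁻¹ , ⁻¹∈ s Kk , ⁻¹∈ s Kl ,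
    sym (trans (cong (k ⁻¹ ∙_) (assoc _ _ _)) (trans (x⁻¹[xy]≡y k _)
      (trans (assoc _ _ _) (trans (cong (a ∙_) (inverseʳ l)) (identityʳ a)))))

  DoubleCoset-trans : Sub K → ∀ {a b d} → DoubleCoset K a b → DoubleCoset K b d → DoubleCoset K a d
  DoubleCoset-trans s {a} (k , l , Kk , Kl , refl) (k′ , l′ , Kk′ , Kl′ , refl) =
    k′ ∙ k , l ∙ l′ , ∙∈ s Kk′ Kk , ∙∈ s Kl Kl′ ,
    trans (cong (k′ ∙_) (trans (assoc _ _ _) (cong (k ∙_) (assoc _ _ _)))) (sym (assoc _ _ _))

  -- K normalised by a up to finite index: KaK is a finite union of cosets kaK.
  DoubleCoset≲ : Sub K → ∀ {a} → K ≲ conj a K → DoubleCoset K a ≲ K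
  DoubleCoset≲ {K = K} s {a} (cs , f) = List.map (_∙ a) cs , λ { (k , l , Kk , Kl , refl) →
    let (c , c∈ , p) = f Kk
    in c ∙ a , ∈-map⁺ _ c∈ , subst K (sym (trans ([xy]⁻¹z c a _) (e c k l))) (∙∈ s p Kl) }
    where
    e : ∀ c k l → a ⁻¹ ∙ (c ⁻¹ ∙ (k ∙ (a ∙ l))) ≡ (a ⁻¹ ∙ ((c ⁻¹ ∙ k) ∙ a)) ∙ l
    e c k l = sym (trans (assoc _ _ _) (cong (a ⁻¹ ∙_) (trans (assoc _ _ _) (assoc _ _ _))))

  -- Greedy choice: `K` and the sets `D a` for the points chosen so far are together covered by
  -- finitely many translates of `K`, so they cannot exhaust `V`.
  separated : (D : X → Pred X c) → (∀ {a b} → D a b → D b a) → (∀ {a} → V a → D a ≲ K) → ¬ V ≲ K →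
              ∀ t → Σ[ as ∈ (Fin t → X) ] ((∀ i → V (as i) × ¬ K (as i)) × (∀ i j → i ≢ j → ¬ D (as i) (as j)))
  separated D D-sym small large zero = (λ ()) , (λ ()) , (λ ())
  separated {V = V} {K = K} D D-sym small large (suc t) =
    let (as , in-V , apart) = separated D D-sym small large t
        (a , Va , ¬bad) = not-⊆ {W = K ∪ (λ x → ∃[ i ] (i ∈ List.allFin t × D (as i) x))} λ h →
          large (≲-monoˡ h (≲-∪ (⊆⇒≲ id) (≲-⋃ (List.allFin t) λ i → small (proj₁ (in-V i)))))
    in (λ { zero → a ; (suc i) → as i })
     , (λ { zero → Va , ¬bad ∘ inj₁ ; (suc i) → in-V i })
     , (λ { zero zero 0≢0 _ → 0≢0 refl
          ; zero (suc j) _ d → ¬bad (inj₂ (j , ∈-allFin j , D-sym d))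
          ; (suc i) zero _ d → ¬bad (inj₂ (i , ∈-allFin i , d))
          ; (suc i) (suc j) i≢j d → apart i j (λ { refl → i≢j refl }) d })

module _ {a} {A : Set a} {m n : ℕ} (x : Vec A m) (y : Vec A n) where

  take-++≡ : Vec.take m (x Vec.++ y) ≡ x
  take-++≡ = proj₁ (Vecₚ.++-injective _ x (Vecₚ.take++drop≡id m (x Vec.++ y)))

  drop-++≡ : Vec.drop m (x Vec.++ y) ≡ y
  drop-++≡ = proj₂ (Vecₚ.++-injective _ x (Vecₚ.take++drop≡id m (x Vec.++ y)))

-- Finite families of definable sets.

module Families (em : ∀ {a} → ExcludedMiddle a) {ℓ c} {L : Language ℓ} (𝕄 : Structure L c) where

  open Definability em 𝕄

  private
    M = Carrier 𝕄
    variable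
      Γ : List ℕ
      j k m p : ℕ

  DF-[] : DF {Γ} (λ _ → [])
  DF-[] = TF⇒DF ([] , λ _ → refl)

  Def-at₁ : {P : Pred (Vec M k) c} → Def {k ∷ []} (λ ρ → P (All.head ρ)) →
            {f : Env Γ → Vec M k} → DF f → Def (λ ρ → P (f ρ))
  Def-at₁ (φ , h) {f} d = Def-resp (λ ρ → h (f ρ ∷ [])) (Def-⊨ φ (DF-++ d DF-[]))

  Def-at₂ : {P : Vec M j → Vec M k → Set c} → Def {j ∷ k ∷ []} (λ ρ → P (All.head ρ) (All.head (All.tail ρ))) →
            {f : Env Γ → Vec M j} {g : Env Γ → Vec M k} → DF f → DF g → Def (λ ρ → P (f ρ) (g ρ))
  Def-at₂ (φ , h) {f} {g} d e = Def-resp (λ ρ → h (f ρ ∷ g ρ ∷ [])) (Def-⊨ φ (DF-++ d (DF-++ e DF-[])))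

  TF-resp : {f g : Env Γ → Vec M k} → (∀ ρ → f ρ ≡ g ρ) → TF f → TF g
  TF-resp h (ts , i) = ts , λ ρ → trans (i ρ) (h ρ)

  Def-⊤ : Def {Γ} (λ _ → ⊤ₚ.⊤)
  Def-⊤ = Def-resp (λ _ → mk⇔ (λ _ → _) (λ _ x → x)) (Def-→ Def-⊥ Def-⊥)

  -- The form in which definability over acl^eq(∅) is used: `H` is the fibre over `e`, a point of a
  -- ∅-definable set `Θ` that carries only finitely many different fibres. The set `Θ` itself may be
  -- infinite, because an imaginary can have infinitely many representatives.
  record FiniteFamily {m} (H : Pred (Vec M m) c) : Set (ℓ ⊔ lsuc c) where
    field
      {nparams}   : ℕ
      Member    : Vec M m → Vec M nparams → Set c
      Member-def : Def {m ∷ nparams ∷ []} (λ ρ → Member (All.head ρ) (All.head (All.tail ρ)))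
      Θ         : Pred (Vec M nparams) c
      Θ-def     : Def {nparams ∷ []} (λ ρ → Θ (All.head ρ))
      e         : Vec M nparams
      Θe        : Θ e
      isMember    : ∀ a → H a ⇔ Member a e
      es        : List (Vec M nparams)
      finite    : ∀ {e′} → Θ e′ → ∃[ e″ ] (e″ ∈ es × (∀ a → Member a e′ ⇔ Member a e″))

  FiniteFamily-⊤ : FiniteFamily {m} (λ _ → ⊤ₚ.⊤)
  FiniteFamily-⊤ = record
    { Member = λ _ _ → ⊤ₚ.⊤ ; Member-def = Def-⊤ ; Θ = λ _ → ⊤ₚ.⊤ ; Θ-def = Def-⊤ ; e = [] ; Θe = _
    ; isMember = λ _ → ⇔.refl ; es = [] ∷ [] ; finite = λ _ → [] , here refl , λ _ → ⇔.refl }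

  ×-⇔ : ∀ {A B C D : Set c} → A ⇔ B → C ⇔ D → (A × C) ⇔ (B × D)
  ×-⇔ h i = mk⇔ (λ (x , y) → to h x , to i y) (λ (x , y) → from h x , from i y)

  FiniteFamily-∩ : {H K : Pred (Vec M m) c} → FiniteFamily H → FiniteFamily K → FiniteFamily (H ∩ K)
  FiniteFamily-∩ {m} F F′ = record
    { nparams      = F.nparams + F′.nparams
    ; Member     = λ a v → F.Member a (Vec.take _ v) × F′.Member a (Vec.drop F.nparams v)
    ; Member-def = Def-× (Def-at₂ {P = F.Member} F.Member-def DF-head (DF-take _ (DF-tail DF-head)))
                         (Def-at₂ {P = F′.Member} F′.Member-def DF-head (DF-drop F.nparams (DF-tail DF-head)))
    ; Θ          = λ v → F.Θ (Vec.take _ v) × F′.Θ (Vec.drop F.nparams v)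
    ; Θ-def      = Def-× (Def-at₁ {P = F.Θ} F.Θ-def (DF-take _ DF-head)) (Def-at₁ {P = F′.Θ} F′.Θ-def (DF-drop F.nparams DF-head))
    ; e          = F.e Vec.++ F′.e
    ; Θe         = subst F.Θ (sym (take-++≡ F.e F′.e)) F.Θe , subst F′.Θ (sym (drop-++≡ F.e F′.e)) F′.Θe
    ; isMember     = λ a → ×-⇔ (⇔.trans (F.isMember a) (≡⇒⇔ (cong (F.Member a) (sym (take-++≡ F.e F′.e)))))
                             (⇔.trans (F′.isMember a) (≡⇒⇔ (cong (F′.Member a) (sym (drop-++≡ F.e F′.e)))))
    ; es         = cartesianProductWith Vec._++_ F.es F′.es
    ; finite     = λ (p , q) →
        let (d , d∈ , h) = F.finite p ; (d′ , d′∈ , h′) = F′.finite q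
        in d Vec.++ d′ , ∈-cartesianProductWith⁺ Vec._++_ d∈ d′∈ , λ a →
           ×-⇔ (⇔.trans (h a) (≡⇒⇔ (cong (F.Member a) (sym (take-++≡ d d′)))))
               (⇔.trans (h′ a) (≡⇒⇔ (cong (F′.Member a) (sym (drop-++≡ d d′)))))
    }
    where
    module F = FiniteFamily F
    module F′ = FiniteFamily F′

  -- Translation of formulas of 𝕄^eq into formulas of 𝕄.

  open Eq 𝕄 renaming (Env to Envᵉ)

  width : Sort → ℕ
  width home     = 1
  width (quot ε) = dim ε

  tuple : ∀ s → ⟦ s ⟧ → Vec M (width s)
  tuple home     a = a ∷ []
  tuple (quot ε) v = v

  untuple : ∀ s → Vec M (width s) → ⟦ s ⟧
  untuple home     v = Vec.head v
  untuple (quot ε) v = v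

  tuple-untuple : ∀ s v → tuple s (untuple s v) ≡ v
  tuple-untuple home     (a ∷ []) = refl
  tuple-untuple (quot ε) v        = refl

  untuple-tuple : ∀ s a → untuple s (tuple s a) ≡ a
  untuple-tuple home     a = refl
  untuple-tuple (quot ε) a = refl

  TFᵉ : ∀ {Δ Γ} → (Env Δ → Envᵉ Γ) → Set (ℓ ⊔ c)
  TFᵉ {Γ = Γ} δ = ∀ {s} (x : s ∈ Γ) → TF (λ ρ → tuple s (All.lookup (δ ρ) x))

  TFᵉ-∷ : ∀ {Δ Γ} s {f : Env Δ → Vec M (width s)} {δ : Env Δ → Envᵉ Γ} → TF f → TFᵉ δ →
          TFᵉ {Γ = s ∷ Γ} (λ ρ → untuple s (f ρ) ∷ δ ρ)
  TFᵉ-∷ s t h (here refl) = TF-resp (λ _ → sym (tuple-untuple s _)) t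
  TFᵉ-∷ s t h (there x)   = h x

  TFᵉ-++ : ∀ {Δ Γ} m {f : Env Δ → Vec M m} {δ : Env Δ → Envᵉ Γ} → TF f → TFᵉ δ → TFᵉ (λ ρ → f ρ ++ᵉ δ ρ)
  TFᵉ-++ {Γ = Γ} zero {f} {δ} t h {s} x = TF-resp (λ ρ → cong (λ δ′ → tuple s (All.lookup {P = ⟦_⟧} δ′ x)) (same {δ = δ ρ} (f ρ))) (h x)
    where
    same : ∀ {Γ} {δ : Envᵉ Γ} (v : Vec M 0) → δ ≡ v ++ᵉ δ
    same [] = refl
  TFᵉ-++ (suc m) {f} t h (here refl) = TF-resp (λ ρ → same (f ρ)) (TF-take 1 t)
    where
    same : ∀ {Γ} {δ : Envᵉ Γ} (v : Vec M (suc m)) → Vec.take 1 v ≡ All.lookup (v ++ᵉ δ) (here refl) ∷ []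
    same (a ∷ v) = refl
  TFᵉ-++ (suc m) {f} t h (there x) =
    TF-resp (λ ρ → cong (tuple _) (same (f ρ) x)) (TFᵉ-++ m (TF-drop 1 t) h x)
    where
    same : ∀ {Γ s} {δ : Envᵉ Γ} (v : Vec M (suc m)) (x : s ∈ homes m Γ) →
         All.lookup (Vec.drop 1 v ++ᵉ δ) x ≡ All.lookup (v ++ᵉ δ) (there x)
    same (a ∷ v) x = refl

  TF-evalᵉ  : ∀ {Δ Γ s} {δ : Env Δ → Envᵉ Γ} → TFᵉ δ → (t : Termᵉ Γ s) → TF (λ ρ → tuple s (evalᵉ t (δ ρ)))
  TF-evalsᵉ : ∀ {Δ Γ k} {δ : Env Δ → Envᵉ Γ} → TFᵉ δ → (ts : Vec (Termᵉ Γ home) k) → TF (λ ρ → evalsᵉ ts (δ ρ))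
  TF-evalᵉ h (var x)     = h x
  TF-evalᵉ h (app f ts)  = let (us , i) = TF-evalsᵉ h ts in app f us ∷ [] , λ ρ → cong (λ v → fun 𝕄 f v ∷ []) (i ρ)
  TF-evalᵉ h (proj ε ts) = TF-evalsᵉ h ts
  TF-evalsᵉ h []       = [] , λ _ → refl
  TF-evalsᵉ h (t ∷ ts) = TF-++ (TF-evalᵉ h t) (TF-evalsᵉ h ts)

  -- An imaginary is replaced by a representing tuple: equality in a quotient sort becomes the
  -- formula `E`, and a quantifier over the sort becomes one over a block of variables.
  Def-⊨ᵉ : ∀ {Δ Γ} {δ : Env Δ → Envᵉ Γ} → TFᵉ δ → (ψ : Formulaᵉ Γ) → Def (λ ρ → ⊨ᵉ ψ [ δ ρ ])
  Def-⊨ᵉ h false             = Def-⊥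
  Def-⊨ᵉ h (eq home t u)     = Def-resp (λ _ → mk⇔ (cong Vec.head) (cong (_∷ []))) (Def-≡ (TF-evalᵉ h t) (TF-evalᵉ h u))
  Def-⊨ᵉ h (eq (quot ε) t u) = Def-⊨ (E ε) (DF-++ (TF⇒DF (TF-evalᵉ h t)) (TF⇒DF (TF-evalᵉ h u)))
  Def-⊨ᵉ h (relₐ R ts)       = let (us , i) = TF-evalsᵉ h ts in relₐ R us , λ ρ → ≡⇒⇔ (cong (rel 𝕄 R) (i ρ))
  Def-⊨ᵉ h (φ ⇒ ψ)           = Def-→ (Def-⊨ᵉ h φ) (Def-⊨ᵉ h ψ)
  Def-⊨ᵉ {δ = δ} h (all′ s φ) = Def-resp
    (λ ρ → mk⇔ (λ i a → subst (λ a → ⊨ᵉ φ [ a ∷ δ ρ ]) (untuple-tuple s a) (i (tuple s a))) (λ i v → i (untuple s v)))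
    (Def-∀ {P = λ σ → ⊨ᵉ φ [ untuple s (All.head σ) ∷ δ (All.tail σ) ]}
      (Def-⊨ᵉ (TFᵉ-∷ s TF-head (λ x → TF-tail (h x))) φ))

  ≈-equiv : ∀ s → IsEquivalence ≈[ s ]
  ≈-equiv home     = ≡ₚ.isEquivalence
  ≈-equiv (quot ε) = isEquivalence ε

  _≈ᵉ_ : ∀ {Γ} → Envᵉ Γ → Envᵉ Γ → Set (ℓ ⊔ c)
  _≈ᵉ_ {Γ} ρ σ = ∀ {s} (x : s ∈ Γ) → ≈[ s ] (All.lookup ρ x) (All.lookup σ x)

  ≈ᵉ-∷ : ∀ {Γ s} {a b : ⟦ s ⟧} {ρ σ : Envᵉ Γ} → ≈[ s ] a b → ρ ≈ᵉ σ →
         _≈ᵉ_ {s ∷ Γ} (a ∷ ρ) (b ∷ σ)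
  ≈ᵉ-∷ p q (here refl) = p
  ≈ᵉ-∷ p q (there x)   = q x

  ≈ᵉ-++ : ∀ {Γ m} (a : Vec M m) {ρ σ : Envᵉ Γ} → ρ ≈ᵉ σ → (a ++ᵉ ρ) ≈ᵉ (a ++ᵉ σ)
  ≈ᵉ-++ []      q = q
  ≈ᵉ-++ (x ∷ a) {ρ} {σ} q = ≈ᵉ-∷ {s = home} {ρ = a ++ᵉ ρ} {σ = a ++ᵉ σ} refl (≈ᵉ-++ a {ρ} {σ} q)

  evalᵉ-≈  : ∀ {Γ s} (t : Termᵉ Γ s) {ρ σ : Envᵉ Γ} → ρ ≈ᵉ σ → ≈[ s ] (evalᵉ t ρ) (evalᵉ t σ)
  evalsᵉ-≡ : ∀ {Γ k} (ts : Vec (Termᵉ Γ home) k) {ρ σ : Envᵉ Γ} → ρ ≈ᵉ σ → evalsᵉ ts ρ ≡ evalsᵉ ts σ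
  evalᵉ-≈ (var x)     q = q x
  evalᵉ-≈ (app f ts) {ρ} {σ} q = cong (fun 𝕄 f) (evalsᵉ-≡ ts {ρ} {σ} q)
  evalᵉ-≈ (proj ε ts) {ρ} {σ} q = subst (λ v → ≈[ quot ε ] (evalsᵉ ts ρ) v) (evalsᵉ-≡ ts {ρ} {σ} q) (IsEquivalence.refl (isEquivalence ε) {evalsᵉ ts ρ})
  evalsᵉ-≡ []       q = refl
  evalsᵉ-≡ (t ∷ ts) {ρ} {σ} q = cong₂ _∷_ (evalᵉ-≈ t {ρ} {σ} q) (evalsᵉ-≡ ts {ρ} {σ} q)

  -- Elements of quotient sorts enter a formula only through equality, so the choice of
  -- representatives does not affect its truth.
  ⊨ᵉ-≈ : ∀ {Γ} (ψ : Formulaᵉ Γ) {ρ σ : Envᵉ Γ} → ρ ≈ᵉ σ → ⊨ᵉ ψ [ ρ ] ⇔ ⊨ᵉ ψ [ σ ]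
  ⊨ᵉ-≈ false        q = ⇔.refl
  ⊨ᵉ-≈ (eq s t u) {ρ} {σ} q = mk⇔ (λ h → S.trans (S.sym t≈) (S.trans h u≈)) (λ h → S.trans t≈ (S.trans h (S.sym u≈)))
    where
    module S = IsEquivalence (≈-equiv s)
    t≈ = evalᵉ-≈ t {ρ} {σ} q
    u≈ = evalᵉ-≈ u {ρ} {σ} q
  ⊨ᵉ-≈ (relₐ R ts) {ρ} {σ} q = ≡⇒⇔ (cong (rel 𝕄 R) (evalsᵉ-≡ ts {ρ} {σ} q))
  ⊨ᵉ-≈ (φ ⇒ ψ) {ρ} {σ} q = mk⇔ (λ h → to (⊨ᵉ-≈ ψ {ρ} {σ} q) ∘ h ∘ from (⊨ᵉ-≈ φ {ρ} {σ} q))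
                               (λ h → from (⊨ᵉ-≈ ψ {ρ} {σ} q) ∘ h ∘ to (⊨ᵉ-≈ φ {ρ} {σ} q))
  ⊨ᵉ-≈ (all′ s φ) {ρ} {σ} q = mk⇔ (λ h a → to (i a) (h a)) (λ h a → from (i a) (h a))
    where i = λ a → ⊨ᵉ-≈ φ {a ∷ ρ} {a ∷ σ} (≈ᵉ-∷ {s = s} {ρ = ρ} {σ = σ} (IsEquivalence.refl (≈-equiv s) {a}) q)

  -- Packs finitely many algebraic imaginaries into one home tuple `e`, which decodes by `δ` and
  -- lies in a ∅-definable set with finitely many decodings up to equality in 𝕄^eq.
  record AlgebraicTuples {Γ} (es : All aclᵉ Γ) : Set (ℓ ⊔ lsuc c) where
    field
      {nparams} : ℕ
      δ       : Vec M nparams → Envᵉ Γ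
      δ-def   : ∀ {Δ} {f : Env Δ → Vec M nparams} → TF f → TFᵉ (δ ∘ f)
      Θ       : Pred (Vec M nparams) c
      Θ-def   : Def {nparams ∷ []} (λ ρ → Θ (All.head ρ))
      e       : Vec M nparams
      Θe      : Θ e
      δe      : δ e ≡ All.map proj₁ es
      points  : List (Vec M nparams)
      finite  : ∀ {e′} → Θ e′ → ∃[ e″ ] (e″ ∈ points × δ e′ ≈ᵉ δ e″)

  algebraicTuples : ∀ {Γ} (es : All aclᵉ Γ) → AlgebraicTuples es
  algebraicTuples [] = record
    { δ = λ _ → [] ; δ-def = λ _ () ; Θ = λ _ → ⊤ₚ.⊤ ; Θ-def = Def-⊤ ; e = [] ; Θe = _ ; δe = refl
    ; points = [] ∷ [] ; finite = λ _ → [] , here refl , λ () }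
  algebraicTuples (_∷_ {x = s} (a , θ , θa , as , fin) es) = record
    { nparams  = width s + T.nparams
    ; δ      = λ v → untuple s (Vec.take (width s) v) ∷ T.δ (Vec.drop (width s) v)
    ; δ-def  = λ t → TFᵉ-∷ s (TF-take (width s) t) (T.δ-def (TF-drop (width s) t))
    ; Θ      = λ v → ⊨ᵉ θ [ untuple s (Vec.take (width s) v) ∷ [] ] × T.Θ (Vec.drop (width s) v)
    ; Θ-def  = Def-× (Def-⊨ᵉ (TFᵉ-∷ s (TF-take (width s) TF-head) (λ ())) θ) (Def-at₁ {P = T.Θ} T.Θ-def (DF-drop (width s) DF-head))
    ; e      = tuple s a Vec.++ T.e
    ; Θe     = subst (λ b → ⊨ᵉ θ [ b ∷ [] ]) (sym (unt a T.e)) θa , subst T.Θ (sym (drop-++≡ (tuple s a) T.e)) T.Θe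
    ; δe     = cong₂ _∷_ (unt a T.e) (trans (cong T.δ (drop-++≡ (tuple s a) T.e)) T.δe)
    ; points = cartesianProductWith (λ b v → tuple s b Vec.++ v) as T.points
    ; finite = λ {e′} (p , q) →
        let (b , b∈ , h) = find (fin _ p)
            (v , v∈ , i) = T.finite q
        in tuple s b Vec.++ v , ∈-cartesianProductWith⁺ (λ b v → tuple s b Vec.++ v) b∈ v∈ ,
           ≈ᵉ-∷ {s = s} {ρ = T.δ (Vec.drop (width s) e′)} {σ = T.δ (Vec.drop (width s) (tuple s b Vec.++ v))}
             (subst (≈[ s ] _) (sym (unt b v)) h)
             (subst (λ w → T.δ (Vec.drop (width s) e′) ≈ᵉ T.δ w) (sym (drop-++≡ (tuple s b) v)) i)
    }
    where
    module T = AlgebraicTuples (algebraicTuples es)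
    unt : ∀ b (v : Vec M T.nparams) → untuple s (Vec.take (width s) (tuple s b Vec.++ v)) ≡ b
    unt b v = trans (cong (untuple s) (take-++≡ (tuple s b) v)) (untuple-tuple s b)

  -- The parameters vary over the ∅-definable sets that witness their algebraicity; by `⊨ᵉ-≈`
  -- equivalent representatives yield the same fibre.
  AclEqDefinable⇒FiniteFamily : {H : Pred (Vec M m) c} → AclEqDefinable H → FiniteFamily H
  AclEqDefinable⇒FiniteFamily (Γ , ψ , es , H⊆ , H⊇) = record
    { Member     = λ a v → ⊨ᵉ ψ [ a ++ᵉ T.δ v ]
    ; Member-def = Def-⊨ᵉ (TFᵉ-++ _ TF-head (T.δ-def (TF-tail TF-head))) ψ
    ; Θ          = T.Θ
    ; Θ-def      = T.Θ-def
    ; e          = T.e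
    ; Θe         = T.Θe
    ; isMember     = λ a → ⇔.trans (mk⇔ H⊆ H⊇) (≡⇒⇔ (cong (λ ρ → ⊨ᵉ ψ [ a ++ᵉ ρ ]) (sym T.δe)))
    ; es         = T.points
    ; finite     = λ {e′} p → let (v , v∈ , h) = T.finite p in v , v∈ , λ a →
                     ⊨ᵉ-≈ ψ {a ++ᵉ T.δ e′} {a ++ᵉ T.δ v} (≈ᵉ-++ a {T.δ e′} {T.δ v} h)
    }
    where
    module T = AlgebraicTuples (algebraicTuples es)

¬-⇔ : ∀ {a} {A B : Set a} → A ⇔ B → (¬ A) ⇔ (¬ B)
¬-⇔ h = mk⇔ (λ p → p ∘ from h) (λ p → p ∘ to h)

-- Powers of the group and their definable subgroups.

module OneBasedGroups (em : ∀ {a} → ExcludedMiddle a) {ℓ c} (G : ExpandedGroup ℓ c) where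

  open ExpandedGroup G using (language; mul; _∙_; unit; _⁻¹; isGroup)

  𝕄 : Structure language c
  𝕄 = structure G

  M : Set c
  M = Carrier 𝕄

  open Definability em 𝕄
  open Families em 𝕄

  infixl 7 _∙ᵛ_
  infix 8 _⁻¹ᵛ
  _∙ᵛ_ : ∀ {m} → Vec M m → Vec M m → Vec M m
  _∙ᵛ_ = Vec.zipWith _∙_
  _⁻¹ᵛ : ∀ {m} → Vec M m → Vec M m
  _⁻¹ᵛ = Vec.map _⁻¹
  1ᵛ : ∀ {m} → Vec M m
  1ᵛ = Vec.replicate _ unit

  abstract
    vec-isGroup : ∀ m → IsGroup _≡_ (_∙ᵛ_ {m}) 1ᵛ _⁻¹ᵛ
    vec-isGroup m = record
      { isMonoid = record
        { isSemigroup = record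
          { isMagma = record { isEquivalence = ≡ₚ.isEquivalence ; ∙-cong = cong₂ _∙ᵛ_ }
          ; assoc   = Vecₚ.zipWith-assoc (IsGroup.assoc isGroup) }
        ; identity = Vecₚ.zipWith-identityˡ (IsGroup.identityˡ isGroup) , Vecₚ.zipWith-identityʳ (IsGroup.identityʳ isGroup) }
      ; inverse = Vecₚ.zipWith-inverseˡ (IsGroup.inverseˡ isGroup) , Vecₚ.zipWith-inverseʳ (IsGroup.inverseʳ isGroup)
      ; ⁻¹-cong = cong _⁻¹ᵛ
      }

  module Gᵛ {m} = IsGroup (vec-isGroup m)
  open module Coversᵛ {m} = Covers em (vec-isGroup m) public

  toSub : ∀ {m} {K : Pred (Vec M m) c} → IsSubgroup G K → Sub K
  toSub s = record { ε∈ = S.unit-closed ; ∙∈ = S.mul-closed ; ⁻¹∈ = S.inv-closed }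
    where
    module S = IsSubgroup s

  private
    variable
      Γ : List ℕ
      m n p k : ℕ

  TF-∙ : {f g : Env Γ → Vec M k} → TF f → TF g → TF (λ ρ → f ρ ∙ᵛ g ρ)
  TF-∙ (ts , h) (us , i) = Vec.zipWith prod ts us , λ ρ → trans (evals-zip ts us) (cong₂ _∙ᵛ_ (h ρ) (i ρ))
    where
    prod : ∀ {n} → Term language n → Term language n → Term language n
    prod t u = app mul (t ∷ u ∷ [])
    evals-zip : ∀ {k n ρ} (ts us : Vec (Term language n) k) →
                evals 𝕄 (Vec.zipWith prod ts us) ρ ≡ evals 𝕄 ts ρ ∙ᵛ evals 𝕄 us ρ
    evals-zip []       []       = refl
    evals-zip (t ∷ ts) (u ∷ us) = cong (_ ∷_) (evals-zip ts us)

  DF-∙ : {f g : Env Γ → Vec M k} → DF f → DF g → DF (λ ρ → f ρ ∙ᵛ g ρ)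
  DF-∙ = DF₂ _∙ᵛ_ TF-∙

  -- The unit is the only idempotent, and x ⁻¹ is the only y with x y x = x.
  DF-1 : DF {Γ} {k} (λ _ → 1ᵛ)
  DF-1 = mkDF (Def-resp (λ σ → mk⇔ idem idem⁻) (Def-≡ (TF-∙ TF-head TF-head) TF-head))
    where
    idem⁻ : ∀ {m} {y : Vec M m} → y ≡ 1ᵛ → y ∙ᵛ y ≡ y
    idem⁻ refl = Gᵛ.identityˡ _
    idem : ∀ {m} {y : Vec M m} → y ∙ᵛ y ≡ y → y ≡ 1ᵛ
    idem {y = y} e = trans (sym (trans (cong (_∙ᵛ y) (Gᵛ.inverseˡ y)) (Gᵛ.identityˡ y)))
      (trans (Gᵛ.assoc _ _ _) (trans (cong (y ⁻¹ᵛ ∙ᵛ_) e) (Gᵛ.inverseˡ y)))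

  DF-⁻¹ : {f : Env Γ → Vec M k} → DF f → DF (λ ρ → f ρ ⁻¹ᵛ)
  DF-⁻¹ d = mkDF (Def-sub₁ {P = λ σ → All.head (All.tail σ) ≡ All.head σ ⁻¹ᵛ}
    (Def-resp (λ σ → mk⇔ inverse inverse⁻)
      (Def-≡ (TF-∙ (TF-∙ TF-head (TF-tail TF-head)) TF-head) TF-head))
    (DF-tail d))
    where
    inverse⁻ : ∀ {m} {x y : Vec M m} → y ≡ x ⁻¹ᵛ → x ∙ᵛ y ∙ᵛ x ≡ x
    inverse⁻ {x = x} refl = trans (cong (_∙ᵛ x) (Gᵛ.inverseʳ x)) (Gᵛ.identityˡ x)
    inverse : ∀ {m} {x y : Vec M m} → x ∙ᵛ y ∙ᵛ x ≡ x → y ≡ x ⁻¹ᵛ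
    inverse {x = x} {y} e = trans (sym (Gᵛ.identityˡ y)) (trans (cong (_∙ᵛ y) (sym (Gᵛ.inverseˡ x)))
      (trans (Gᵛ.assoc _ _ _) (trans (cong (x ⁻¹ᵛ ∙ᵛ_) xy≡1) (Gᵛ.identityʳ _))))
      where
      xy≡1 : x ∙ᵛ y ≡ 1ᵛ
      xy≡1 = trans (sym (Gᵛ.identityʳ _)) (trans (cong (x ∙ᵛ y ∙ᵛ_) (sym (Gᵛ.inverseʳ x)))
        (trans (sym (Gᵛ.assoc _ _ _)) (trans (cong (_∙ᵛ x ⁻¹ᵛ) e) (Gᵛ.inverseʳ x))))

  -- Definability with parameters, with the dependence on the parameters kept explicit so that
  -- formulas built from `K` can treat them as variables.
  record ParamDef {m} (K : Pred (Vec M m) c) : Set (ℓ ⊔ lsuc c) where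
    field
      {arityₚ}   : ℕ
      Member     : Vec M m → Vec M arityₚ → Set c
      Member-def : Def {m ∷ arityₚ ∷ []} (λ ρ → Member (All.head ρ) (All.head (All.tail ρ)))
      param      : Vec M arityₚ
      spec       : ∀ a → K a ⇔ Member a param

    Member-at : {f : Env Γ → Vec M m} {g : Env Γ → Vec M arityₚ} → DF f → DF g → Def (λ ρ → Member (f ρ) (g ρ))
    Member-at = Def-at₂ {P = Member} Member-def

  record DefinableSubgroup (m : ℕ) : Set (ℓ ⊔ lsuc c) where
    field
      ⟨_⟩ : Pred (Vec M m) c
      sub : Sub ⟨_⟩
      def : ParamDef ⟨_⟩
  open DefinableSubgroup public

  -- _≲_ with a prescribed number of translates, which makes it first-order.
  Cov : ℕ → Pred (Vec M m) c → Pred (Vec M m) c → Set c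
  Cov zero    U W = ∀ x → ¬ U x
  Cov (suc n) U W = ∃[ g ] Cov n (λ x → U x × ¬ W (g ⁻¹ᵛ ∙ᵛ x)) W

  Cov⇒≲ : ∀ n {U W : Pred (Vec M m) c} → Cov n U W → U ≲ W
  Cov⇒≲ zero    h = ∅≲ (h _)
  Cov⇒≲ (suc n) {U} {W} (g , h) with Cov⇒≲ n h
  ... | cs , f = g ∷ cs , λ {x} Ux → case em {P = W (g ⁻¹ᵛ ∙ᵛ x)} of λ
    { (yes p) → g , here refl , p ; (no ¬p) → let (d , d∈ , q) = f (Ux , ¬p) in d , there d∈ , q }

  ≲⇒Cov : {U W : Pred (Vec M m) c} → U ≲ W → ∃[ n ] Cov n U W
  ≲⇒Cov (cs , f) = length cs , go cs f
    where
    go : ∀ cs {U W} → (∀ {x} → U x → ∃[ d ] (d ∈ cs × W (d ⁻¹ᵛ ∙ᵛ x))) → Cov (length cs) U W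
    go []       f x Ux = case f Ux of λ ()
    go (d ∷ cs) f = d , go cs λ (Ux , ¬p) → case f Ux of λ
      { (_ , here refl , p) → ⊥-elim (¬p p) ; (b , there b∈ , p) → b , b∈ , p }

  Def-Cov : ∀ n {U W : Env Γ → Pred (Vec M m) c} →
            Def {m ∷ Γ} (λ σ → U (All.tail σ) (All.head σ)) → Def {m ∷ Γ} (λ σ → W (All.tail σ) (All.head σ)) →
            Def {Γ} (λ ρ → Cov n (U ρ) (W ρ))
  Def-Cov zero    {U}     u w = Def-∀ {P = λ σ → ¬ U (All.tail σ) (All.head σ)} (Def-¬ u)
  Def-Cov (suc n) {U} {W} u w = Def-∃
    {P = λ σ → Cov n (λ x → U (All.tail σ) x × ¬ W (All.tail σ) (All.head σ ⁻¹ᵛ ∙ᵛ x)) (W (All.tail σ))}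
    (Def-Cov n
      (Def-× (Def-skip {P = λ σ → U (All.tail σ) (All.head σ)} u)
        (Def-¬ (Def-sub₁ {P = λ τ → W (All.tail (All.tail (All.tail τ))) (All.head τ)}
          (Def-skip {P = λ τ → W (All.tail (All.tail τ)) (All.head τ)} (Def-skip {P = λ τ → W (All.tail τ) (All.head τ)} w))
          (DF-∙ (DF-⁻¹ (DF-tail DF-head)) DF-head))))
      (Def-skip {P = λ σ → W (All.tail σ) (All.head σ)} w))

  -- Sets determined by finitely many cosets.

  record AclCoset (m : ℕ) : Set (ℓ ⊔ lsuc c) where
    field
      set       : Pred (Vec M m) c
      base      : Vec M m
      H         : Pred (Vec M m) c
      H-sub     : Sub H
      H-family  : FiniteFamily H
      set-coset : ∀ x → set x ⇔ H (base ⁻¹ᵛ ∙ᵛ x)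
  open AclCoset

  toAclCoset : {C : Pred (Vec M m) c} → CosetOfAclEqSubgroup G C → AclCoset m
  toAclCoset {C = C} (H , s , d , g , C⊆ , C⊇) = record
    { set = C ; base = g ; H = H ; H-sub = toSub s ; H-family = AclEqDefinable⇒FiniteFamily d
    ; set-coset = λ x → mk⇔
        (λ p → let (h , Hh , e) = C⊆ p in subst H (trans (sym (x⁻¹xy g h)) (cong (g ⁻¹ᵛ ∙ᵛ_) (sym e))) Hh)
        (λ p → C⊇ (_ , p , sym (xx⁻¹y g x))) }
    where
    x⁻¹xy : ∀ x y → x ⁻¹ᵛ ∙ᵛ (x ∙ᵛ y) ≡ y
    x⁻¹xy x y = trans (sym (Gᵛ.assoc _ _ _)) (trans (cong (_∙ᵛ y) (Gᵛ.inverseˡ x)) (Gᵛ.identityˡ y))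
    xx⁻¹y : ∀ x y → x ∙ᵛ (x ⁻¹ᵛ ∙ᵛ y) ≡ y
    xx⁻¹y x y = trans (sym (Gᵛ.assoc _ _ _)) (trans (cong (_∙ᵛ y) (Gᵛ.inverseʳ x)) (Gᵛ.identityˡ y))

  -- What remains of a Boolean combination: membership depends only on which of the cosets contain
  -- the point.
  Determines : List (AclCoset m) → Pred (Vec M m) c → Set (ℓ ⊔ lsuc c)
  Determines Cs P = ∀ {u v} → All (λ C → set C u ⇔ set C v) Cs → P u ⇔ P v

  determined : {P : Pred (Vec M m) c} → BooleanCombination (CosetOfAclEqSubgroup G) P → ∃[ Cs ] Determines Cs P
  determined (gen C)   = toAclCoset C ∷ [] , λ { (h ∷ []) → h }
  determined (comp b)  = let (Cs , h) = determined b in Cs , λ as → ¬-⇔ (h as)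
  determined (cup b d) =
    let (Cs , h) = determined b ; (Ds , i) = determined d
    in Cs ++ Ds , λ as → let p = h (Allₚ.++⁻ˡ Cs as) ; q = i (Allₚ.++⁻ʳ Cs as) in
       mk⇔ (λ { (inj₁ x) → inj₁ (to p x) ; (inj₂ y) → inj₂ (to q y) })
           (λ { (inj₁ x) → inj₁ (from p x) ; (inj₂ y) → inj₂ (from q y) })
  determined (cap b d) =
    let (Cs , h) = determined b ; (Ds , i) = determined d
    in Cs ++ Ds , λ as → ×-⇔ (h (Allₚ.++⁻ˡ Cs as)) (i (Allₚ.++⁻ʳ Cs as))
  determined (resp (P⊆Q , Q⊆P) b) = let (Cs , h) = determined b in Cs , λ as → ⇔.trans (mk⇔ Q⊆P P⊆Q) (⇔.trans (h as) (mk⇔ P⊆Q Q⊆P))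

  ⋂ₕ : List (AclCoset m) → Pred (Vec M m) c
  ⋂ₕ []       = λ _ → ⊤ₚ.⊤
  ⋂ₕ (C ∷ Cs) = H C ∩ ⋂ₕ Cs

  ⋂ₕ-sub : (Cs : List (AclCoset m)) → Sub (⋂ₕ Cs)
  ⋂ₕ-sub []       = record { ε∈ = _ ; ∙∈ = λ _ _ → _ ; ⁻¹∈ = λ _ → _ }
  ⋂ₕ-sub (C ∷ Cs) = Sub-∩ (H-sub C) (⋂ₕ-sub Cs)

  ⋂ₕ-family : (Cs : List (AclCoset m)) → FiniteFamily (⋂ₕ Cs)
  ⋂ₕ-family []       = FiniteFamily-⊤
  ⋂ₕ-family (C ∷ Cs) = FiniteFamily-∩ (H-family C) (⋂ₕ-family Cs)

  ≲-⋂ₕ : {J : Pred (Vec M m) c} (Cs : List (AclCoset m)) → All (λ C → J ≲ H C) Cs → J ≲ ⋂ₕ Cs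
  ≲-⋂ₕ []       []       = ⊆⇒≲ _
  ≲-⋂ₕ (C ∷ Cs) (p ∷ ps) = ≲-∩ (H-sub C) (⋂ₕ-sub Cs) p (≲-⋂ₕ Cs ps)

  ∈-⋂ₕ : ∀ {Cs : List (AclCoset m)} {C x} → C ∈ Cs → ⋂ₕ Cs x → H C x
  ∈-⋂ₕ (here refl) (p , _) = p
  ∈-⋂ₕ (there i)   (_ , q) = ∈-⋂ₕ i q

  private
    Bad : List (AclCoset m) → Pred (Vec M m) (ℓ ⊔ lsuc c)
    Bad R x = Any (λ C → H C (base C ⁻¹ᵛ ∙ᵛ x)) R

    ⋃ₕ : List (AclCoset m) → Pred (Vec M m) c
    ⋃ₕ R = ⋃ (List.map H R)

    Bad≲⋃ₕ : (R : List (AclCoset m)) → Bad R ≲ ⋃ₕ R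
    Bad≲⋃ₕ R = List.map base R , λ b → let (C , C∈ , p) = find b in base C , ∈-map⁺ base C∈ , ∈-⋃ (∈-map⁺ H C∈) p

    Subs : (R : List (AclCoset m)) → All Sub (List.map H R)
    Subs []      = []
    Subs (C ∷ R) = H-sub C ∷ Subs R

    -- A coset of a subgroup from `S` contains both points or neither, as they differ by an element
    -- of that subgroup; a coset from `R` contains neither.
    same-traces : ∀ {S R : List (AclCoset m)} {u v} → ⋂ₕ S u → ⋂ₕ S v → ¬ Bad R u → ¬ Bad R v →
                  ∀ {C} → C ∈ S ⊎ C ∈ R → set C u ⇔ set C v
    same-traces {u = u} {v} Nu Nv ¬bu ¬bv {C} C∈ = ⇔.trans (set-coset C u) (⇔.trans (same C∈) (⇔.sym (set-coset C v)))
      where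
      step : ∀ {x y} → H C x → H C y → H C (base C ⁻¹ᵛ ∙ᵛ x) → H C (base C ⁻¹ᵛ ∙ᵛ y)
      step Hx Hy p = coset-trans (H-sub C) p (Sub.∙∈ (H-sub C) (Sub.⁻¹∈ (H-sub C) Hx) Hy)
      same : C ∈ _ ⊎ C ∈ _ → H C (base C ⁻¹ᵛ ∙ᵛ u) ⇔ H C (base C ⁻¹ᵛ ∙ᵛ v)
      same (inj₁ C∈S) = mk⇔ (step (∈-⋂ₕ C∈S Nu) (∈-⋂ₕ C∈S Nv)) (step (∈-⋂ₕ C∈S Nv) (∈-⋂ₕ C∈S Nu))
      same (inj₂ C∈R) = mk⇔ (λ p → ⊥-elim (¬bu (Any.map (λ { refl → p }) C∈R)))
                            (λ p → ⊥-elim (¬bv (Any.map (λ { refl → p }) C∈R)))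

    -- Otherwise Neumann's lemma provides a point `u` of `J` and a point `v` outside `J`, both in
    -- the intersection over `S` and outside all cosets from `R`, since no subgroup from `R` covers
    -- `J` by finitely many translates. The cosets in `Cs` cannot tell `u` from `v`, a
    -- contradiction.
    ⋂ₕ≲ : ∀ {J : Pred (Vec M m) c} {Cs} → Determines Cs J → Sub J → ∀ S R →
          (∀ {C} → C ∈ Cs → C ∈ S ⊎ C ∈ R) → J ≲ ⋂ₕ S → All (λ C → ¬ J ≲ H C) R → ⋂ₕ S ≲ J
    ⋂ₕ≲ {J = J} h J-sub S R split J≲N J⋦R = ¬¬-elim λ N⋦J →
      let (u , (Ju , Nu) , ¬bu) = not-⊆ {U = J ∩ ⋂ₕ S} {W = Bad R} λ sub →
            noR J-sub (⊆⇒≲ id) (≲-trans (≲-∩ J-sub (⋂ₕ-sub S) (⊆⇒≲ id) J≲N) (≲-monoˡ sub (Bad≲⋃ₕ R)))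
          (v , Nv , ¬JBv) = not-⊆ {U = ⋂ₕ S} {W = J ∪ Bad R} λ sub →
            case neumann (⋂ₕ-sub S) J-sub (≲-monoˡ {V = J ∪ Bad R} sub
                   (≲-∪ (≲-monoʳ inj₁ (⊆⇒≲ id)) (≲-monoʳ inj₂ (Bad≲⋃ₕ R)))) of λ
              { (inj₁ q) → N⋦J q ; (inj₂ q) → noR (⋂ₕ-sub S) J≲N q }
      in ¬JBv (inj₁ (to (h (All.tabulate (same-traces {S = S} {R = R} Nu Nv ¬bu (¬JBv ∘ inj₂) ∘ split))) Ju))
      where
      noR : {A : Pred (Vec M _) c} → Sub A → J ≲ A → ¬ (A ≲ ⋃ₕ R)
      noR A-sub J≲A A≲ = let (C , C∈ , p) = find (Anyₚ.map⁻ (neumann-⋃ A-sub (Subs R) A≲))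
                         in All.lookup J⋦R C∈ (≲-trans J≲A p)

  -- The subgroup `N` is the intersection of those subgroups from `Cs` that cover `J` by finitely
  -- many translates.
  commensurable : ∀ {J : Pred (Vec M m) c} Cs → Determines Cs J → Sub J →
                  ∃[ N ] (FiniteFamily N × J ≲ N × N ≲ J)
  commensurable {J = J} Cs h J-sub = ⋂ₕ S , ⋂ₕ-family S , J≲N , ⋂ₕ≲ h J-sub S R split J≲N (Allₚ.all-filter (¬? ∘ J≲?) Cs)
    where
    J≲? = λ (C : AclCoset _) → em {P = J ≲ H C}
    S = filter J≲? Cs
    R = filter (¬? ∘ J≲?) Cs
    J≲N : J ≲ ⋂ₕ S
    J≲N = ≲-⋂ₕ S (Allₚ.all-filter J≲? Cs)
    split : ∀ {C} → C ∈ Cs → C ∈ S ⊎ C ∈ R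
    split {C} C∈ with em {P = J ≲ H C}
    ... | yes p = inj₁ (∈-filter⁺ J≲? C∈ p)
    ... | no ¬p = inj₂ (∈-filter⁺ (¬? ∘ J≲?) C∈ ¬p)

  -- Generic points and conjugates of a definable subgroup.

  module _ (K : DefinableSubgroup m) where

    private
      module KD = ParamDef (def K)

    FormulaOver : Set ℓ
    FormulaOver = Formula language (m + KD.arityₚ)

    -- The formula may fail on `L` only inside finitely many cosets of `K`. It uses no parameters
    -- but those of `K`, so that the candidates form a small type, as saturation demands.
    Large : Pred (Vec M m) c → FormulaOver → Set c
    Large L χ = (λ x → L x × ¬ instanceOf 𝕄 χ KD.param x) ≲ ⟨ K ⟩

    private
      -- A tautology stands in for a formula that is not large. The type can thus be indexed by all
      -- formulas, without storing proofs of largeness from a possibly bigger universe.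
      orTrue : ∀ {L} (χ : FormulaOver) → Dec (Large L χ) → FormulaOver
      orTrue χ (yes _) = χ
      orTrue χ (no _)  = false ⇒ false

      orTrue≲ : ∀ {L} χ (d : Dec (Large L χ)) → (λ x → L x × ¬ instanceOf 𝕄 (orTrue χ d) KD.param x) ≲ ⟨ K ⟩
      orTrue≲ χ (yes p) = p
      orTrue≲ χ (no _)  = ∅≲ λ (_ , q) → q id

      orTrue-large : ∀ {L} χ (d : Dec (Large L χ)) → Large L χ → ∀ {x} →
                     instanceOf 𝕄 (orTrue χ d) KD.param x → instanceOf 𝕄 χ KD.param x
      orTrue-large χ (yes _) _ p = p
      orTrue-large χ (no ¬l) l _ = ⊥-elim (¬l l)

    -- Finitely many conditions exclude only finitely many cosets of `K` from `L`, and these do not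
    -- cover `L`; saturation then realises all conditions together.
    generic-point : Saturated 𝕄 → (L : DefinableSubgroup m) → ¬ ⟨ L ⟩ ≲ ⟨ K ⟩ →
                    ∃[ x ] (∀ χ → Large ⟨ L ⟩ χ → instanceOf 𝕄 χ KD.param x)
    generic-point saturated L L⋦K =
      let (x , all) = saturated m π consistent in x , λ χ l → orTrue-large χ em l (all (inj₁ χ))
      where
      module LD = ParamDef (def L)
      ψL : Σ[ ψ ∈ Formula language (m + LD.arityₚ) ] ∀ x y → 𝕄 ⊨ ψ [ x Vec.++ y ] ⇔ LD.Member x y
      ψL = toFormula {P = λ ρ → LD.Member (All.head ρ) (All.head (All.tail ρ))} LD.Member-def
      π : PartialType 𝕄 m
      π = record
        { Index   = FormulaOver ⊎ ⊤ₚ.⊤ {ℓ}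
        ; arity   = λ { (inj₁ _) → KD.arityₚ ; (inj₂ _) → LD.arityₚ }
        ; formula = λ { (inj₁ χ) → orTrue χ (em {P = Large ⟨ L ⟩ χ}) ; (inj₂ _) → proj₁ ψL }
        ; param   = λ { (inj₁ _) → KD.param ; (inj₂ _) → LD.param }
        }
      excluded≲ : ∀ j → (λ x → ⟨ L ⟩ x × ¬ member π j x) ≲ ⟨ K ⟩
      excluded≲ (inj₁ χ) = orTrue≲ χ em
      excluded≲ (inj₂ _) = ∅≲ λ {x} (Lx , q) → q (from (proj₂ ψL x LD.param) (to (LD.spec x) Lx))
      consistent : Consistent π
      consistent js =
        let (x , Lx , ok) = not-⊆ {U = ⟨ L ⟩} {W = λ x → ∃[ j ] (j ∈ js × ⟨ L ⟩ x × ¬ member π j x)}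
                              λ sub → L⋦K (≲-monoˡ sub (≲-⋃ js excluded≲))
        in x , All.tabulate λ {j} j∈ → ¬¬-elim λ q → ok (j , j∈ , Lx , q)

    conjMember : Vec M m → Vec M KD.arityₚ → Pred (Vec M m) c
    conjMember y v z = KD.Member (y ⁻¹ᵛ ∙ᵛ (z ∙ᵛ y)) v

    conj-spec : ∀ y z → conj y ⟨ K ⟩ z ⇔ conjMember y KD.param z
    conj-spec y z = KD.spec _

    conjMember-def : {f g : Env Γ → Vec M m} {h : Env Γ → Vec M KD.arityₚ} → DF f → DF g → DF h →
                     Def (λ ρ → conjMember (f ρ) (h ρ) (g ρ))
    conjMember-def d e i = KD.Member-at (DF-∙ (DF-⁻¹ d) (DF-∙ e d)) i

    -- The conjugate is definable over `x` and the parameters of `K`, so one-basedness writes it by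
    -- cosets and `commensurable` applies.
    conj-commensurable : OneBased G → ∀ x → ∃[ N ] (FiniteFamily N × conj x ⟨ K ⟩ ≲ N × N ≲ conj x ⟨ K ⟩)
    conj-commensurable oneBased x =
      let (Cs , h) = determined (oneBased m _ (proj₁ ψ) (x Vec.++ KD.param))
      in commensurable Cs (λ as → ⇔.trans (⇔.sym (ψ-spec _)) (⇔.trans (h as) (ψ-spec _))) (Sub-conj x (sub K))
      where
      ψ : Σ[ ψ ∈ Formula language (m + (m + KD.arityₚ)) ]
            ∀ z v → 𝕄 ⊨ ψ [ z Vec.++ v ] ⇔ conjMember (Vec.take m v) (Vec.drop m v) z
      ψ = toFormula {P = λ ρ → conjMember (Vec.take m (All.head (All.tail ρ))) (Vec.drop m (All.head (All.tail ρ))) (All.head ρ)}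
        (conjMember-def (DF-take m (DF-tail DF-head)) DF-head (DF-drop m (DF-tail DF-head)))
      ψ-spec : ∀ z → instanceOf 𝕄 (proj₁ ψ) (x Vec.++ KD.param) z ⇔ conj x ⟨ K ⟩ z
      ψ-spec z = ⇔.trans (proj₂ ψ z (x Vec.++ KD.param))
        (⇔.trans (≡⇒⇔ (cong₂ (λ y v → conjMember y v z) (take-++≡ x KD.param) (drop-++≡ x KD.param)))
                 (⇔.sym (conj-spec x z)))

    module _ {N : Pred (Vec M m) c} (F : FiniteFamily N) (n₁ n₂ : ℕ) where

      private
        module F = FiniteFamily F

      Close : Vec M F.nparams → Vec M m → Vec M KD.arityₚ → Set c
      Close e y v = F.Θ e × Cov n₁ (conjMember y v) (λ a → F.Member a e) × Cov n₂ (λ a → F.Member a e) (conjMember y v)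

      -- Quantifying over the parameter `e` of the family and fixing the numbers of translates makes
      -- the condition first-order, with the parameters of `K` as the only ones.
      far-formula : Σ[ χ ∈ FormulaOver ] ∀ y v → 𝕄 ⊨ χ [ y Vec.++ v ] ⇔ (¬ (∃[ e ] Close e y v))
      far-formula = toFormula {P = λ ρ → ¬ (∃[ e ] Close e (All.head ρ) (All.head (All.tail ρ)))}
        (Def-¬ (Def-∃ {P = λ σ → Close (All.head σ) (All.head (All.tail σ)) (All.head (All.tail (All.tail σ)))}
          (Def-× (Def-at₁ {P = F.Θ} F.Θ-def DF-head)
            (Def-× (Def-Cov n₁ {U = U} {W = W} u-def w-def) (Def-Cov n₂ {U = W} {W = U} w-def u-def)))))
        where
        U W : Env (F.nparams ∷ m ∷ KD.arityₚ ∷ []) → Pred (Vec M m) c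
        U σ = conjMember (All.head (All.tail σ)) (All.head (All.tail (All.tail σ)))
        W σ a = F.Member a (All.head σ)
        u-def : Def (λ τ → U (All.tail τ) (All.head τ))
        u-def = conjMember-def (DF-tail (DF-tail DF-head)) DF-head (DF-tail (DF-tail (DF-tail DF-head)))
        w-def : Def (λ τ → W (All.tail τ) (All.head τ))
        w-def = Def-at₂ {P = F.Member} F.Member-def DF-head (DF-tail DF-head)

      -- If the formula fails at `y`, the conjugate by `y` is commensurable to one of finitely many
      -- sets. For each such set fix one suitable `g` in `L`; by `conj-shift` the other `y` have
      -- g⁻¹y among the elements a with K ≲ aKa⁻¹, and these are covered by `few`.
      far-large : (L : Pred (Vec M m) c) → Sub L → (λ x → L x × ⟨ K ⟩ ≲ conj x ⟨ K ⟩) ≲ ⟨ K ⟩ → Large L (proj₁ far-formula)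
      far-large L L-sub few = ≲-monoˡ
        (λ {y} (Ly , ¬χ) → let (e , Θe , p , q) = ¬¬-elim (λ r → ¬χ (from (proj₂ far-formula y KD.param) r))
                               (e″ , e″∈ , h) = F.finite Θe
                           in e″ , e″∈ , Ly
                              , ≲-monoˡ (to (conj-spec y _)) (≲-monoʳ (to (h _)) (Cov⇒≲ n₁ p))
                              , ≲-monoˡ (from (h _)) (≲-monoʳ (from (conj-spec y _)) (Cov⇒≲ n₂ q)))
        (≲-⋃ F.es CloseTo≲)
        where
        CloseTo : Vec M F.nparams → Pred (Vec M m) c
        CloseTo e y = L y × conj y ⟨ K ⟩ ≲ (λ a → F.Member a e) × (λ a → F.Member a e) ≲ conj y ⟨ K ⟩
        CloseTo≲ : ∀ e → CloseTo e ≲ ⟨ K ⟩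
        CloseTo≲ e with em {P = ∃ (CloseTo e)}
        ... | no ¬p = ∅≲ λ p → ¬p (_ , p)
        ... | yes (g , Lg , g≲ , ≲g) = ≲-monoˡ
          (λ {y} (Ly , y≲ , ≲y) → Sub.∙∈ L-sub (Sub.⁻¹∈ L-sub Lg) Ly , conj-shift g y (≲-trans g≲ ≲y))
          (≲-translate (g ⁻¹ᵛ) few)

    -- A generic point x of L lies outside every definable set covered by
    -- finitely many cosets of K.  Were the a ∈ L with K ≲ aKa⁻¹ covered by
    -- finitely many cosets of K, then so would be the y ∈ L with yKy⁻¹
    -- commensurable to a member of a finite ∅-definable family; but one of
    -- these families has a member commensurable to xKx⁻¹.
    normalising-large : Saturated 𝕄 → OneBased G → (L : DefinableSubgroup m) → ¬ ⟨ L ⟩ ≲ ⟨ K ⟩ →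
                        ¬ (λ x → ⟨ L ⟩ x × ⟨ K ⟩ ≲ conj x ⟨ K ⟩) ≲ ⟨ K ⟩
    normalising-large saturated oneBased L L⋦K few =
      let (x , generic) = generic-point saturated L L⋦K
          (_ , F , J≲N , N≲J) = conj-commensurable oneBased x
      in absurd x generic F J≲N N≲J
      where
      absurd : ∀ x → (∀ χ → Large ⟨ L ⟩ χ → instanceOf 𝕄 χ KD.param x) →
               ∀ {N} → FiniteFamily N → conj x ⟨ K ⟩ ≲ N → N ≲ conj x ⟨ K ⟩ → ⊥
      absurd x generic F J≲N N≲J =
        let (n₁ , cov₁) = ≲⇒Cov {U = conjMember x KD.param} {W = λ a → F.Member a F.e}
                            (≲-monoˡ (from (conj-spec x _)) (≲-monoʳ (to (F.isMember _)) J≲N))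
            (n₂ , cov₂) = ≲⇒Cov {U = λ a → F.Member a F.e} {W = conjMember x KD.param}
                            (≲-monoˡ (from (F.isMember _)) (≲-monoʳ (to (conj-spec x _)) N≲J))
        in to (proj₂ (far-formula F n₁ n₂) x KD.param)
              (generic (proj₁ (far-formula F n₁ n₂)) (far-large F n₁ n₂ ⟨ L ⟩ (sub L) few)) (F.e , F.Θe , cov₁ , cov₂)
        where
        module F = FiniteFamily F

-- Irredundant families of definable subgroups.

module Irredundance (em : ∀ {a} → ExcludedMiddle a) {ℓ c} (G : ExpandedGroup ℓ c) where

  open ExpandedGroup G using (language; _∙_; unit; _⁻¹)
  open OneBasedGroups em G
  open Definability em 𝕄
  open Families em 𝕄
  open Sub

  private
    variable
      j k m : ℕ

  ⊤ˢ : DefinableSubgroup m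
  ⊤ˢ = record
    { ⟨_⟩ = λ _ → ⊤ₚ.⊤
    ; sub = record { ε∈ = _ ; ∙∈ = λ _ _ → _ ; ⁻¹∈ = λ _ → _ }
    ; def = record { Member = λ _ _ → ⊤ₚ.⊤ ; Member-def = Def-⊤ ; param = [] ; spec = λ _ → ⇔.refl }
    }

  _∩ˢ_ : DefinableSubgroup m → DefinableSubgroup m → DefinableSubgroup m
  K ∩ˢ L = record
    { ⟨_⟩ = ⟨ K ⟩ ∩ ⟨ L ⟩
    ; sub = Sub-∩ (sub K) (sub L)
    ; def = record
      { Member     = λ a v → KD.Member a (Vec.take KD.arityₚ v) × LD.Member a (Vec.drop KD.arityₚ v)
      ; Member-def = Def-× (KD.Member-at DF-head (DF-take _ (DF-tail DF-head))) (LD.Member-at DF-head (DF-drop _ (DF-tail DF-head)))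
      ; param      = KD.param Vec.++ LD.param
      ; spec       = λ a → ×-⇔ (⇔.trans (KD.spec a) (≡⇒⇔ (cong (KD.Member a) (sym (take-++≡ KD.param LD.param)))))
                               (⇔.trans (LD.spec a) (≡⇒⇔ (cong (LD.Member a) (sym (drop-++≡ KD.param LD.param)))))
      }
    }
    where
    module KD = ParamDef (def K)
    module LD = ParamDef (def L)

  ⋂ˢ : List (DefinableSubgroup m) → DefinableSubgroup m
  ⋂ˢ []       = ⊤ˢ
  ⋂ˢ (K ∷ Ks) = K ∩ˢ ⋂ˢ Ks

  ⋂ : List (DefinableSubgroup m) → Pred (Vec M m) c
  ⋂ Ks = ⟨ ⋂ˢ Ks ⟩

  ⋂-lookup : ∀ {Ks : List (DefinableSubgroup m)} {K x} → ⋂ Ks x → K ∈ Ks → ⟨ K ⟩ x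
  ⋂-lookup (p , _) (here refl) = p
  ⋂-lookup (_ , q) (there i)   = ⋂-lookup q i

  ⋂-tabulate : ∀ {Ks : List (DefinableSubgroup m)} {x} → (∀ {K} → K ∈ Ks → ⟨ K ⟩ x) → ⋂ Ks x
  ⋂-tabulate {Ks = []}     h = _
  ⋂-tabulate {Ks = K ∷ Ks} h = h (here refl) , ⋂-tabulate (h ∘ there)

  ⋂-anti : ∀ {Ks Ls : List (DefinableSubgroup m)} {x} → (∀ {K} → K ∈ Ls → K ∈ Ks) → ⋂ Ks x → ⋂ Ls x
  ⋂-anti sub p = ⋂-tabulate (⋂-lookup p ∘ sub)

  -- The permutation singles out an entry of the list rather than a subgroup, so a list with
  -- repetitions is never irredundant.
  Irredundant : List (DefinableSubgroup m) → Set (ℓ ⊔ lsuc c)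
  Irredundant Ks = ∀ {K rest} → Ks ↭ K ∷ rest → ¬ ⋂ rest ≲ ⟨ K ⟩

  -- Redundant entries are dropped one at a time, each at the cost of finitely many translates; `n`
  -- bounds the recursion. The map `f` allows the kept and discarded entries to be recorded before
  -- it is applied.
  irredundant-core : ∀ {a} {A : Set a} (f : A → DefinableSubgroup m) n (xs : List A) → length xs ≤ n →
    ∃[ ys ] ∃[ zs ] (xs ↭ ys ++ zs × Irredundant (List.map f ys) × ⋂ (List.map f ys) ≲ ⋂ (List.map f xs))
  irredundant-core f zero    []       _ = [] , [] , ↭-refl , (λ p → case ↭-length p of λ ()) , ⊆⇒≲ id
  irredundant-core f (suc n) xs l with em {P = Irredundant (List.map f xs)}
  ... | yes irr = xs , [] , subst (xs ↭_) (sym (Listₚ.++-identityʳ xs)) ↭-refl , irr , ⊆⇒≲ id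
  ... | no ¬irr = remove (¬¬-elim λ h → ¬irr λ p q → h (_ , _ , p , q))
    where
    remove : (∃[ K ] ∃[ rest ] (List.map f xs ↭ K ∷ rest × ⋂ rest ≲ ⟨ K ⟩)) →
             ∃[ ys ] ∃[ zs ] (xs ↭ ys ++ zs × Irredundant (List.map f ys) × ⋂ (List.map f ys) ≲ ⋂ (List.map f xs))
    remove (K , rest , p , small) with ↭-map-inv f p
    ... | y ∷ ys′ , refl , q =
      let (ys , zs , r , irr , ≲ys′) = irredundant-core f n ys′ (ℕₚ.≤-pred (subst (_≤ suc n) (↭-length q) l))
      in ys , y ∷ zs , ↭-trans q (↭-trans (prep y r) (↭-sym (shift y ys zs))) , irr ,
         ≲-trans ≲ys′ (≲-monoʳ (⋂-anti {Ks = List.map f (y ∷ ys′)} (∈-resp-↭ p))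
           (≲-∩ (sub (f y)) (sub (⋂ˢ (List.map f ys′))) small (⊆⇒≲ id)))

  Bound : ℕ → ℕ → Set (ℓ ⊔ lsuc c)
  Bound m b = ∀ (Ks : List (DefinableSubgroup m)) → Irredundant Ks → length Ks ≤ b

  -- Definable homomorphisms and irredundance in products.

  record DefinableHom (j k : ℕ) : Set (ℓ ⊔ c) where
    field
      _⟪_⟫     : Vec M j → Vec M k
      homo     : ∀ x y → _⟪_⟫ (x ∙ᵛ y) ≡ _⟪_⟫ x ∙ᵛ _⟪_⟫ y
      1-homo   : _⟪_⟫ 1ᵛ ≡ 1ᵛ
      ⁻¹-homo  : ∀ x → _⟪_⟫ (x ⁻¹ᵛ) ≡ _⟪_⟫ x ⁻¹ᵛ
      hom-def  : ∀ {Γ} {f : Env Γ → Vec M j} → DF f → DF (λ ρ → _⟪_⟫ (f ρ))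

    \\-homo : ∀ x y → _⟪_⟫ (x ⁻¹ᵛ ∙ᵛ y) ≡ (_⟪_⟫ x) ⁻¹ᵛ ∙ᵛ _⟪_⟫ y
    \\-homo x y = trans (homo _ y) (cong (_∙ᵛ _⟪_⟫ y) (⁻¹-homo x))
  open DefinableHom

  pullback : DefinableHom j k → DefinableSubgroup k → DefinableSubgroup j
  pullback h K = record
    { ⟨_⟩ = λ x → ⟨ K ⟩ (h ⟪ x ⟫)
    ; sub = record
      { ε∈  = subst ⟨ K ⟩ (sym (1-homo h)) (ε∈ (sub K))
      ; ∙∈  = λ p q → subst ⟨ K ⟩ (sym (homo h _ _)) (∙∈ (sub K) p q)
      ; ⁻¹∈ = λ p → subst ⟨ K ⟩ (sym (⁻¹-homo h _)) (⁻¹∈ (sub K) p)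
      }
    ; def = record
      { Member     = λ x → KD.Member (h ⟪ x ⟫)
      ; Member-def = KD.Member-at (hom-def h DF-head) (DF-tail DF-head)
      ; param      = KD.param
      ; spec       = λ x → KD.spec (h ⟪ x ⟫)
      }
    }
    where
    module KD = ParamDef (def K)

  1ᵛ-++ : ∀ k → 1ᵛ {k + m} ≡ 1ᵛ {k} Vec.++ 1ᵛ
  1ᵛ-++ zero    = refl
  1ᵛ-++ (suc k) = cong (unit ∷_) (1ᵛ-++ k)

  1≡1⁻¹ : 1ᵛ {m} ≡ 1ᵛ ⁻¹ᵛ
  1≡1⁻¹ = trans (sym (Gᵛ.inverseʳ 1ᵛ)) (Gᵛ.identityˡ _)

  takeʰ : ∀ k {m} → DefinableHom (k + m) k
  takeʰ k = record
    { _⟪_⟫ = Vec.take k ; homo = Vecₚ.take-zipWith _∙_ ; 1-homo = trans (cong (Vec.take k) (1ᵛ-++ k)) (take-++≡ (1ᵛ {k}) 1ᵛ)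
    ; ⁻¹-homo = Vecₚ.take-map _⁻¹ k ; hom-def = DF-take k }

  dropʰ : ∀ k {m} → DefinableHom (k + m) m
  dropʰ k = record
    { _⟪_⟫ = Vec.drop k ; homo = Vecₚ.drop-zipWith _∙_ ; 1-homo = trans (cong (Vec.drop k) (1ᵛ-++ k)) (drop-++≡ (1ᵛ {k}) 1ᵛ)
    ; ⁻¹-homo = Vecₚ.drop-map _⁻¹ k ; hom-def = DF-drop k }

  ++-homo : ∀ (x x′ : Vec M k) (y y′ : Vec M m) → (x Vec.++ y) ∙ᵛ (x′ Vec.++ y′) ≡ (x ∙ᵛ x′) Vec.++ (y ∙ᵛ y′)
  ++-homo x x′ y y′ = Vecₚ.zipWith-++ _∙_ x y x′ y′

  inlʰ : ∀ k {m} → DefinableHom k (k + m)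
  inlʰ k = record
    { _⟪_⟫ = Vec._++ 1ᵛ
    ; homo = λ x y → trans (cong ((x ∙ᵛ y) Vec.++_) (sym (Gᵛ.identityˡ 1ᵛ))) (sym (++-homo x y 1ᵛ 1ᵛ))
    ; 1-homo = sym (1ᵛ-++ k)
    ; ⁻¹-homo = λ x → trans (cong (x ⁻¹ᵛ Vec.++_) 1≡1⁻¹) (sym (Vecₚ.map-++ _⁻¹ x 1ᵛ))
    ; hom-def = λ d → DF-++ d DF-1 }

  inrʰ : ∀ k {m} → DefinableHom m (k + m)
  inrʰ k = record
    { _⟪_⟫ = 1ᵛ {k} Vec.++_
    ; homo = λ x y → trans (cong (Vec._++ (x ∙ᵛ y)) (sym (Gᵛ.identityˡ (1ᵛ {k})))) (sym (++-homo 1ᵛ 1ᵛ x y))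
    ; 1-homo = sym (1ᵛ-++ k)
    ; ⁻¹-homo = λ x → trans (cong (Vec._++ x ⁻¹ᵛ) 1≡1⁻¹) (sym (Vecₚ.map-++ _⁻¹ (1ᵛ {k}) x))
    ; hom-def = λ d → DF-++ DF-1 d }

  image-drop : ∀ k → DefinableSubgroup (k + m) → DefinableSubgroup m
  image-drop {m} k K = record
    { ⟨_⟩ = λ v → ∃[ u ] ⟨ K ⟩ (u Vec.++ v)
    ; sub = record
      { ε∈  = 1ᵛ , subst ⟨ K ⟩ (1ᵛ-++ k) (ε∈ (sub K))
      ; ∙∈  = λ (u , p) (u′ , q) → u ∙ᵛ u′ , subst ⟨ K ⟩ (++-homo u u′ _ _) (∙∈ (sub K) p q)
      ; ⁻¹∈ = λ (u , p) → u ⁻¹ᵛ , subst ⟨ K ⟩ (Vecₚ.map-++ _⁻¹ u _) (⁻¹∈ (sub K) p)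
      }
    ; def = record
      { Member     = λ v w → ∃[ u ] KD.Member (u Vec.++ v) w
      ; Member-def = Def-∃ {P = λ σ → KD.Member (All.head σ Vec.++ All.head (All.tail σ)) (All.head (All.tail (All.tail σ)))}
                       (KD.Member-at (DF-++ DF-head (DF-tail DF-head)) (DF-tail (DF-tail DF-head)))
      ; param      = KD.param
      ; spec       = λ v → mk⇔ (λ (u , p) → u , to (KD.spec _) p) (λ (u , p) → u , from (KD.spec _) p)
      }
    }
    where
    module KD = ParamDef (def K)

  -- Modular law: modulo T ∩ (Mᵏ × 1), which is commensurable to the
  -- intersection of all of Ks, the image in Mᵐ determines the elements of T.
  image-drop-≲ : ∀ k (T L K : DefinableSubgroup (k + m)) →
    (∀ {x} → ⟨ L ⟩ x → ⟨ T ⟩ x) → ⟨ pullback (inlʰ k) T ⟩ ≲ ⟨ pullback (inlʰ k) K ⟩ →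
    ⟨ image-drop k L ⟩ ≲ ⟨ image-drop k (T ∩ˢ K) ⟩ → ⟨ L ⟩ ≲ ⟨ K ⟩
  image-drop-≲ {m} k T L K L⊆T (ds , g) (cs , f) =
    cartesianProductWith (λ x d → x ∙ᵛ (d Vec.++ 1ᵛ)) xs ds , covers
    where
    P = image-drop k (T ∩ˢ K)
    reps = representatives {m} cs (λ d x → ⟨ L ⟩ x × ⟨ P ⟩ (d ⁻¹ᵛ ∙ᵛ Vec.drop k x))
    xs = proj₁ reps
    covers : ∀ {x} → ⟨ L ⟩ x → ∃[ b ] (b ∈ cartesianProductWith (λ x d → x ∙ᵛ (d Vec.++ 1ᵛ)) xs ds × ⟨ K ⟩ (b ⁻¹ᵛ ∙ᵛ x))
    covers {x} Lx =
      let (d , d∈ , p) = f {Vec.drop k x} (Vec.take k x , subst ⟨ L ⟩ (sym (Vecₚ.take++drop≡id k x)) Lx)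
          (y , y∈ , Ly , q) = proj₂ (proj₂ reps) {y = x} d∈ (Lx , p)
          (u , Tw , Kw) = coset-diff (sub P) q p
          -- The element `w` of T ∩ K has the same image in Mᵐ as y⁻¹x. Their quotient `z` therefore
          -- lies in T ∩ (Mᵏ × 1), which `g` covers by translates of `K`.
          w = u Vec.++ (Vec.drop k y ⁻¹ᵛ ∙ᵛ Vec.drop k x)
          z = (y ⁻¹ᵛ ∙ᵛ x) ∙ᵛ w ⁻¹ᵛ
          Tz = ∙∈ (sub T) (∙∈ (sub T) (⁻¹∈ (sub T) (L⊆T Ly)) (L⊆T Lx)) (⁻¹∈ (sub T) Tw)
          drop-z : Vec.drop k z ≡ 1ᵛ
          drop-z = trans (homo (dropʰ k) (y ⁻¹ᵛ ∙ᵛ x) (w ⁻¹ᵛ)) (trans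
                     (cong₂ _∙ᵛ_ (\\-homo (dropʰ k) y x) (trans (⁻¹-homo (dropʰ k) w) (cong _⁻¹ᵛ (drop-++≡ u _))))
                     (Gᵛ.inverseʳ _))
          z-eq : Vec.take k z Vec.++ 1ᵛ ≡ z
          z-eq = trans (cong (Vec.take k z Vec.++_) (sym drop-z)) (Vecₚ.take++drop≡id k z)
          (e , e∈ , r) = g {Vec.take k z} (subst ⟨ T ⟩ (sym z-eq) Tz)
          r′ : ⟨ K ⟩ ((e Vec.++ 1ᵛ) ⁻¹ᵛ ∙ᵛ z)
          r′ = subst ⟨ K ⟩ (trans (\\-homo (inlʰ k) e _) (cong ((e Vec.++ 1ᵛ) ⁻¹ᵛ ∙ᵛ_) z-eq)) r
          s : ((e Vec.++ 1ᵛ) ⁻¹ᵛ ∙ᵛ z) ∙ᵛ w ≡ (y ∙ᵛ (e Vec.++ 1ᵛ)) ⁻¹ᵛ ∙ᵛ x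
          s = trans (Gᵛ.assoc _ _ _) (trans (cong ((e Vec.++ 1ᵛ) ⁻¹ᵛ ∙ᵛ_)
                (trans (Gᵛ.assoc _ _ _) (trans (cong ((y ⁻¹ᵛ ∙ᵛ x) ∙ᵛ_) (Gᵛ.inverseˡ w)) (Gᵛ.identityʳ _))))
                (sym ([xy]⁻¹z y (e Vec.++ 1ᵛ) x)))
      in y ∙ᵛ (e Vec.++ 1ᵛ) , ∈-cartesianProductWith⁺ (λ x d → x ∙ᵛ (d Vec.++ 1ᵛ)) y∈ e∈ ,
         subst ⟨ K ⟩ s (∙∈ (sub K) r′ Kw)

  -- T is a minimal part of Ks whose intersection with Mᵏ × 1 is commensurable
  -- to that of Ks.
  bound-+ : ∀ {k m b b′} → Bound k b → Bound m b′ → Bound (k + m) (b + b′)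
  bound-+ {k} {m} {b} {b′} B B′ Ks irr
    with irredundant-core (pullback (inlʰ k)) (length Ks) Ks ℕₚ.≤-refl
  ... | T , S , Ks↭ , irrT , T≲ = subst (_≤ b + b′) (sym (trans (↭-length Ks↭) (Listₚ.length-++ T)))
          (ℕₚ.+-mono-≤ (subst (_≤ b) (Listₚ.length-map _ T) (B _ irrT)) (subst (_≤ b′) (Listₚ.length-map _ S) (B′ _ irrS)))
    where
    P : DefinableSubgroup (k + m) → DefinableSubgroup m
    P K = image-drop k (⋂ˢ T ∩ˢ K)
    irrS : Irredundant (List.map P S)
    irrS p rest≲ with ↭-map-inv P p
    ... | K ∷ S′ , refl , S↭ = irr Ks↭K (image-drop-≲ k (⋂ˢ T) (⋂ˢ (T ++ S′)) K
            (⋂-anti {Ks = T ++ S′} {Ls = T} ∈-++⁺ˡ)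
            (≲-monoˡ (pull T) (≲-monoʳ (λ q → ⋂-lookup {Ks = List.map (pullback (inlʰ k)) Ks} q (∈-map⁺ _ K∈Ks)) T≲))
            (≲-monoˡ (λ {v} (u , q) → ⋂-tabulate λ Q∈ → inImage u v q Q∈) rest≲))
      where
      Ks↭K : Ks ↭ K ∷ (T ++ S′)
      Ks↭K = ↭-trans Ks↭ (↭-trans (++⁺ˡ T S↭) (shift K T S′))
      K∈Ks : K ∈ Ks
      K∈Ks = ∈-resp-↭ (↭-sym Ks↭K) (here refl)
      pull : ∀ T {x} → ⟨ pullback (inlʰ k) (⋂ˢ T) ⟩ x → ⋂ (List.map (pullback (inlʰ k)) T) x
      pull []      _       = _
      pull (K ∷ T) (p , q) = p , pull T q
      inImage : ∀ u v → ⋂ (T ++ S′) (u Vec.++ v) → ∀ {Q} → Q ∈ List.map P S′ → ⟨ Q ⟩ v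
      inImage u v q Q∈ with ∈-map⁻ P Q∈
      ... | K′ , K′∈ , refl = u , ⋂-anti {Ks = T ++ S′} {Ls = T} ∈-++⁺ˡ q , ⋂-lookup {Ks = T ++ S′} q (∈-++⁺ʳ T K′∈)

  bound-0 : Bound 0 0
  bound-0 []         _   = z≤n
  bound-0 (K ∷ rest) irr = ⊥-elim (irr ↭-refl (⊆⇒≲ λ { {[]} _ → ε∈ (sub K) }))

  bound-* : ∀ {b} → Bound 1 b → ∀ m → Bound m (m * b)
  bound-* B zero    = bound-0
  bound-* B (suc m) = bound-+ B (bound-* B m)

  -- Since `s` is a section of `r`, applying `r` to the centres of the covering gives centres for
  -- the restriction along `s`.
  pullback-≲ : ∀ (r : DefinableHom j k) (s : DefinableHom k j) → (∀ x → r ⟪ s ⟪ x ⟫ ⟫ ≡ x) →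
               ∀ {U : Pred (Vec M j) c} K → U ≲ ⟨ pullback r K ⟩ → (λ x → U (s ⟪ x ⟫)) ≲ ⟨ K ⟩
  pullback-≲ r s rs K (cs , f) = List.map (r ⟪_⟫) cs , λ {x} Ux →
    let (d , d∈ , p) = f Ux
    in r ⟪ d ⟫ , ∈-map⁺ (r ⟪_⟫) d∈ , subst ⟨ K ⟩ (trans (\\-homo r d _) (cong ((r ⟪ d ⟫) ⁻¹ᵛ ∙ᵛ_) (rs x))) p

  -- If a member were redundant, restricting along the inclusion of its factor would make it
  -- redundant in its own family, because the subgroups from the other factor impose no condition
  -- there.
  Irredundant-++ : ∀ {k m} {Ks : List (DefinableSubgroup k)} {Ls : List (DefinableSubgroup m)} →
    Irredundant Ks → Irredundant Ls →
    Irredundant (List.map (pullback (takeʰ k)) Ks ++ List.map (pullback (dropʰ k)) Ls)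
  Irredundant-++ {k} {m} {Ks} {Ls} irr irr′ {Q} {rest} p rest≲ = cases (∈-++⁻ (List.map fst Ks) (∈-resp-↭ (↭-sym p) (here refl)))
    where
    fst = pullback (takeʰ k {m})
    snd = pullback (dropʰ k {m})
    split : ∀ {n} {Ks : List (DefinableSubgroup n)} {K} → K ∈ Ks → ∃[ Ks₀ ] Ks ↭ K ∷ Ks₀
    split K∈ with ∈-∃++ K∈
    ... | xs , ys , refl = xs ++ ys , shift _ xs ys
    cases : Q ∈ List.map fst Ks ⊎ Q ∈ List.map snd Ls → ⊥
    cases (inj₁ Q∈) with ∈-map⁻ fst Q∈
    ... | K , K∈ , refl with split K∈
    ... | Ks₀ , q = irr q (≲-monoˡ (λ {x} h → ⋂-tabulate λ R∈ → inRest x h (∈-++⁻ _ (∈-resp-↭ rest↭ R∈)))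
                             (pullback-≲ (takeʰ k) (inlʰ k) (λ x → take-++≡ x 1ᵛ) K rest≲))
      where
      rest↭ : rest ↭ List.map fst Ks₀ ++ List.map snd Ls
      rest↭ = drop-∷ (↭-trans (↭-sym p) (++⁺ʳ _ (map⁺ fst q)))
      inRest : ∀ x → ⋂ Ks₀ x → ∀ {R} → R ∈ List.map fst Ks₀ ⊎ R ∈ List.map snd Ls → ⟨ R ⟩ (x Vec.++ 1ᵛ)
      inRest x h (inj₁ R∈) with ∈-map⁻ fst R∈
      ... | K′ , K′∈ , refl = subst ⟨ K′ ⟩ (sym (take-++≡ x 1ᵛ)) (⋂-lookup {Ks = Ks₀} h K′∈)
      inRest x h (inj₂ R∈) with ∈-map⁻ snd R∈
      ... | K′ , K′∈ , refl = subst ⟨ K′ ⟩ (sym (drop-++≡ x 1ᵛ)) (ε∈ (sub K′))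
    cases (inj₂ Q∈) with ∈-map⁻ snd Q∈
    ... | K , K∈ , refl with split K∈
    ... | Ls₀ , q = irr′ q (≲-monoˡ (λ {x} h → ⋂-tabulate λ R∈ → inRest x h (∈-++⁻ _ (∈-resp-↭ rest↭ R∈)))
                              (pullback-≲ (dropʰ k) (inrʰ k) (λ x → drop-++≡ (1ᵛ {k}) x) K rest≲))
      where
      rest↭ : rest ↭ List.map fst Ks ++ List.map snd Ls₀
      rest↭ = drop-∷ (↭-trans (↭-sym p) (↭-trans (++⁺ˡ _ (map⁺ snd q)) (shift _ (List.map fst Ks) _)))
      inRest : ∀ x → ⋂ Ls₀ x → ∀ {R} → R ∈ List.map fst Ks ⊎ R ∈ List.map snd Ls₀ → ⟨ R ⟩ (1ᵛ {k} Vec.++ x)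
      inRest x h (inj₁ R∈) with ∈-map⁻ fst R∈
      ... | K′ , K′∈ , refl = subst ⟨ K′ ⟩ (sym (take-++≡ (1ᵛ {k}) x)) (ε∈ (sub K′))
      inRest x h (inj₂ R∈) with ∈-map⁻ snd R∈
      ... | K′ , K′∈ , refl = subst ⟨ K′ ⟩ (sym (drop-++≡ (1ᵛ {k}) x)) (⋂-lookup {Ks = Ls₀} h K′∈)

  Irredundant-[] : ∀ {m} → Irredundant {m} []
  Irredundant-[] p = case ↭-length p of λ ()

  Irredundant-* : ∀ {Ks : List (DefinableSubgroup 1)} → Irredundant Ks → ∀ m →
                  Σ[ Ls ∈ List (DefinableSubgroup m) ] Irredundant Ls × length Ls ≡ m * length Ks
  Irredundant-* irr zero = [] , Irredundant-[] , refl
  Irredundant-* {Ks} irr (suc m) =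
    let (Ls , irr′ , e) = Irredundant-* irr m
    in _ , Irredundant-++ irr irr′ ,
       trans (Listₚ.length-++ (List.map (pullback (takeʰ 1)) Ks))
             (cong₂ _+_ (Listₚ.length-map _ Ks) (trans (Listₚ.length-map _ Ls) e))

-- Counting with lists, and values of the shatter function.

length-cartesianProductWith : ∀ {a b d} {A : Set a} {B : Set b} {D : Set d} (f : A → B → D) xs ys →
                              length (cartesianProductWith f xs ys) ≡ length xs * length ys
length-cartesianProductWith f []       ys = refl
length-cartesianProductWith f (x ∷ xs) ys =
  trans (Listₚ.length-++ (List.map (f x) ys)) (cong₂ _+_ (Listₚ.length-map (f x) ys) (length-cartesianProductWith f xs ys))

lookup-injective : ∀ {a} {A : Set a} {xs : List A} → Unique xs → ∀ i j → List.lookup xs i ≡ List.lookup xs j → i ≡ j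
lookup-injective (_ ∷ _)  zero    zero    _ = refl
lookup-injective (x ∷ _)  zero    (suc j) e = ⊥-elim (All.lookup x (∈-lookup j) e)
lookup-injective (x ∷ _)  (suc i) zero    e = ⊥-elim (All.lookup x (∈-lookup i) (sym e))
lookup-injective (_ ∷ u)  (suc i) (suc j) e = cong suc (lookup-injective u i j e)

-- Positions in `zs` act as codes. A relation in place of a function avoids choosing the code, and
-- `zs` may contain repetitions.
pigeonhole : ∀ {a b r} {A : Set a} {B : Set b} {xs : List A} (zs : List B) (R : B → A → Set r) → Unique xs →
             (∀ {x} → x ∈ xs → ∃[ z ] (z ∈ zs × R z x)) → (∀ {z x x′} → R z x → R z x′ → x ≡ x′) →
             length xs ≤ length zs
pigeonhole {xs = xs} zs R u f inj = Finₚ.injective⇒≤ {f = code} λ {i} {j} e →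
  lookup-injective u i j (inj (related i) (subst (λ z → R z (List.lookup xs j)) (sym (same e)) (related j)))
  where
  z∈ : ∀ i → ∃[ z ] (z ∈ zs × R z (List.lookup xs i))
  z∈ i = f (∈-lookup i)
  code : Fin (length xs) → Fin (length zs)
  code i = Any.index (proj₁ (proj₂ (z∈ i)))
  related : ∀ i → R (proj₁ (z∈ i)) (List.lookup xs i)
  related i = proj₂ (proj₂ (z∈ i))
  same : ∀ {i j} → code i ≡ code j → proj₁ (z∈ i) ≡ proj₁ (z∈ j)
  same {i} {j} e = trans (Anyₚ.lookup-index (proj₁ (proj₂ (z∈ i))))
    (trans (cong (List.lookup zs) e) (sym (Anyₚ.lookup-index (proj₁ (proj₂ (z∈ j))))))

subsets : ∀ n → List (Subset n)
subsets zero    = [] ∷ []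
subsets (suc n) = List.map (inside ∷_) (subsets n) ++ List.map (outside ∷_) (subsets n)

∈-subsets : ∀ {n} (T : Subset n) → T ∈ subsets n
∈-subsets []            = here refl
∈-subsets (true  ∷ T) = ∈-++⁺ˡ (∈-map⁺ _ (∈-subsets T))
∈-subsets (false ∷ T) = ∈-++⁺ʳ _ (∈-map⁺ _ (∈-subsets T))

subset-ext : ∀ {n} {S T : Subset n} → (∀ j → (j ∈ₛ S) ⇔ (j ∈ₛ T)) → S ≡ T
subset-ext h = Subsetₚ.⊆-antisym (λ {j} → to (h j)) (λ {j} → from (h j))

module Counting (em : ∀ {a} → ExcludedMiddle a) where

  subset-of : ∀ {p n} (P : Fin n → Set p) → Σ[ T ∈ Subset n ] ∀ j → (j ∈ₛ T) ⇔ P j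
  subset-of P = Vec.tabulate χ , λ j → mk⇔
    (λ j∈ → χ⇒ j (trans (sym (Vecₚ.lookup∘tabulate χ j)) (Vecₚ.[]=⇒lookup j∈)))
    (λ p → Vecₚ.lookup⇒[]= j _ (trans (Vecₚ.lookup∘tabulate χ j) (⇒χ j p)))
    where
    χ : Fin _ → Bool
    χ j = case em {P = P j} of λ { (yes _) → true ; (no _) → false }
    χ⇒ : ∀ j → χ j ≡ true → P j
    χ⇒ j e with em {P = P j} | e
    ... | yes p | _ = p
    ... | no _  | ()
    ⇒χ : ∀ j → P j → χ j ≡ true
    ⇒χ j p with em {P = P j}
    ... | yes _ = refl
    ... | no ¬p = ⊥-elim (¬p p)

  enumerate : ∀ {a p} {A : Set a} (P : Pred A p) (xs : List A) →
              Σ[ ys ∈ List A ] Unique ys × (∀ x → (P x × x ∈ xs) ⇔ (x ∈ ys))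
  enumerate P [] = [] , [] , λ x → mk⇔ (λ ()) (λ ())
  enumerate P (x ∷ xs) with enumerate P xs
  ... | ys , u , h with em {P = P x × ¬ x ∈ ys}
  ... | yes (p , x∉) = x ∷ ys , Allₚ.¬Any⇒All¬ ys x∉ ∷ u , λ y → mk⇔
    (λ { (_ , here refl) → here refl ; (q , there y∈) → there (to (h y) (q , y∈)) })
    (λ { (here refl) → p , here refl ; (there y∈) → let (q , i) = from (h y) y∈ in q , there i })
  ... | no ¬new = ys , u , λ y → mk⇔
    (λ { (q , there y∈) → to (h y) (q , y∈)
       ; (q , here refl) → case em {P = y ∈ ys} of λ { (yes i) → i ; (no y∉) → ⊥-elim (¬new (q , y∉)) } })
    (λ y∈ → let (q , i) = from (h y) y∈ in q , there i)

  hasCardinality : ∀ {p n} (P : Pred (Subset n) p) → ∃[ k ] HasCardinality P k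
  hasCardinality {n = n} P =
    let (ys , u , h) = enumerate P (subsets n)
    in length ys , ys , u , (λ T → mk⇔ (λ p → to (h T) (p , ∈-subsets T)) (λ T∈ → proj₁ (from (h T) T∈))) , refl

  cardinality≤ : ∀ {p n k} {P : Pred (Subset n) p} → HasCardinality P k → k ≤ length (subsets n)
  cardinality≤ {n = n} (ys , u , h , refl) =
    pigeonhole (subsets n) _≡_ u (λ {T} _ → T , ∈-subsets T , refl) (λ { refl refl → refl })

  maximum : ∀ {p} {P : ℕ → Set p} B → (∀ n → P n → n ≤ B) → ∀ {k} → P k → ∃[ n ] (P n × (∀ k → P k → k ≤ n))
  maximum {P = P} zero    bound {k} p = k , p , λ n q → ℕₚ.≤-trans (bound n q) z≤n
  maximum {P = P} (suc B) bound p with em {P = P (suc B)}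
  ... | yes q = suc B , q , bound
  ... | no ¬q = maximum B (λ n r → ℕₚ.≤-pred (ℕₚ.≤∧≢⇒< (bound n r) λ { refl → ¬q r })) p

  -- The numbers of traces on `n` points are bounded by the number of subsets, and `a` shows that
  -- there is at least one such number, so a maximum exists.
  shatterValue : ∀ {i b p} {X : Set i} {B : Set b} (𝒮 : B → Pred X p) {n} (a : Fin n ↣ X) →
                 ∃[ k ] IsShatterValue 𝒮 n k × (∀ k′ → HasCardinality (Trace 𝒮 a) k′ → k′ ≤ k)
  shatterValue 𝒮 {n} a =
    let (k₀ , h) = hasCardinality (Trace 𝒮 a)
        (k , (a′ , h′) , max) = maximum {P = λ k → Σ[ a ∈ _ ] HasCardinality (Trace 𝒮 a) k}
                                  (length (subsets n)) (λ _ (_ , h) → cardinality≤ h) (a , h)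
    in k , ((a′ , h′) , λ a″ k′ h″ → max k′ (a″ , h″)) , λ k′ h″ → max k′ (a , h″)

-- Upper bound for the shatter function.

module UpperBound (em : ∀ {a} → ExcludedMiddle a) {ℓ c} (G : ExpandedGroup ℓ c) where

  open ExpandedGroup G using (language)
  open OneBasedGroups em G
  open Definability em 𝕄
  open Families em 𝕄
  open Irredundance em G
  open AclCoset
  open Sub

  module _ {k m : ℕ} where

    -- For each object a, the parameters y with (a, y) in the coset form the empty set or a left
    -- coset of this subgroup, which does not depend on a.
    fibre : AclCoset (k + m) → DefinableSubgroup m
    fibre C = pullback (inrʰ k) (record
      { ⟨_⟩ = H C ; sub = H-sub C
      ; def = record { Member = F.Member ; Member-def = F.Member-def ; param = F.e ; spec = F.isMember } })
      where
      module F = FiniteFamily (H-family C)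

    module _ (C : AclCoset (k + m)) (a : Vec M k) where

      fibre-eq : ∀ (y z : Vec M m) → (a Vec.++ y) ⁻¹ᵛ ∙ᵛ (a Vec.++ z) ≡ 1ᵛ {k} Vec.++ (y ⁻¹ᵛ ∙ᵛ z)
      fibre-eq y z = trans (cong (_∙ᵛ (a Vec.++ z)) (Vecₚ.map-++ _ a y)) (trans (++-homo (a ⁻¹ᵛ) a (y ⁻¹ᵛ) z)
                       (cong (Vec._++ (y ⁻¹ᵛ ∙ᵛ z)) (Gᵛ.inverseˡ a)))

      fibre-closed : ∀ {y z} → ⟨ fibre C ⟩ (y ⁻¹ᵛ ∙ᵛ z) → set C (a Vec.++ y) → set C (a Vec.++ z)
      fibre-closed {y} {z} p q = from (set-coset C _)
        (coset-trans (H-sub C) (to (set-coset C _) q) (subst (H C) (sym (fibre-eq y z)) p))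

      fibre-⇔ : ∀ {y z} → ⟨ fibre C ⟩ (y ⁻¹ᵛ ∙ᵛ z) → set C (a Vec.++ y) ⇔ set C (a Vec.++ z)
      fibre-⇔ p = mk⇔ (fibre-closed p) (fibre-closed (coset-sym (sub (fibre C)) p))

      fibre-coset : ∀ {y z} → set C (a Vec.++ y) → set C (a Vec.++ z) → ⟨ fibre C ⟩ (y ⁻¹ᵛ ∙ᵛ z)
      fibre-coset {y} {z} p q = subst (H C) (fibre-eq y z)
        (coset-diff (H-sub C) (to (set-coset C _) p) (to (set-coset C _) q))

    module _ {n : ℕ} (a : Fin n → Vec M k) where

      Met : AclCoset (k + m) → Vec M m → Set c
      Met C y = ∃[ j ] set C (a j Vec.++ y)

      Agree : List (AclCoset (k + m)) → Vec M m → Vec M m → Set (ℓ ⊔ lsuc c)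
      Agree Cs z y = ∀ {C} → C ∈ Cs → ∀ j → set C (a j Vec.++ z) ⇔ set C (a j Vec.++ y)

      -- Choosing a point `a j` for each coset in `I` leaves at most n^|I| intersections, each of
      -- them empty or a coset of the intersection of the fibres; one representative of each
      -- suffices.
      cosets-cover : ∀ (I : List (AclCoset (k + m))) → Σ[ zs ∈ List (Vec M m) ] length zs ≤ n ^ length I ×
        (∀ y → (∀ {C} → C ∈ I → Met C y) → ∃[ z ] (z ∈ zs × ⋂ (List.map fibre I) (z ⁻¹ᵛ ∙ᵛ y)))
      cosets-cover []      = 1ᵛ ∷ [] , ℕₚ.≤-refl , λ y _ → 1ᵛ , here refl , _
      cosets-cover (C ∷ I) =
        let (zs , l , h) = cosets-cover I
            P : Vec M m × Fin n → Vec M m → Set c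
            P = λ (z , j) y → ⋂ (List.map fibre I) (z ⁻¹ᵛ ∙ᵛ y) × set C (a j Vec.++ y)
            (ys , l′ , r) = representatives {m} (cartesianProduct zs (List.allFin n)) P
        in ys
         , ℕₚ.≤-trans l′ (subst (_≤ n * n ^ length I) (sym (length-cartesianProductWith _,_ zs (List.allFin n)))
             (subst₂ _≤_ (ℕₚ.*-comm (length (List.allFin n)) (length zs)) refl
               (ℕₚ.*-mono-≤ (ℕₚ.≤-reflexive (Listₚ.length-tabulate {n = n} id)) l)))
         , λ y met → let (z , z∈ , p) = h y (met ∘ there) ; (j , q) = met (here refl)
                         (x , x∈ , p′ , q′) = r {y = y} (∈-cartesianProduct⁺ z∈ (∈-allFin j)) (p , q)
                     in x , x∈ , fibre-coset C (a j) q′ q , coset-diff (sub (⋂ˢ (List.map fibre I))) p′ p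

    -- The points y meeting every coset in D fall into O(n^b) cosets of the
    -- intersection of the fibres of D, as b of these fibres already have a
    -- commensurable intersection.
    module _ {b : ℕ} (bound : Bound m b) where

      cells : ∀ (E D : List (AclCoset (k + m))) → ∃[ C₀ ] ∀ n .{{_ : NonZero n}} (a : Fin n → Vec M k) →
        Σ[ zs ∈ List (Vec M m) ] length zs ≤ C₀ * n ^ b ×
        (∀ y → (∀ {C} → C ∈ D → Met a C y) → ∃[ z ] (z ∈ zs × Agree a D z y × Agree a E z y))
      cells [] D =
        let (I , _ , D↭ , irr , (ds , f)) = irredundant-core fibre (length D) D ℕₚ.≤-refl
            I⊆D = λ {C} (C∈ : C ∈ I) → ∈-resp-↭ (↭-sym D↭) (∈-++⁺ˡ C∈)
            I≤b = subst (_≤ b) (Listₚ.length-map fibre I) (bound (List.map fibre I) irr)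
        in length ds , λ n a →
          let (zs , l , h) = cosets-cover a I
          in cartesianProductWith _∙ᵛ_ zs ds
           , subst₂ _≤_ (sym (length-cartesianProductWith _∙ᵛ_ zs ds)) (ℕₚ.*-comm (n ^ b) (length ds))
               (ℕₚ.*-monoˡ-≤ (length ds) (ℕₚ.≤-trans l (ℕₚ.^-monoʳ-≤ n I≤b)))
           , λ y met →
               let (z , z∈ , p) = h y (λ C∈ → met (I⊆D C∈)) ; (d , d∈ , q) = f p
               in z ∙ᵛ d , ∈-cartesianProductWith⁺ _∙ᵛ_ z∈ d∈
                , (λ {C} C∈ j → fibre-⇔ C (a j) (⋂-lookup {Ks = List.map fibre D}
                    (subst (⋂ (List.map fibre D)) (sym ([xy]⁻¹z z d y)) q) (∈-map⁺ fibre C∈)))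
                , λ ()
      -- Parameters that meet `C` are treated with `C` moved to `D`. Those that miss `C` agree on it
      -- trivially, but the cells found for `E` and `D` need new representatives that miss `C` too.
      cells (C ∷ E) D =
        let (C₁ , h₁) = cells E (C ∷ D)
            (C₂ , h₂) = cells E D
        in C₁ + C₂ , λ n a →
          let (zs₁ , l₁ , f₁) = h₁ n a
              (zs₂ , l₂ , f₂) = h₂ n a
              (ys , l , r) = representatives {m} zs₂ (λ z y → (Agree a D z y × Agree a E z y) × ¬ Met a C y)
          in zs₁ ++ ys
           , subst₂ _≤_ (sym (Listₚ.length-++ zs₁)) (sym (ℕₚ.*-distribʳ-+ (n ^ b) C₁ C₂))
               (ℕₚ.+-mono-≤ l₁ (ℕₚ.≤-trans l l₂))
           , λ y met → case em {P = Met a C y} of λ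
             { (yes q) → let (z , z∈ , p , p′) = f₁ y (λ { (here refl) → q ; (there C∈) → met C∈ })
                         in z , ∈-++⁺ˡ z∈ , p ∘ there , λ { (here refl) → p (here refl) ; (there C∈) → p′ C∈ }
             ; (no ¬q) → let (z , z∈ , p) = f₂ y met
                             (x , x∈ , (p₁ , p₂) , ¬q′) = r {y = y} z∈ (p , ¬q)
                         in x , ∈-++⁺ʳ zs₁ x∈
                          , (λ C∈ j → ⇔.trans (⇔.sym (p₁ C∈ j)) (proj₁ p C∈ j))
                          , λ { (here refl) j → mk⇔ (λ s → ⊥-elim (¬q′ (j , s))) (λ s → ⊥-elim (¬q (j , s)))
                              ; (there C∈) j → ⇔.trans (⇔.sym (p₂ C∈ j)) (proj₂ p C∈ j) } }

      -- Parameters in the same cell lie in the same cosets together with each object, hence cut out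
      -- the same trace.
      shatter-upper : OneBased G → (φ : Formula language (k + m)) →
        ∃[ C₀ ] ∀ n .{{_ : NonZero n}} v → IsShatterValue (instanceOf 𝕄 {k} {m} φ) n v → v ≤ C₀ * n ^ b
      shatter-upper oneBased φ =
        let (Cs , det) = determined (oneBased (k + m) 0 (proj₁ φ₀) [])
            (C₀ , h) = cells Cs []
        in C₀ , λ { n _ ((a , xs , u , traces , refl) , _) →
          let (zs , l , f) = h n (Injection.to a)
          in ℕₚ.≤-trans (pigeonhole zs (λ z T → ∀ j → (j ∈ₛ T) ⇔ 𝕄 ⊨ φ [ Injection.to a j Vec.++ z ]) u
              (λ {T} T∈ → let (y , t) = from (traces T) T∈ ; (z , z∈ , _ , agree) = f y (λ ())
                      in z , z∈ , λ j → ⇔.trans (t j) (⇔.trans (⇔.sym (proj₂ φ₀ _ []))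
                           (⇔.trans (⇔.sym (det (All.tabulate λ C∈ → agree C∈ j))) (proj₂ φ₀ _ []))))
              (λ p q → subset-ext λ j → ⇔.trans (p j) (⇔.sym (q j)))) l }
        where
        -- One-basedness is applied in the power k + m: all variables of `φ` count as object
        -- variables and the parameter tuple is empty.
        φ₀ : Σ[ φ₀ ∈ Formula language ((k + m) + 0) ] ∀ x y → 𝕄 ⊨ φ₀ [ x Vec.++ y ] ⇔ 𝕄 ⊨ φ [ x ]
        φ₀ = toFormula {P = λ ρ → 𝕄 ⊨ φ [ All.head ρ ]} (Def-⊨ φ DF-head)

-- Finite choice functions and comparison of exponents.

lookup-↭ : ∀ {a} {A : Set a} (xs : List A) i →
           ∃[ rest ] (xs ↭ List.lookup xs i ∷ rest × (∀ j → j ≢ i → List.lookup xs j ∈ rest))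
lookup-↭ (x ∷ xs) zero    = xs , ↭-refl , λ { zero 0≢0 → ⊥-elim (0≢0 refl) ; (suc j) _ → ∈-lookup j }
lookup-↭ (x ∷ xs) (suc i) =
  let (rest , p , h) = lookup-↭ xs i
  in x ∷ rest , ↭-trans (prep x p) (swap x _ ↭-refl) , λ
     { zero _ → here refl ; (suc j) j≢i → there (h j λ { refl → j≢i refl }) }

funToFin-cong : ∀ {m n} {f g : Fin m → Fin n} → (∀ i → f i ≡ g i) → funToFin f ≡ funToFin g
funToFin-cong {zero}  h = refl
funToFin-cong {suc m} h = cong₂ combine (h zero) (funToFin-cong (h ∘ suc))

finToFun-injective : ∀ {m n} {x y : Fin (n ^ m)} → (∀ i → finToFun {n} {m} x i ≡ finToFun y i) → x ≡ y
finToFun-injective {m} {n} {x} {y} h = trans (sym (Finₚ.funToFin-finToFin {m} {n} x))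
  (trans (funToFin-cong h) (Finₚ.funToFin-finToFin {m} {n} y))

other : ∀ {n} → 2 ≤ n → (i : Fin n) → ∃[ j ] i ≢ j
other (s≤s (s≤s _)) zero    = suc zero , λ ()
other (s≤s (s≤s _)) (suc _) = zero , λ ()

-- If u < e, cancelling t^u would leave t ≤ C s^u for all large t.
exponent-≤ : ∀ s e u C T → (∀ t → T ≤ t → t ^ e ≤ C * (s * t) ^ u) → e ≤ u
exponent-≤ s e u C T h = ℕₚ.≮⇒≥ λ u<e → ℕₚ.<⇒≱ C*s^u<t (ℕₚ.*-cancelʳ-≤ t (C * s ^ u) (t ^ u) {{ℕₚ.m^n≢0 t u}} (begin
    t * t ^ u           ≤⟨ ℕₚ.^-monoʳ-≤ t u<e ⟩
    t ^ e               ≤⟨ h t (ℕₚ.m≤n⇒m≤1+n (ℕₚ.m≤m+n T _)) ⟩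
    C * (s * t) ^ u     ≡⟨ cong (C *_) (^-distrib-* u) ⟩
    C * (s ^ u * t ^ u) ≡⟨ ℕₚ.*-assoc C (s ^ u) (t ^ u) ⟨
    C * s ^ u * t ^ u   ∎))
  where
  open ℕₚ.≤-Reasoning
  -- Positive, at least `T`, and larger than the bound C s^u.
  t = suc (T + C * s ^ u)
  C*s^u<t : C * s ^ u < t
  C*s^u<t = s≤s (ℕₚ.m≤n+m (C * s ^ u) T)
  ^-distrib-* : ∀ u → (s * t) ^ u ≡ s ^ u * t ^ u
  ^-distrib-* zero    = refl
  ^-distrib-* (suc u) = trans (cong (s * t *_) (^-distrib-* u)) (ℕₚ.[m*n]*[o*p]≡[m*o]*[n*p] s t (s ^ u) (t ^ u))

-- Lower bound for the shatter function.

module LowerBound (em : ∀ {a} → ExcludedMiddle a) {ℓ c} (G : ExpandedGroup ℓ c) where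

  open ExpandedGroup G using (language)
  open OneBasedGroups em G
  open Definability em 𝕄
  open Families em 𝕄
  open Irredundance em G
  open Counting em
  open Sub

  prod : ∀ {m s} → (Fin s → Vec M m) → Vec M m
  prod {s = zero}  f = 1ᵛ
  prod {s = suc s} f = f zero ∙ᵛ prod (f ∘ suc)

  prod∈ : ∀ {m s} {K : Pred (Vec M m) c} → Sub K → (f : Fin s → Vec M m) → (∀ i → K (f i)) → K (prod f)
  prod∈ {s = zero}  S f h = ε∈ S
  prod∈ {s = suc s} S f h = ∙∈ S (h zero) (prod∈ S (f ∘ suc) (h ∘ suc))

  -- The factors before position `i` make up the left element of `K`, those after it the right one.
  prod-DoubleCoset : ∀ {m s} {K : Pred (Vec M m) c} → Sub K → (f : Fin s → Vec M m) → ∀ i →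
                     (∀ j → j ≢ i → K (f j)) → DoubleCoset K (f i) (prod f)
  prod-DoubleCoset S f zero    h = 1ᵛ , prod (f ∘ suc) , ε∈ S , prod∈ S (f ∘ suc) (λ j → h (suc j) λ ()) , sym (Gᵛ.identityˡ _)
  prod-DoubleCoset S f (suc i) h =
    let (k , l , Kk , Kl , e) = prod-DoubleCoset S (f ∘ suc) i (λ j j≢i → h (suc j) λ { refl → j≢i refl })
    in f zero ∙ᵛ k , l , ∙∈ S (h zero λ ()) Kk , Kl , trans (cong (f zero ∙ᵛ_) e) (sym (Gᵛ.assoc _ _ _))

  -- One formula whose instances include all double cosets KaK ≠ K with
  -- K ∈ Ks: the components of an object belonging to the subgroups other
  -- than K are filled with 1.
  record DoubleCosetFormula {m} (Ks : List (DefinableSubgroup m)) : Set (ℓ ⊔ lsuc c) where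
    field
      {len}  : ℕ
      ψ      : Formula language (len + m)
      blank  : Σ[ o ∈ Vec M len ] (∀ (y : Vec M m) → ¬ 𝕄 ⊨ ψ [ o Vec.++ y ])
      object : ∀ {K} → K ∈ Ks → ∀ a → ¬ ⟨ K ⟩ a → Σ[ o ∈ Vec M len ] (∀ (y : Vec M m) → 𝕄 ⊨ ψ [ o Vec.++ y ] ⇔ DoubleCoset ⟨ K ⟩ a y)

  doubleCosetFormula : ∀ {m} (Ks : List (DefinableSubgroup m)) → DoubleCosetFormula Ks
  doubleCosetFormula []       = record { len = 0 ; ψ = false ; blank = [] , λ { _ () } ; object = λ () }
  doubleCosetFormula {m} (K ∷ Ks) = record
    { ψ      = proj₁ χ
    ; blank  = 1ᵛ {m} Vec.++ (KD.param Vec.++ proj₁ R.blank) , λ y q → case to (χ-spec _ _ _ y) q of λ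
        { (inj₁ (¬1 , _)) → ¬1 (to (KD.spec _) (ε∈ (sub K))) ; (inj₂ r) → proj₂ R.blank y r }
    ; object = λ
        { (here refl) a a∉K → a Vec.++ (KD.param Vec.++ proj₁ R.blank) , λ y → ⇔.trans (χ-spec _ _ _ y) (mk⇔
            (λ { (inj₁ (_ , k , l , p , q , e)) → k , l , from (KD.spec _) p , from (KD.spec _) q , e
               ; (inj₂ r) → ⊥-elim (proj₂ R.blank y r) })
            (λ { (k , l , p , q , e) → inj₁ (a∉K ∘ from (KD.spec _) , k , l , to (KD.spec _) p , to (KD.spec _) q , e) }))
        ; (there K∈) a a∉K → let (o , h) = R.object K∈ a a∉K in
            1ᵛ {m} Vec.++ (KD.param Vec.++ o) , λ y → ⇔.trans (χ-spec _ _ _ y) (mk⇔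
            (λ { (inj₁ (¬1 , _)) → ⊥-elim (¬1 (to (KD.spec _) (ε∈ (sub K)))) ; (inj₂ r) → to (h y) r })
            (λ r → inj₂ (from (h y) r))) }
    }
    where
    module KD = ParamDef (def K)
    module R = DoubleCosetFormula (doubleCosetFormula Ks)
    p = KD.arityₚ
    -- The negated conjunct turns the unit into a switch: 1 lies in `K`, so a row with d = 1 holds
    -- for no `y`. It costs only the trivial double coset `K` itself.
    Row : Vec M m → Vec M p → Vec M m → Set c
    Row d v y = ¬ KD.Member d v × ∃[ k ] ∃[ l ] (KD.Member k v × KD.Member l v × y ≡ k ∙ᵛ (d ∙ᵛ l))
    Row-def : ∀ {Γ} {d : Env Γ → Vec M m} {v : Env Γ → Vec M p} {y : Env Γ → Vec M m} → DF d → DF v → DF y →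
              Def (λ ρ → Row (d ρ) (v ρ) (y ρ))
    Row-def {d = d} {v} {y} dd dv dy = Def-× (Def-¬ (KD.Member-at dd dv))
      (Def-∃ {P = λ σ → ∃[ l ] (KD.Member (All.head σ) (v (All.tail σ)) × KD.Member l (v (All.tail σ)) ×
                                y (All.tail σ) ≡ All.head σ ∙ᵛ (d (All.tail σ) ∙ᵛ l))}
      (Def-∃ {P = λ τ → KD.Member (All.head (All.tail τ)) (v (All.tail (All.tail τ))) × KD.Member (All.head τ) (v (All.tail (All.tail τ))) ×
                        y (All.tail (All.tail τ)) ≡ All.head (All.tail τ) ∙ᵛ (d (All.tail (All.tail τ)) ∙ᵛ All.head τ)}
        (Def-× (KD.Member-at (DF-tail DF-head) (DF-tail (DF-tail dv)))
        (Def-× (KD.Member-at DF-head (DF-tail (DF-tail dv)))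
               (Def-sub₁ {P = λ υ → All.head υ ≡ All.head (All.tail (All.tail υ)) ∙ᵛ (d (All.tail (All.tail (All.tail υ))) ∙ᵛ All.head (All.tail υ))}
                 (DF.graph (DF-∙ (DF-tail DF-head) (DF-∙ (DF-tail (DF-tail dd)) DF-head)))
                 (DF-tail (DF-tail dy)))))))
    χ : Σ[ χ ∈ Formula language ((m + (p + R.len)) + m) ] ∀ o y → 𝕄 ⊨ χ [ o Vec.++ y ] ⇔
          (Row (Vec.take m o) (Vec.take p (Vec.drop m o)) y ⊎ 𝕄 ⊨ R.ψ [ Vec.drop p (Vec.drop m o) Vec.++ y ])
    χ = toFormula {P = λ ρ → Row (Vec.take m (All.head ρ)) (Vec.take p (Vec.drop m (All.head ρ))) (All.head (All.tail ρ))
                           ⊎ 𝕄 ⊨ R.ψ [ Vec.drop p (Vec.drop m (All.head ρ)) Vec.++ All.head (All.tail ρ) ]}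
          (Def-⊎ (Row-def (DF-take m DF-head) (DF-take p (DF-drop m DF-head)) (DF-tail DF-head))
                 (Def-⊨ R.ψ (DF-++ (DF-drop p (DF-drop m DF-head)) (DF-tail DF-head))))
    χ-spec : ∀ d v o y → 𝕄 ⊨ proj₁ χ [ (d Vec.++ (v Vec.++ o)) Vec.++ y ] ⇔ (Row d v y ⊎ 𝕄 ⊨ R.ψ [ o Vec.++ y ])
    χ-spec d v o y = ⇔.trans (proj₂ χ (d Vec.++ (v Vec.++ o)) y)
      (≡⇒⇔ (cong₂ _⊎_
        (cong₂ (λ d v → Row d v y) (take-++≡ d _) (trans (cong (Vec.take p) (drop-++≡ d _)) (take-++≡ v o)))
        (cong (λ o → 𝕄 ⊨ R.ψ [ o Vec.++ y ]) (trans (cong (Vec.drop p) (drop-++≡ d _)) (drop-++≡ v o)))))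

  -- The source of t^s traces on s t points: any choice of one entry in each of the `s` rows is
  -- picked out by a single parameter.
  record Grid {m len} (ψ : Formula language (len + m)) (s t : ℕ) : Set c where
    field
      o    : Fin s → Fin t → Vec M len
      y    : (Fin s → Fin t) → Vec M m
      spec : ∀ i j η → 𝕄 ⊨ ψ [ o i j Vec.++ y η ] ⇔ (j ≡ η i)

  -- The trace of `y η` determines `η`, so different choices have different traces. Having two
  -- columns makes objects from different rows distinct.
  Grid-shatter : ∀ {m len} {ψ : Formula language (len + m)} {s t} → 2 ≤ t → Grid ψ s t →
                 ∃[ v ] (IsShatterValue (instanceOf 𝕄 {len} {m} ψ) (s * t) v × t ^ s ≤ v)
  Grid-shatter {m} {len} {ψ} {s} {t} 2≤t g =
    let (v , isValue , max) = shatterValue (instanceOf 𝕄 {len} {m} ψ) points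
        (k , card) = hasCardinality (Trace (instanceOf 𝕄 {len} {m} ψ) points)
    in v , isValue , ℕₚ.≤-trans (many card) (max k card)
    where
    open Grid g
    o-injective : ∀ i j i′ j′ → o i j ≡ o i′ j′ → i ≡ i′ × j ≡ j′
    o-injective i j i′ j′ e with i ≟ i′
    ... | yes refl = refl , sym (transfer (λ _ → j) refl)
      where
      transfer : ∀ η → j ≡ η i → j′ ≡ η i
      transfer η q = to (spec i j′ η) (subst (λ z → 𝕄 ⊨ ψ [ z Vec.++ y η ]) e (from (spec i j η) q))
    ... | no i≢i′ = ⊥-elim (proj₂ (other 2≤t j′) (trans transfer (at-other i′ (i≢i′ ∘ sym))))
      where
      -- A choice that selects `o i j` and avoids `o i′ j′`.
      η : Fin s → Fin t
      η l = case l ≟ i of λ { (yes _) → j ; (no _) → proj₁ (other 2≤t j′) }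
      at-i : j ≡ η i
      at-i with i ≟ i
      ... | yes _ = refl
      ... | no i≢i = ⊥-elim (i≢i refl)
      at-other : ∀ l → l ≢ i → η l ≡ proj₁ (other 2≤t j′)
      at-other l l≢i with l ≟ i
      ... | yes q = ⊥-elim (l≢i q)
      ... | no _  = refl
      transfer : j′ ≡ η i′
      transfer = to (spec i′ j′ η) (subst (λ z → 𝕄 ⊨ ψ [ z Vec.++ y η ]) e (from (spec i j η) at-i))
    point : Fin (s * t) → Vec M len
    point p = o (proj₁ (remQuot {s} t p)) (proj₂ (remQuot {s} t p))
    points : Fin (s * t) ↣ Vec M len
    points = mk↣ {to = point} λ {p} {q} e →
      let (e₁ , e₂) = o-injective _ _ _ _ e
      in trans (sym (Finₚ.combine-remQuot {s} t p)) (trans (cong₂ combine e₁ e₂) (Finₚ.combine-remQuot {s} t q))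
    traceOf : ∀ η → Σ[ T ∈ _ ] ∀ p → (p ∈ₛ T) ⇔ 𝕄 ⊨ ψ [ point p Vec.++ y η ]
    traceOf η = subset-of λ p → 𝕄 ⊨ ψ [ point p Vec.++ y η ]
    traceOf-injective : ∀ {η θ} → proj₁ (traceOf η) ≡ proj₁ (traceOf θ) → ∀ i → η i ≡ θ i
    traceOf-injective {η} {θ} e i =
      let p = combine i (η i)
          rq = Finₚ.remQuot-combine i (η i)
          η-holds = from (spec (proj₁ (remQuot {s} t p)) (proj₂ (remQuot {s} t p)) η)
                      (trans (cong proj₂ rq) (cong η (sym (cong proj₁ rq))))
          θ-holds = to (proj₂ (traceOf θ) p) (subst (p ∈ₛ_) e (from (proj₂ (traceOf η) p) η-holds))
      in trans (sym (cong proj₂ rq)) (trans (to (spec _ _ θ) θ-holds) (cong θ (cong proj₁ rq)))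
    many : ∀ {k} → HasCardinality (Trace (instanceOf 𝕄 {len} {m} ψ) points) k → t ^ s ≤ k
    many (xs , u , traces , refl) = subst (_≤ length xs) (Listₚ.length-tabulate {n = t ^ s} id)
      (pigeonhole xs (λ T x → T ≡ proj₁ (traceOf (finToFun {t} {s} x))) (Uniqueₚ.allFin⁺ (t ^ s))
        (λ {x} _ → let (T , h) = traceOf (finToFun {t} {s} x) in T , to (traces T) (y (finToFun {t} {s} x) , h) , refl)
        (λ p q → finToFun-injective {s} {t} (traceOf-injective (trans (sym p) q))))

  record Row {m} (K L : DefinableSubgroup m) (t : ℕ) : Set c where
    field
      as    : Fin t → Vec M m
      as∈   : ∀ j → ⟨ L ⟩ (as j)
      as∉   : ∀ j → ¬ ⟨ K ⟩ (as j)
      apart : ∀ i j → i ≢ j → ¬ DoubleCoset ⟨ K ⟩ (as i) (as j)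
  open Row

  -- The greedy choice runs among the elements of `L` with K ≲ aKa⁻¹: their double cosets are
  -- covered by finitely many cosets of `K`, whereas by `normalising-large` the set of all of them
  -- is not.
  row : Saturated 𝕄 → OneBased G → ∀ {m} (K L : DefinableSubgroup m) → ¬ ⟨ L ⟩ ≲ ⟨ K ⟩ → ∀ t → Row K L t
  row saturated oneBased {m} K L L⋦K t =
    let (as , in-V , apart) = separated {V = V} {K = ⟨ K ⟩} (DoubleCoset ⟨ K ⟩) (DoubleCoset-sym (sub K))
                                (λ (_ , n) → DoubleCoset≲ (sub K) n) (normalising-large K saturated oneBased L L⋦K) t
    in record { as = as ; as∈ = λ j → proj₁ (proj₁ (in-V j)) ; as∉ = λ j → proj₂ (in-V j) ; apart = apart }
    where
    V : Pred (Vec M m) c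
    V x = ⟨ L ⟩ x × ⟨ K ⟩ ≲ conj x ⟨ K ⟩

  -- All factors of `y η` except the i-th lie in the i-th subgroup, so the product stays in the
  -- double coset of its i-th factor and avoids those of the other entries in row `i`.
  grid : ∀ {m t} {Ks : List (DefinableSubgroup m)} (F : DoubleCosetFormula Ks)
         (others : Fin (length Ks) → List (DefinableSubgroup m)) →
         (∀ i j → j ≢ i → List.lookup Ks j ∈ others i) →
         (∀ i → Row (List.lookup Ks i) (⋂ˢ (others i)) t) →
         Grid (DoubleCosetFormula.ψ F) (length Ks) t
  grid {m} {t} {Ks} F others ∈others rows = record
    { o    = λ i j → proj₁ (object i j)
    ; y    = y
    ; spec = λ i j η → ⇔.trans (proj₂ (object i j) (y η)) (mk⇔ (only i j η) (λ e → subst (λ j → D i j (y η)) (sym e) (in-product i η)))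
    }
    where
    D : ∀ i → Fin t → Pred (Vec M m) c
    D i j = DoubleCoset ⟨ List.lookup Ks i ⟩ (as (rows i) j)
    y : (Fin (length Ks) → Fin t) → Vec M m
    y η = prod (λ i → as (rows i) (η i))
    object : ∀ i j → Σ[ o ∈ Vec M _ ] (∀ (y : Vec M m) → 𝕄 ⊨ DoubleCosetFormula.ψ F [ o Vec.++ y ] ⇔ D i j y)
    object i j = DoubleCosetFormula.object F (∈-lookup i) (as (rows i) j) (as∉ (rows i) j)
    in-product : ∀ i η → D i (η i) (y η)
    in-product i η = prod-DoubleCoset (sub (List.lookup Ks i)) (λ i → as (rows i) (η i)) i λ j j≢i →
      ⋂-lookup {Ks = others j} (as∈ (rows j) (η j)) (∈others j i (j≢i ∘ sym))
    only : ∀ i j η → D i j (y η) → j ≡ η i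
    only i j η d with j ≟ η i
    ... | yes e = e
    ... | no j≢ = ⊥-elim (apart (rows i) j (η i) j≢
            (DoubleCoset-trans (sub (List.lookup Ks i)) d (DoubleCoset-sym (sub (List.lookup Ks i)) (in-product i η))))

  shatter-lower : Saturated 𝕄 → OneBased G → ∀ {m} (Ks : List (DefinableSubgroup m)) → Irredundant Ks →
    Σ[ len ∈ ℕ ] Σ[ ψ ∈ Formula language (len + m) ] ∀ t → 2 ≤ t →
      ∃[ v ] (IsShatterValue (instanceOf 𝕄 {len} {m} ψ) (length Ks * t) v × t ^ length Ks ≤ v)
  shatter-lower saturated oneBased Ks irr = DoubleCosetFormula.len F , DoubleCosetFormula.ψ F , λ t 2≤t →
    Grid-shatter 2≤t (grid F (λ i → proj₁ (lookup-↭ Ks i)) (λ i → proj₂ (proj₂ (lookup-↭ Ks i)))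
      λ i → row saturated oneBased (List.lookup Ks i) _ (irr (proj₁ (proj₂ (lookup-↭ Ks i)))) t)
    where
    F : DoubleCosetFormula Ks
    F = doubleCosetFormula Ks

-- Natural numbers as rationals.

fromℕ : ℕ → ℚ
fromℕ n = mkℚ (+ n) 0 (Coprimality.sym (Coprimality.1-coprimeTo n))

-- The fraction `fromℕ n` is given in lowest terms, so its numerator and denominator compute,
-- whereas `+ n / 1` waits for a gcd.
n/1≡fromℕ : ∀ n → + n / 1 ≡ fromℕ n
n/1≡fromℕ n = ℚₚ.↥p/↧p≡p (fromℕ n)

fromℕ-* : ∀ m n → fromℕ (m * n) ≡ fromℕ m ℚ.* fromℕ n
fromℕ-* m n = trans (sym (n/1≡fromℕ (m * n))) (cong (_/ 1) (ℤₚ.pos-* m n))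

0≤fromℕ : ∀ n → 0ℚ ℚ.≤ fromℕ n
0≤fromℕ n = *≤* (subst (+ 0 ℤ.≤_) (sym (ℤₚ.*-identityʳ (+ n))) (+≤+ z≤n))

fromℕ-≤ : ∀ n q → 0ℚ ℚ.≤ q → n * ↧ₙ q ≤ ∣ ↥ q ∣ → fromℕ n ℚ.≤ q
fromℕ-≤ n q 0≤q h = *≤* (subst₂ ℤ._≤_ (ℤₚ.pos-* n (↧ₙ q))
  (trans (ℤₚ.0≤i⇒+∣i∣≡i (subst (+ 0 ℤ.≤_) (ℤₚ.*-identityʳ (↥ q)) (ℚₚ.drop-*≤* 0≤q))) (sym (ℤₚ.*-identityʳ (↥ q)))) (+≤+ h))

-- A crude integral bound: the denominator is at least 1, so a positive rational does not exceed its
-- numerator.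
fromℕ<⇒≤ : ∀ n q → fromℕ n ℚ.< q → n ≤ ∣ ↥ q ∣
fromℕ<⇒≤ n q h = ℕₚ.≤-trans (ℕₚ.m≤m*n n (↧ₙ q)) (drop (subst₂ ℤ._≤_ (sym (ℤₚ.pos-* n (↧ₙ q))) (ℤₚ.*-identityʳ (↥ q)) (ℚₚ.drop-*≤* (ℚₚ.<⇒≤ h))))
  where
  drop : ∀ {i j} → + i ℤ.≤ j → i ≤ ∣ j ∣
  drop (+≤+ i≤j) = i≤j

-- The vc-density in terms of irredundant families.

module VCDensity (em : ∀ {a} → ExcludedMiddle a) {ℓ c} (G : ExpandedGroup ℓ c)
                 (saturated : Saturated (structure G)) (oneBased : OneBased G) where

  open ExpandedGroup G using (language)
  open OneBasedGroups em G
  open Irredundance em G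
  open Counting em
  open UpperBound em G
  open LowerBound em G

  growth-upper : ∀ {m b} → Bound m b → ∀ k (φ : Formula language (k + m)) → GrowthBound (instanceOf 𝕄 {k} {m} φ) (fromℕ b)
  growth-upper {b = b} bound k φ =
    let (C , h) = shatter-upper {k} bound oneBased φ
    -- The bound on cells needs n ≥ 1, whence the threshold 1; the exponent of `v` is the
    -- denominator 1.
    in 0≤fromℕ b , C , 1 , λ { (suc n) v _ isValue → subst (_≤ C * suc n ^ b) (sym (ℕₚ.*-identityʳ v)) (h (suc n) v isValue) }

  -- For r = u/d the growth bound on s t points gives t^(s d) ≤ C (s t)^u for all large t, which
  -- forces s d ≤ u.
  growth-lower : ∀ {m s len r} (ψ : Formula language (len + m)) →
    (∀ t → 2 ≤ t → ∃[ v ] (IsShatterValue (instanceOf 𝕄 {len} {m} ψ) (s * t) v × t ^ s ≤ v)) →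
    GrowthBound (instanceOf 𝕄 {len} {m} ψ) r → fromℕ s ℚ.≤ r
  growth-lower {s = zero}  {r = r} ψ many (0≤r , _) = fromℕ-≤ 0 r 0≤r z≤n
  growth-lower {s = suc s} {r = r} ψ many (0≤r , C , N , h) =
    -- The threshold 2 + N gives the two columns that `many` asks for and at least `N` points for
    -- the growth bound.
    fromℕ-≤ (suc s) r 0≤r (exponent-≤ (suc s) (suc s * ↧ₙ r) ∣ ↥ r ∣ C (2 + N) λ t 2+N≤t →
      let (v , isValue , t^s≤v) = many t (ℕₚ.≤-trans (ℕₚ.m≤m+n 2 N) 2+N≤t)
      in ℕₚ.≤-trans (ℕₚ.≤-reflexive (sym (ℕₚ.^-*-assoc t (suc s) (↧ₙ r))))
           (ℕₚ.≤-trans (ℕₚ.^-monoˡ-≤ (↧ₙ r) t^s≤v)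
             (h (suc s * t) v (ℕₚ.≤-trans (ℕₚ.≤-trans (ℕₚ.m≤n+m N 2) 2+N≤t) (ℕₚ.m≤n*m t (suc s))) isValue)))

  vcDensity-upper : ∀ {m b q} → Bound m b → fromℕ b ℚ.< q → Above (vcDensity 𝕄 m) q
  vcDensity-upper {b = b} bound b<q =
    let (r , b<r , r<q) = ℚₚ.<-dense b<q
    in r , ℚₚ.≤-trans (0≤fromℕ b) (ℚₚ.<⇒≤ b<r) , r<q , λ { (k , φ) → fromℕ b , growth-upper bound k φ , b<r }

  vcDensity-lower : ∀ {m q} (Ks : List (DefinableSubgroup m)) → Irredundant Ks → Above (vcDensity 𝕄 m) q →
                    fromℕ (length Ks) ℚ.< q
  vcDensity-lower Ks irr (r , _ , r<q , above) =
    let (len , ψ , many) = shatter-lower saturated oneBased Ks irr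
        (r′ , growth , r′<r) = above (len , ψ)
    in ℚₚ.≤-<-trans (growth-lower ψ many growth) (ℚₚ.<-trans r′<r r<q)

  -- Any bound at all yields an irredundant family of largest size, whose length is then the sharp
  -- bound b(m).
  maximal-irredundant : ∀ {m} B → Bound m B → Σ[ Ks ∈ List (DefinableSubgroup m) ] Irredundant Ks × Bound m (length Ks)
  maximal-irredundant {m} B bound with maximum {P = λ n → Σ[ Ks ∈ List (DefinableSubgroup m) ] Irredundant Ks × length Ks ≡ n}
                                      B (λ { _ (Ks , irr , refl) → bound Ks irr }) ([] , Irredundant-[] , refl)
  ... | _ , (Ks , irr , refl) , max = Ks , irr , λ Ls irr′ → max _ (Ls , irr′ , refl)

  module _ (n : ℕ) where

    private
      m : ℕ
      m = suc n
      m-pos : ℚ.Positive (+ m / 1)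
      m-pos = ℚₚ.normalize-pos m 1
      instance
        _ = m-pos
        _ = ℚₚ.pos⇒nonNeg (+ m / 1)
        _ = ℚₚ.pos⇒nonZero (+ m / 1)
      m*fromℕ : ∀ b → + m / 1 ℚ.* fromℕ b ≡ fromℕ (m * b)
      m*fromℕ b = trans (cong (ℚ._* fromℕ b) (n/1≡fromℕ m)) (sym (fromℕ-* m b))

    -- Placing an irredundant family of G in each of the m coordinates shows that m times its size
    -- is below `q`. Hence b(1) exists and is below q/m, and so is the vc-density at 1.
    linear-lower : ∀ {q} → Above (vcDensity 𝕄 m) q → Above (m · vcDensity 𝕄 1) q
    linear-lower {q} above =
      -- The numerator of `q` is only a first bound that secures a family of largest size; the sharp
      -- inequality comes from `m*irr<`.
      let (Ks , irr , bound) = maximal-irredundant ∣ ↥ q ∣ λ Ks irr →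
            ℕₚ.≤-trans (ℕₚ.m≤n*m (length Ks) m) (fromℕ<⇒≤ (m * length Ks) q (m*irr< Ks irr))
      in r , vcDensity-upper bound (ℚₚ.*-cancelˡ-<-nonNeg (+ m / 1)
               (subst₂ ℚ._<_ (sym (m*fromℕ (length Ks))) (sym m*r≡q) (m*irr< Ks irr)))
           , ℚₚ.≤-reflexive m*r≡q
      where
      r = ℚ.1/ (+ m / 1) ℚ.* q
      m*r≡q : + m / 1 ℚ.* r ≡ q
      m*r≡q = trans (sym (ℚₚ.*-assoc (+ m / 1) (ℚ.1/ (+ m / 1)) q))
                (trans (cong (ℚ._* q) (ℚₚ.*-inverseʳ (+ m / 1))) (ℚₚ.*-identityˡ q))
      m*irr< : ∀ (Ks : List (DefinableSubgroup 1)) → Irredundant Ks → fromℕ (m * length Ks) ℚ.< q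
      m*irr< Ks irr = let (Ls , irr′ , e) = Irredundant-* irr m
                      in subst (λ b → fromℕ b ℚ.< q) e (vcDensity-lower Ls irr′ above)

    -- A number `r` above the vc-density at 1 is above b(1), and `bound-*` gives b(m) ≤ m b(1) < m
    -- r.
    linear-upper : ∀ {q} → Above (m · vcDensity 𝕄 1) q → Above (vcDensity 𝕄 m) q
    linear-upper (r , above , m*r≤q) =
      let (Ks , irr , bound) = maximal-irredundant ∣ ↥ r ∣ λ Ks irr →
            fromℕ<⇒≤ (length Ks) r (vcDensity-lower Ks irr above)
      in vcDensity-upper (bound-* bound m) (ℚₚ.<-≤-trans
           (subst (ℚ._< + m / 1 ℚ.* r) (m*fromℕ (length Ks))
             (ℚₚ.*-monoʳ-<-pos (+ m / 1) (vcDensity-lower Ks irr above))) m*r≤q)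

corollary3p8 : (∀ {a} → ExcludedMiddle a) →
    ∀ {ℓ c} (G : ExpandedGroup ℓ c) →
    ℕ ↣ Carrier (structure G) →
    Saturated (structure G) →
    OneBased G →
    FiniteDpRank (x=x (structure G)) →
    ∀ (m : ℕ) .{{_ : NonZero m}} →
    vcDensity (structure G) m ≈ m · vcDensity (structure G) 1
corollary3p8 em G _ saturated oneBased _ (suc n) q = mk⇔ (linear-lower n) (linear-upper n)
  where open VCDensity em G saturated oneBased
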